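{- Let $r,k,e,i$ be fixed integers satisfying $i\ge 0$, $r\ge k+i+1\ge 2$ and $\binom{k+i+1}{k}\ge e\ge 3$. Then $f_r(n,e(r-k)+k+i+1,e)=o(n^k)$ as $n\to\infty$.
   Context: For integers $r,v,e$, an $r$-uniform hypergraph is called $\mathcal{G}_r(v,e)$-free if it does not contain $e$ distinct edges whose union has at most $v$ vertices (equivalently, the union of any $e$ distinct edges has at least $v+1$ vertices). $f_r(n,v,e)$ denotes the maximum number of edges in a $\mathcal{G}_r(v,e)$-free $r$-uniform hypergraph on $n$ vertices. -}

module Defs where

open import Data.Nat using (ℕ; suc; _+_; _*_; _∸_; _^_; _≤_; _<_)
open import Data.Nat.Combinatorics using (_C_)
open import Data.Fin using (Fin)
open import Data.Fin.Subset using (Subset; ⋃; ∣_∣)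
open import Data.Product using (Σ)
open import Data.List using (List; length; lookup; tabulate)
open import Data.List.Relation.Unary.All using (All)
open import Data.List.Relation.Unary.Unique.Propositional using (Unique)
open import Function.Definitions using (Injective)
open import Relation.Binary.PropositionalEquality using (_≡_)

record Hypergraph (n r : ℕ) : Set where
  field
    edges   : List (Subset n)
    unique  : Unique edges
    uniform : All (λ S → ∣ S ∣ ≡ r) edges

open Hypergraph public

numEdges : ∀ {n r} → Hypergraph n r → ℕ
numEdges H = length (edges H)

-- G_r(v,e)-free: the union of any e distinct edges has at least v+1 vertices.
-- "e distinct edges" = an injective choice of e edge positions (edges are
-- pairwise distinct as the list is Unique).
GFree : ∀ {n r} → (v e : ℕ) → Hypergraph n r → Set
GFree v e H =
  (σ : Fin e → Fin (numEdges H)) → Injective _≡_ _≡_ σ →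
  v < ∣ ⋃ (tabulate (λ j → lookup (edges H) (σ j))) ∣

-- f_r(n,v,e) = o(n^k): for every ε = 1/m > 0 there is N such that for all
-- n ≥ N every G_r(v,e)-free r-uniform hypergraph on n vertices has at most
-- ε·n^k edges (i.e. f_r(n,v,e) ≤ n^k / m).
LittleO-f : (r v e k : ℕ) → Set
LittleO-f r v e k =
  (m : ℕ) → 1 ≤ m →
  Σ ℕ (λ N → (n : ℕ) → N ≤ n → (H : Hypergraph n r) → GFree v e H →
             m * numEdges H ≤ n ^ k)

{-# OPTIONS --safe #-}
module Submission where

-- Suppose that a free hypergraph has more than n^k / m edges, and let t = k + i + 1.
-- Sending an edge to its first t vertices gives a set T of t-tuples.  Freeness bounds
-- by e the number of edges through k given vertices, so for events depending on at most
-- k coordinates the uniform measure on T is bounded by a constant times the uniform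
-- measure on all t-tuples.  The hypergraph removal lemma, in the form "a measure with
-- bounded k-dimensional marginals forces a positive proportion of all tuples to look,
-- on every k coordinates, like a tuple of T", yields (as only O(n^(t-1)) tuples are
-- degenerate) a tuple x whose k-subsets are covered by distinct edges.  Any e of them
-- have at most t + e (r - k) vertices together.
--
-- Removal: go through the index sets g, supersets first, each carrying a colouring of
-- its coordinates.  Every colour class of g is made regular relative to the colours of
-- the proper subsets of g by refining the latter (energy increment): up to a small
-- exceptional event it has density p there, with an error that is negligible against
-- all densities chosen later.  Most elements of T lie in colour classes that are neither
-- sparse nor exceptional.  For such a τ the tuples sharing all colours of τ can
-- be counted: replacing the classes by their densities one at a time, their proportion
-- is about the product of the p.

-- The obstacle is the order of the constants. Replacing a class by its density must cost little
-- even against the densities of lower classes, which exist only after the refinement that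
-- regularises the class. Each energy increment therefore yields two nested colourings: a coarse
-- one, which defines the densities and is passed on, and a finer one, which only witnesses
-- uniformity, at a precision dictated by the number of colours of the coarse one. The two densities
-- differ noticeably only on an exceptional event, whose measure the energy gap controls. Smallness
-- on average does not suffice there: the event must be rare inside the cell of τ, so τ with a rough
-- cell are discarded, and it must stay rare inside larger intersections, so the upper count carries
-- an arbitrary extra event. The budget for discarded τ is `ρ`: each index set contributes two
-- events of measure at most `ρ`, and `ρ` is about 1 over twice the number of index sets times e m.
-- All constants depend on t, k, e and m but not on n.

module HypergraphRemoval where
  open import Defs using (Hypergraph; edges; uniform; numEdges; GFree)
  open import Data.Bool using (Bool; true; false; _∧_; _∨_; if_then_else_)
  import Data.Bool.Properties as Boolₚ
  open import Data.Empty using (⊥; ⊥-elim)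
  open import Data.Fin using (Fin; zero; suc; inject≤)
  import Data.Fin.Properties as Finₚ
  open import Data.Fin.Subset
    using (Subset; _∈_; _∉_; _⊆_; _∩_; _∪_; ⁅_⁆; ⋃; ∣_∣; Nonempty; inside; outside)
    renaming (⊥ to ∅; ⊤ to full; _-_ to _∖_)
  open import Data.Fin.Subset.Properties
    using ( _⊆?_; _∈?_; nonempty?; ⊆-refl; ⊆-trans; ⊥⊆; ⊆⊤; ∉⊥; drop-there; Empty-unique; ∣⊥∣≡0; ∣p∣≤∣x∷p∣
          ; p∩q⊆p; p∩q⊆q; x∈p∩q⁺; p⊆p∪q; q⊆p∪q; x∈p∪q⁻; x∈p∪q⁺; ∪-identityˡ; ∣p∣≤∣p∪q∣; p⊆q⇒∣p∣≤∣q∣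
          ; x∈⁅x⁆; x∈p∧x≢y⇒x∈p-y; x∈p⇒∣p-x∣<∣p∣)
  import Data.Integer as ℤ
  import Data.Integer.Properties as ℤₚ
  open import Data.List as List using (List; []; _∷_; _++_; length; filter; allFin)
  import Data.List.Properties as Listₚ
  open import Data.List.Membership.Propositional using () renaming (_∈_ to _∈ˡ_)
  open import Data.List.Membership.Propositional.Properties
    using (∈-map⁺; ∈-map⁻; ∈-++⁺ˡ; ∈-++⁺ʳ; ∈-filter⁺; ∈-filter⁻; ∈-lookup; ∈-allFin)
  open import Data.List.Relation.Unary.All as All using (All; []; _∷_)
  import Data.List.Relation.Unary.All.Properties as Allₚ
  open import Data.List.Relation.Unary.AllPairs using (AllPairs; []; _∷_)
  import Data.List.Relation.Unary.AllPairs.Properties as AllPairsₚ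
  open import Data.List.Relation.Unary.Any using (here; there)
  open import Data.List.Relation.Unary.Unique.Propositional using (Unique)
  import Data.List.Relation.Unary.Unique.Propositional.Properties as Uniqueₚ
  open import Data.Nat as ℕ using (ℕ; zero; suc; z≤n; s≤s)
  import Data.Nat.Properties as ℕₚ
  open import Data.Nat.Combinatorics using (_C_; nCk≡nC[n∸k]; nCn≡1; nCk+nC[k+1]≡[n+1]C[k+1]; k>n⇒nCk≡0)
  open import Data.Product using (_×_; _,_; proj₁; proj₂; ∃)
  open import Data.Rational hiding (∣_∣)
  open import Data.Rational.Properties hiding (_≟_)
  import Data.Rational.Unnormalised as ℚᵘ
  import Data.Rational.Unnormalised.Properties as ℚᵘₚ
  open import Data.Sum using (_⊎_; inj₁; inj₂)
  open import Data.Unit using (tt) renaming (⊤ to Unit)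
  open import Data.Vec as Vec using (Vec; []; _∷_; lookup; here; there)
  import Data.Vec.Properties as Vecₚ
  open import Function.Definitions using (Injective)
  open import Relation.Binary.PropositionalEquality
  open import Relation.Nullary using (¬_; Dec; yes; no; does)
  open import Relation.Nullary.Decidable using (map′; _×-dec_; ¬?; dec-true; dec-false)
  open import Relation.Nullary.Decidable.Core using (dec⇒maybe)
  open import Tactic.RingSolver using (solve-∀)
  open import Tactic.RingSolver.Core.AlmostCommutativeRing using (AlmostCommutativeRing; fromCommutativeRing)

  -- Rational arithmetic and averages over tuples

  ℚ-ring : AlmostCommutativeRing _ _
  ℚ-ring = fromCommutativeRing +-*-commutativeRing (λ x → dec⇒maybe (0ℚ ≟ x))

  ≤-by : ∀ {a b} d → 0ℚ ≤ d → b ≡ a + d → a ≤ b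
  ≤-by {a} d 0≤d refl = subst (_≤ a + d) (+-identityʳ a) (+-monoʳ-≤ a 0≤d)

  a+[b-a] : ∀ a b → b ≡ a + (b - a)
  a+[b-a] = solve-∀ ℚ-ring

  0≤⇒≤ : ∀ {a b} → 0ℚ ≤ b - a → a ≤ b
  0≤⇒≤ {a} {b} h = ≤-by (b - a) h (a+[b-a] a b)

  ≤⇒0≤ : ∀ {a b} → a ≤ b → 0ℚ ≤ b - a
  ≤⇒0≤ {a} {b} h = subst (_≤ b - a) (+-inverseʳ a) (+-monoˡ-≤ (- a) h)

  0≤+ : ∀ {a b} → 0ℚ ≤ a → 0ℚ ≤ b → 0ℚ ≤ a + b
  0≤+ = +-mono-≤

  mulˡ : ∀ {a b c} → 0ℚ ≤ a → b ≤ c → a * b ≤ a * c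
  mulˡ {a} h = *-monoˡ-≤-nonNeg a {{nonNegative h}}

  mulʳ : ∀ {a b c} → 0ℚ ≤ a → b ≤ c → b * a ≤ c * a
  mulʳ {a} h = *-monoʳ-≤-nonNeg a {{nonNegative h}}

  0≤* : ∀ {a b} → 0ℚ ≤ a → 0ℚ ≤ b → 0ℚ ≤ a * b
  0≤* {a} {b} h k = subst (_≤ a * b) (*-zeroʳ a) (mulˡ h k)

  mul-mono : ∀ {a b c d} → 0ℚ ≤ a → 0ℚ ≤ d → a ≤ b → c ≤ d → a * c ≤ b * d
  mul-mono 0≤a 0≤d a≤b c≤d = ≤-trans (mulˡ 0≤a c≤d) (mulʳ 0≤d a≤b)

  0<* : ∀ {a b} → 0ℚ < a → 0ℚ < b → 0ℚ < a * b
  0<* {a} {b} h k = positive⁻¹ (a * b) {{pos*pos⇒pos a {{positive h}} b {{positive k}}}}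

  cancel-*ˡ : ∀ {a b c} → 0ℚ < a → a * b ≤ a * c → b ≤ c
  cancel-*ˡ {a} h = *-cancelˡ-≤-pos a {{positive h}}

  neg*neg : ∀ a → (- a) * (- a) ≡ a * a
  neg*neg = solve-∀ ℚ-ring

  neg≡0- : ∀ a → - a ≡ 0ℚ - a
  neg≡0- = solve-∀ ℚ-ring

  0≤sq : ∀ a → 0ℚ ≤ a * a
  0≤sq a with ≤-total 0ℚ a
  ... | inj₁ h = 0≤* h h
  ... | inj₂ h = subst (0ℚ ≤_) (neg*neg a) (0≤* h' h')
    where
    h' : 0ℚ ≤ - a
    h' = subst (0ℚ ≤_) (sym (neg≡0- a)) (≤⇒0≤ h)

  0<1 : 0ℚ < 1ℚ
  0<1 = positive⁻¹ 1ℚ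

  0≤1 : 0ℚ ≤ 1ℚ
  0≤1 = <⇒≤ 0<1

  recip : ∀ {a} → 0ℚ < a → ℚ
  recip {a} h = (1/ a) {{pos⇒nonZero a {{positive h}}}}

  recip-inv : ∀ {a} (h : 0ℚ < a) → recip h * a ≡ 1ℚ
  recip-inv {a} h = *-inverseˡ a {{pos⇒nonZero a {{positive h}}}}

  0<recip : ∀ {a} (h : 0ℚ < a) → 0ℚ < recip h
  0<recip {a} h = positive⁻¹ (recip h) {{1/pos⇒pos a {{positive h}}}}

  ι : ℕ → ℚ
  ι zero    = 0ℚ
  ι (suc n) = 1ℚ + ι n

  ι-+ : ∀ m n → ι (m ℕ.+ n) ≡ ι m + ι n
  ι-+ zero    n = sym (+-identityˡ (ι n))
  ι-+ (suc m) n = trans (cong (1ℚ +_) (ι-+ m n)) (sym (+-assoc 1ℚ (ι m) (ι n)))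

  ι-* : ∀ m n → ι (m ℕ.* n) ≡ ι m * ι n
  ι-* zero    n = sym (*-zeroˡ (ι n))
  ι-* (suc m) n = trans (ι-+ n (m ℕ.* n)) (trans (cong (ι n +_) (ι-* m n)) (lem (ι m) (ι n)))
    where
    lem : ∀ a b → b + a * b ≡ (1ℚ + a) * b
    lem = solve-∀ ℚ-ring

  0≤ι : ∀ n → 0ℚ ≤ ι n
  0≤ι zero    = ≤-refl
  0≤ι (suc n) = 0≤+ 0≤1 (0≤ι n)

  0<ι : ∀ n → 0ℚ < ι (suc n)
  0<ι n = <-≤-trans 0<1 (≤-by (ι n) (0≤ι n) refl)

  ι-mono : ∀ {m n} → m ℕ.≤ n → ι m ≤ ι n
  ι-mono {n = n} ℕ.z≤n = 0≤ι n
  ι-mono (ℕ.s≤s h)     = +-monoʳ-≤ 1ℚ (ι-mono h)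

  ι-mono-< : ∀ {m n} → m ℕ.< n → ι m < ι n
  ι-mono-< {m} h = <-≤-trans (subst (_< ι (suc m)) (+-identityˡ (ι m)) (+-monoˡ-< (ι m) 0<1)) (ι-mono h)

  -- 1/ι 0 = 1.
  abstract
    1/ι : ℕ → ℚ
    1/ι n = recip (0<ι (ℕ.pred n))

    1/ι-inv : ∀ n → 1/ι (suc n) * ι (suc n) ≡ 1ℚ
    1/ι-inv n = recip-inv (0<ι n)

    0<1/ι : ∀ n → 0ℚ < 1/ι n
    0<1/ι n = 0<recip (0<ι (ℕ.pred n))

  ⟦_⟧ : Bool → ℚ
  ⟦ true ⟧  = 1ℚ
  ⟦ false ⟧ = 0ℚ

  ⟦⟧-∧ : ∀ a b → ⟦ a ∧ b ⟧ ≡ ⟦ a ⟧ * ⟦ b ⟧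
  ⟦⟧-∧ true  b = sym (*-identityˡ ⟦ b ⟧)
  ⟦⟧-∧ false b = sym (*-zeroˡ ⟦ b ⟧)

  0≤⟦⟧ : ∀ b → 0ℚ ≤ ⟦ b ⟧
  0≤⟦⟧ true  = 0≤1
  0≤⟦⟧ false = ≤-refl

  ⟦⟧≤1 : ∀ b → ⟦ b ⟧ ≤ 1ℚ
  ⟦⟧≤1 true  = ≤-refl
  ⟦⟧≤1 false = 0≤1

  ⟦⟧-mono : ∀ {a b} → (a ≡ true → b ≡ true) → ⟦ a ⟧ ≤ ⟦ b ⟧
  ⟦⟧-mono {false} {b} h = 0≤⟦⟧ b
  ⟦⟧-mono {true} {b}  h rewrite h refl = ≤-refl

  sumF : ∀ {n} → (Fin n → ℚ) → ℚ
  sumF {zero}  f = 0ℚ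
  sumF {suc n} f = f zero + sumF (λ i → f (suc i))

  sumF-cong : ∀ {n} {f g : Fin n → ℚ} → (∀ i → f i ≡ g i) → sumF f ≡ sumF g
  sumF-cong {zero}  h = refl
  sumF-cong {suc n} h = cong₂ _+_ (h zero) (sumF-cong (λ i → h (suc i)))

  sumF-mono : ∀ {n} {f g : Fin n → ℚ} → (∀ i → f i ≤ g i) → sumF f ≤ sumF g
  sumF-mono {zero}  h = ≤-refl
  sumF-mono {suc n} h = +-mono-≤ (h zero) (sumF-mono (λ i → h (suc i)))

  interchange : ∀ a b c d → a + b + (c + d) ≡ a + c + (b + d)
  interchange = solve-∀ ℚ-ring

  sumF-+ : ∀ {n} (f g : Fin n → ℚ) → sumF (λ i → f i + g i) ≡ sumF f + sumF g
  sumF-+ {zero}  f g = refl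
  sumF-+ {suc n} f g = trans (cong (f zero + g zero +_) (sumF-+ (λ i → f (suc i)) (λ i → g (suc i))))
    (interchange (f zero) (g zero) _ _)

  sumF-* : ∀ {n} c (f : Fin n → ℚ) → sumF (λ i → c * f i) ≡ c * sumF f
  sumF-* {zero}  c f = sym (*-zeroʳ c)
  sumF-* {suc n} c f = trans (cong (c * f zero +_) (sumF-* c (λ i → f (suc i)))) (sym (*-distribˡ-+ c _ _))

  sumF-const : ∀ n c → sumF {n} (λ _ → c) ≡ ι n * c
  sumF-const zero    c = sym (*-zeroˡ c)
  sumF-const (suc n) c = trans (cong (c +_) (sumF-const n c)) (lem (ι n) c)
    where
    lem : ∀ a b → b + a * b ≡ (1ℚ + a) * b
    lem = solve-∀ ℚ-ring

  sumF-swap : ∀ {m n} (f : Fin m → Fin n → ℚ) →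
    sumF (λ i → sumF (λ j → f i j)) ≡ sumF (λ j → sumF (λ i → f i j))
  sumF-swap {zero} {n} f = sym (trans (sumF-const n 0ℚ) (*-zeroʳ (ι n)))
  sumF-swap {suc m} f = trans (cong (sumF (f zero) +_) (sumF-swap (λ i → f (suc i))))
    (sym (sumF-+ (f zero) (λ j → sumF (λ i → f (suc i) j))))

  module Expectation (ν : ℕ) where
    V : Set
    V = Fin (suc ν)

    X : ℕ → Set
    X t = Vec V t

    abstract
      avg : (V → ℚ) → ℚ
      avg f = 1/ι (suc ν) * sumF f

      avg-cong : ∀ {f g : V → ℚ} → (∀ i → f i ≡ g i) → avg f ≡ avg g
      avg-cong h = cong (1/ι (suc ν) *_) (sumF-cong h)

      avg-mono : ∀ {f g : V → ℚ} → (∀ i → f i ≤ g i) → avg f ≤ avg g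
      avg-mono h = mulˡ (<⇒≤ (0<1/ι (suc ν))) (sumF-mono h)

      avg-+ : ∀ f g → avg (λ i → f i + g i) ≡ avg f + avg g
      avg-+ f g = trans (cong (1/ι (suc ν) *_) (sumF-+ f g)) (*-distribˡ-+ (1/ι (suc ν)) _ _)

      avg-* : ∀ c f → avg (λ i → c * f i) ≡ c * avg f
      avg-* c f = trans (cong (1/ι (suc ν) *_) (sumF-* c f)) (lem (1/ι (suc ν)) c (sumF f))
        where
        lem : ∀ a b c → a * (b * c) ≡ b * (a * c)
        lem = solve-∀ ℚ-ring

      avg-const : ∀ c → avg (λ _ → c) ≡ c
      avg-const c = trans (cong (1/ι (suc ν) *_) (sumF-const (suc ν) c))
        (trans (sym (*-assoc (1/ι (suc ν)) (ι (suc ν)) c))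
          (trans (cong (_* c) (1/ι-inv ν)) (*-identityˡ c)))

      avg-swap : (f : V → V → ℚ) → avg (λ i → avg (f i)) ≡ avg (λ j → avg (λ i → f i j))
      avg-swap f = lem (1/ι (suc ν))
        where
        lem : ∀ w → w * sumF (λ i → w * sumF (f i)) ≡ w * sumF (λ j → w * sumF (λ i → f i j))
        lem w = cong (w *_) (trans (sumF-* w (λ i → sumF (f i)))
          (trans (cong (w *_) (sumF-swap f)) (sym (sumF-* w (λ j → sumF (λ i → f i j))))))

      point : ∀ {f : V → ℚ} → (∀ i → 0ℚ ≤ f i) → ∀ i → 1/ι (suc ν) * f i ≤ avg f
      point h i = mulˡ (<⇒≤ (0<1/ι (suc ν))) (lem h i)
        where
        lem : ∀ {n} {f : Fin n → ℚ} → (∀ i → 0ℚ ≤ f i) → ∀ i → f i ≤ sumF f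
        lem {suc n} {f} h zero    = ≤-by _ (subst (_≤ sumF (λ i → f (suc i))) (trans (sumF-const n 0ℚ) (*-zeroʳ (ι n))) (sumF-mono (λ i → h (suc i)))) refl
        lem {suc n} {f} h (suc i) = ≤-trans (lem (λ i → h (suc i)) i) (≤-by (f zero) (h zero) (+-comm (f zero) _))

      avg-single : ∀ (f : V → ℚ) i → (∀ j → j ≢ i → f j ≡ 0ℚ) → avg f ≡ 1/ι (suc ν) * f i
      avg-single f i h = cong (1/ι (suc ν) *_) (lem f i h)
        where
        lem : ∀ {n} (f : Fin n → ℚ) i → (∀ j → j ≢ i → f j ≡ 0ℚ) → sumF f ≡ f i
        lem {suc n} f zero h = trans (cong (f zero +_) (trans (sumF-cong (λ j → h (suc j) (λ ()))) (trans (sumF-const n 0ℚ) (*-zeroʳ (ι n))))) (+-identityʳ (f zero))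
        lem {suc n} f (suc i) h = trans (cong₂ _+_ (h zero (λ ())) (lem (λ j → f (suc j)) i (λ j j≢i → h (suc j) (λ { refl → j≢i refl })))) (+-identityˡ _)

    E : ∀ {t} → (X t → ℚ) → ℚ
    E {zero}  f = f []
    E {suc t} f = avg (λ v → E (λ xs → f (v ∷ xs)))

    E-cong : ∀ {t} {f g : X t → ℚ} → (∀ x → f x ≡ g x) → E f ≡ E g
    E-cong {zero}  h = h []
    E-cong {suc t} h = avg-cong (λ v → E-cong (λ xs → h (v ∷ xs)))

    E-mono : ∀ {t} {f g : X t → ℚ} → (∀ x → f x ≤ g x) → E f ≤ E g
    E-mono {zero}  h = h []
    E-mono {suc t} h = avg-mono (λ v → E-mono (λ xs → h (v ∷ xs)))

    E-+ : ∀ {t} (f g : X t → ℚ) → E (λ x → f x + g x) ≡ E f + E g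
    E-+ {zero}  f g = refl
    E-+ {suc t} f g = trans (avg-cong (λ v → E-+ (λ xs → f (v ∷ xs)) (λ xs → g (v ∷ xs)))) (avg-+ _ _)

    E-* : ∀ {t} c (f : X t → ℚ) → E (λ x → c * f x) ≡ c * E f
    E-* {zero}  c f = refl
    E-* {suc t} c f = trans (avg-cong (λ v → E-* c (λ xs → f (v ∷ xs)))) (avg-* c _)

    E-const : ∀ {t} c → E {t} (λ _ → c) ≡ c
    E-const {zero}  c = refl
    E-const {suc t} c = trans (avg-cong (λ v → E-const {t} c)) (avg-const c)

    E-avg : ∀ {t} (f : X t → V → ℚ) → E (λ x → avg (f x)) ≡ avg (λ v → E (λ x → f x v))
    E-avg {zero}  f = refl
    E-avg {suc t} f = trans (avg-cong (λ v → E-avg (λ xs → f (v ∷ xs)))) (avg-swap _)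

    E-swap : ∀ {s t} (f : X s → X t → ℚ) → E (λ x → E (λ y → f x y)) ≡ E (λ y → E (λ x → f x y))
    E-swap {zero}  f = refl
    E-swap {suc s} f = trans (avg-cong (λ v → E-swap (λ xs → f (v ∷ xs))))
      (sym (E-avg (λ y v → E (λ xs → f (v ∷ xs) y))))

    merge : ∀ {t} → Vec Bool t → X t → X t → X t
    merge []          []       []       = []
    merge (true ∷ g)  (x ∷ xs) (y ∷ ys) = x ∷ merge g xs ys
    merge (false ∷ g) (x ∷ xs) (y ∷ ys) = y ∷ merge g xs ys

    -- Mixing two independent uniform tuples coordinatewise gives a uniform tuple. This permits
    -- freezing the coordinates outside `g` at those of `y` while averaging over the rest.
    E-merge : ∀ {t} (g : Vec Bool t) (f : X t → ℚ) → E (λ y → E (λ x → f (merge g x y))) ≡ E f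
    E-merge [] f = refl
    E-merge (true ∷ g) f = begin
      avg (λ b → E (λ ys → avg (λ a → E (λ xs → f (a ∷ merge g xs ys)))))
        ≡⟨ avg-const _ ⟩
      E (λ ys → avg (λ a → E (λ xs → f (a ∷ merge g xs ys))))
        ≡⟨ E-avg (λ ys a → E (λ xs → f (a ∷ merge g xs ys))) ⟩
      avg (λ a → E (λ ys → E (λ xs → f (a ∷ merge g xs ys))))
        ≡⟨ avg-cong (λ a → E-merge g (λ xs → f (a ∷ xs))) ⟩
      avg (λ a → E (λ xs → f (a ∷ xs))) ∎
      where open ≡-Reasoning
    E-merge (false ∷ g) f = avg-cong (λ b → trans
      (E-cong (λ ys → avg-const (E (λ xs → f (b ∷ merge g xs ys))))) (E-merge g (λ xs → f (b ∷ xs))))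

    E-0 : ∀ {t} {f : X t → ℚ} → (∀ x → 0ℚ ≤ f x) → 0ℚ ≤ E f
    E-0 {t} {f} h = subst (_≤ E f) (E-const {t} 0ℚ) (E-mono h)

    -- A single tuple already has positive weight. Hence every cell of a partition has positive mass
    -- and conditional expectations can be defined by division.
    E-pos : ∀ {t} {f : X t → ℚ} → (∀ x → 0ℚ ≤ f x) → ∀ x → 0ℚ < f x → 0ℚ < E f
    E-pos {zero}  h []       p = p
    E-pos {suc t} {f} h (v ∷ xs) p = <-≤-trans
      (0<* (0<1/ι (suc ν)) (E-pos {f = λ ys → f (v ∷ ys)} (λ ys → h (v ∷ ys)) xs p))
      (point {λ u → E (λ ys → f (u ∷ ys))} (λ u → E-0 {f = λ ys → f (u ∷ ys)} (λ ys → h (u ∷ ys))) v)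

    E-minus : ∀ {t} (f g : X t → ℚ) → E (λ x → f x - g x) ≡ E f - E g
    E-minus f g = trans (E-cong (λ x → lem (f x) (g x)))
      (trans (E-+ f (λ x → (- 1ℚ) * g x))
        (trans (cong (E f +_) (E-* (- 1ℚ) g)) (sym (lem (E f) (E g)))))
      where
      lem : ∀ a b → a - b ≡ a + (- 1ℚ) * b
      lem = solve-∀ ℚ-ring


  -- Conditional expectations

  recip-cong : ∀ {a b} (h : 0ℚ < a) (k : 0ℚ < b) → a ≡ b → recip h ≡ recip k
  recip-cong h k refl = refl

  ⟦⟧-guard : ∀ b {u v} → (b ≡ true → u ≡ v) → ⟦ b ⟧ * u ≡ ⟦ b ⟧ * v
  ⟦⟧-guard true  h = cong (1ℚ *_) (h refl)
  ⟦⟧-guard false {u} {v} h = trans (*-zeroˡ u) (sym (*-zeroˡ v))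

  ⟦⟧-idem : ∀ b → ⟦ b ⟧ * ⟦ b ⟧ ≡ ⟦ b ⟧
  ⟦⟧-idem true  = refl
  ⟦⟧-idem false = refl

  *-≤1 : ∀ {a b} → 0ℚ ≤ b → a ≤ 1ℚ → a * b ≤ b
  *-≤1 {a} {b} h k = subst (a * b ≤_) (*-identityˡ b) (mulʳ h k)

  module Conditional (ν t : ℕ) where
    open Expectation ν

    record Partition : Set where
      field
        rel   : X t → X t → Bool
        reflR : ∀ x → rel x x ≡ true
        symR  : ∀ {x y} → rel x y ≡ true → rel y x ≡ true
        transR : ∀ {x y z} → rel x y ≡ true → rel y z ≡ true → rel x z ≡ true

    Measurable : ∀ {A : Set} → Partition → (X t → A) → Set
    Measurable P b = ∀ {x y} → Partition.rel P x y ≡ true → b x ≡ b y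

    Finer : Partition → Partition → Set
    Finer P′ P = ∀ {x y} → Partition.rel P′ x y ≡ true → Partition.rel P x y ≡ true

    module _ (P : Partition) where
      open Partition P

      rel-congˡ : ∀ {x y} → rel x y ≡ true → ∀ z → rel x z ≡ rel y z
      rel-congˡ {x} {y} x~y z with rel x z in p | rel y z in q
      ... | true  | true  = refl
      ... | false | false = refl
      ... | true  | false = trans (sym (transR (symR x~y) p)) q
      ... | false | true  = trans (sym p) (transR x~y q)

      rel-comm : ∀ x y → rel x y ≡ rel y x
      rel-comm x y with rel x y in p | rel y x in q
      ... | true  | true  = refl
      ... | false | false = refl
      ... | true  | false = trans (sym (symR p)) q
      ... | false | true  = trans (sym p) (symR q)

      mass : X t → ℚ
      mass x = E (λ y → ⟦ rel x y ⟧)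

      0<mass : ∀ x → 0ℚ < mass x
      0<mass x = E-pos (λ y → 0≤⟦⟧ (rel x y)) x (subst (λ b → 0ℚ < ⟦ b ⟧) (sym (reflR x)) 0<1)

      mass-meas : Measurable P mass
      mass-meas x~y = E-cong (λ z → cong ⟦_⟧ (rel-congˡ x~y z))

      abstract
        inv : X t → ℚ
        inv x = recip (0<mass x)

        inv-mass : ∀ x → inv x * mass x ≡ 1ℚ
        inv-mass x = recip-inv (0<mass x)

        0<inv : ∀ x → 0ℚ < inv x
        0<inv x = 0<recip (0<mass x)

        inv-meas : Measurable P inv
        inv-meas {x} {y} x~y = recip-cong (0<mass x) (0<mass y) (mass-meas x~y)

      cexp : (X t → ℚ) → X t → ℚ
      cexp f x = inv x * E (λ y → ⟦ rel x y ⟧ * f y)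

      cexp-meas : ∀ f → Measurable P (cexp f)
      cexp-meas f x~y = cong₂ _*_ (inv-meas x~y) (E-cong (λ z → cong (λ b → ⟦ b ⟧ * f z) (rel-congˡ x~y z)))

      -- Exchange the two averages: the kernel `inv x * ⟦ rel x y ⟧` is symmetric because `inv` is
      -- constant on cells, and `b` may be moved from `x` to `y` for the same reason.
      cexp-orth : ∀ f b → Measurable P b → E (λ x → cexp f x * b x) ≡ E (λ x → f x * b x)
      cexp-orth f b b-meas = begin
        E (λ x → inv x * E (λ y → ⟦ rel x y ⟧ * f y) * b x)
          ≡⟨ E-cong (λ x → trans (lem₁ (inv x) (E (λ y → ⟦ rel x y ⟧ * f y)) (b x))
               (sym (E-* (inv x * b x) (λ y → ⟦ rel x y ⟧ * f y)))) ⟩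
        E (λ x → E (λ y → inv x * b x * (⟦ rel x y ⟧ * f y)))
          ≡⟨ E-swap (λ x y → inv x * b x * (⟦ rel x y ⟧ * f y)) ⟩
        E (λ y → E (λ x → inv x * b x * (⟦ rel x y ⟧ * f y)))
          ≡⟨ E-cong (λ y → E-cong (λ x → step x y)) ⟩
        E (λ y → E (λ x → inv y * b y * f y * ⟦ rel y x ⟧))
          ≡⟨ E-cong (λ y → E-* (inv y * b y * f y) (λ x → ⟦ rel y x ⟧)) ⟩
        E (λ y → inv y * b y * f y * mass y)
          ≡⟨ E-cong (λ y → trans (lem₃ (inv y) (b y) (f y) (mass y))
               (trans (cong (_* (f y * b y)) (inv-mass y)) (*-identityˡ (f y * b y)))) ⟩
        E (λ y → f y * b y) ∎
        where
        open ≡-Reasoning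
        lem₁ : ∀ a b c → a * b * c ≡ a * c * b
        lem₁ = solve-∀ ℚ-ring
        lem₂ : ∀ a b c d → a * b * (c * d) ≡ c * (a * b * d)
        lem₂ = solve-∀ ℚ-ring
        lem₃ : ∀ a b c d → a * b * c * d ≡ a * d * (c * b)
        lem₃ = solve-∀ ℚ-ring
        step : ∀ x y → inv x * b x * (⟦ rel x y ⟧ * f y) ≡ inv y * b y * f y * ⟦ rel y x ⟧
        step x y = trans (lem₂ (inv x) (b x) ⟦ rel x y ⟧ (f y))
          (trans (⟦⟧-guard (rel x y) (λ p → cong (_* f y) (cong₂ _*_ (inv-meas p) (b-meas p))))
            (trans (*-comm ⟦ rel x y ⟧ _) (cong (λ r → inv y * b y * f y * ⟦ r ⟧) (rel-comm x y))))

      cexp-0≤ : ∀ {f} → (∀ x → 0ℚ ≤ f x) → ∀ x → 0ℚ ≤ cexp f x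
      cexp-0≤ h x = 0≤* (<⇒≤ (0<inv x)) (E-0 (λ y → 0≤* (0≤⟦⟧ (rel x y)) (h y)))

      cexp-≤1 : ∀ {f} → (∀ x → f x ≤ 1ℚ) → ∀ x → cexp f x ≤ 1ℚ
      cexp-≤1 {f} h x = subst (cexp f x ≤_) (inv-mass x) (mulˡ (<⇒≤ (0<inv x))
        (E-mono (λ y → subst (⟦ rel x y ⟧ * f y ≤_) (*-identityʳ ⟦ rel x y ⟧) (mulˡ (0≤⟦⟧ (rel x y)) (h y)))))

      cexp-mass : ∀ f x → E (λ y → ⟦ rel x y ⟧ * f y) ≡ mass x * cexp f x
      cexp-mass f x = sym (trans (lem (mass x) (inv x) (E (λ y → ⟦ rel x y ⟧ * f y)))
        (trans (cong (_* E (λ y → ⟦ rel x y ⟧ * f y)) (inv-mass x)) (*-identityˡ _)))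
        where
        lem : ∀ a b c → a * (b * c) ≡ b * a * c
        lem = solve-∀ ℚ-ring

    -- The scalar `e` stays free for two uses: with 1 the expansion gives the Pythagorean identity,
    -- and with the correlation of `d` and `s` it gives a Cauchy-Schwarz bound without square roots.
    E-square : (d : X t → ℚ) → ∀ e (s : X t → ℚ) →
      E (λ x → (d x - e * s x) * (d x - e * s x)) ≡
      E (λ x → d x * d x) - (e + e) * E (λ x → d x * s x) + e * e * E (λ x → s x * s x)
    E-square d e s = begin
      E (λ x → (d x - e * s x) * (d x - e * s x))
        ≡⟨ E-cong (λ x → lem (d x) e (s x)) ⟩
      E (λ x → d x * d x - (e + e) * (d x * s x) + e * e * (s x * s x))
        ≡⟨ E-+ (λ x → d x * d x - (e + e) * (d x * s x)) (λ x → e * e * (s x * s x)) ⟩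
      E (λ x → d x * d x - (e + e) * (d x * s x)) + E (λ x → e * e * (s x * s x))
        ≡⟨ cong₂ _+_ (trans (E-minus (λ x → d x * d x) (λ x → (e + e) * (d x * s x)))
             (cong (λ z → E (λ x → d x * d x) - z) (E-* (e + e) (λ x → d x * s x))))
             (E-* (e * e) (λ x → s x * s x)) ⟩
      _ ∎
      where
      open ≡-Reasoning
      lem : ∀ a e c → (a - e * c) * (a - e * c) ≡ a * a - (e + e) * (a * c) + e * e * (c * c)
      lem = solve-∀ ℚ-ring

    module _ (P P′ : Partition) (P′≤P : Finer P′ P) (f : X t → ℚ) where
      private
        q q′ : X t → ℚ
        q  = cexp P f
        q′ = cexp P′ f

      -- The coarse `q` is also measurable for the finer partition, so in the cross term `q′` may be
      -- replaced by `f`, and then `f` by `q`.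
      pythagoras : E (λ x → (q′ x - q x) * (q′ x - q x)) ≡ E (λ x → q′ x * q′ x) - E (λ x → q x * q x)
      pythagoras = begin
        E (λ x → (q′ x - q x) * (q′ x - q x))
          ≡⟨ E-cong (λ x → cong (λ z → (q′ x - z) * (q′ x - z)) (sym (*-identityˡ (q x)))) ⟩
        E (λ x → (q′ x - 1ℚ * q x) * (q′ x - 1ℚ * q x))
          ≡⟨ E-square q′ 1ℚ q ⟩
        E (λ x → q′ x * q′ x) - (1ℚ + 1ℚ) * E (λ x → q′ x * q x) + 1ℚ * 1ℚ * E (λ x → q x * q x)
          ≡⟨ cong (λ z → E (λ x → q′ x * q′ x) - (1ℚ + 1ℚ) * z + 1ℚ * 1ℚ * E (λ x → q x * q x)) cross ⟩
        E (λ x → q′ x * q′ x) - (1ℚ + 1ℚ) * E (λ x → q x * q x) + 1ℚ * 1ℚ * E (λ x → q x * q x)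
          ≡⟨ lem (E (λ x → q′ x * q′ x)) (E (λ x → q x * q x)) ⟩
        E (λ x → q′ x * q′ x) - E (λ x → q x * q x) ∎
        where
        open ≡-Reasoning
        cross : E (λ x → q′ x * q x) ≡ E (λ x → q x * q x)
        cross = trans (cexp-orth P′ f q (λ r → cexp-meas P f (P′≤P r))) (sym (cexp-orth P f q (cexp-meas P f)))
        lem : ∀ a b → a - (1ℚ + 1ℚ) * b + 1ℚ * 1ℚ * b ≡ a - b
        lem = solve-∀ ℚ-ring

      energy-mono : E (λ x → q x * q x) ≤ E (λ x → q′ x * q′ x)
      energy-mono = 0≤⇒≤ (subst (0ℚ ≤_) pythagoras (E-0 (λ x → 0≤sq (q′ x - q x))))

      -- As `Φ` is measurable for the finer partition, it correlates with `q′ - q` exactly as with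
      -- `f - q`. The norm of `q′ - q` is then at least this correlation, since an indicator has
      -- norm at most 1.
      energy-gain : ∀ (Φ : X t → Bool) → Measurable P′ Φ →
        let e = E (λ x → (f x - q x) * ⟦ Φ x ⟧) in
        E (λ x → q x * q x) + e * e ≤ E (λ x → q′ x * q′ x)
      energy-gain Φ Φ-meas = 0≤⇒≤ (subst (0ℚ ≤_) (lem₂ (E (λ x → q′ x * q′ x)) (E (λ x → q x * q x)) (e * e))
          (subst (λ z → 0ℚ ≤ z - e * e) pythagoras (≤⇒0≤ e²≤d²)))
        where
        e = E (λ x → (f x - q x) * ⟦ Φ x ⟧)
        d : X t → ℚ
        d x = q′ x - q x
        s : X t → ℚ
        s x = ⟦ Φ x ⟧
        distrib : ∀ (a b c : X t → ℚ) → E (λ x → (a x - b x) * c x) ≡ E (λ x → a x * c x) - E (λ x → b x * c x)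
        distrib a b c = trans (E-cong (λ x → lem (a x) (b x) (c x))) (E-minus (λ x → a x * c x) (λ x → b x * c x))
          where
          lem : ∀ a b c → (a - b) * c ≡ a * c - b * c
          lem = solve-∀ ℚ-ring
        ds≡e : E (λ x → d x * s x) ≡ e
        ds≡e = trans (distrib q′ q s)
          (trans (cong (λ z → z - E (λ x → q x * s x)) (cexp-orth P′ f s (λ r → cong ⟦_⟧ (Φ-meas r))))
            (sym (distrib f q s)))
        ss≤1 : E (λ x → s x * s x) ≤ 1ℚ
        ss≤1 = subst (E (λ x → s x * s x) ≤_) (E-const {t} 1ℚ)
          (E-mono (λ x → subst (_≤ 1ℚ) (sym (⟦⟧-idem (Φ x))) (⟦⟧≤1 (Φ x))))
        lem₁ : ∀ a e s → a - (e + e) * e + e * e * s + e * e * (1ℚ - s) ≡ a - e * e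
        lem₁ = solve-∀ ℚ-ring
        lem₂ : ∀ a b c → a - b - c ≡ a - (b + c)
        lem₂ = solve-∀ ℚ-ring
        0≤₁ : 0ℚ ≤ E (λ x → d x * d x) - (e + e) * e + e * e * E (λ x → s x * s x)
        0≤₁ = subst (0ℚ ≤_) (trans (E-square d e s)
            (cong (λ z → E (λ x → d x * d x) - (e + e) * z + e * e * E (λ x → s x * s x)) ds≡e))
          (E-0 (λ x → 0≤sq (d x - e * s x)))
        e²≤d² : e * e ≤ E (λ x → d x * d x)
        e²≤d² = 0≤⇒≤ (subst (0ℚ ≤_) (lem₁ (E (λ x → d x * d x)) e (E (λ x → s x * s x)))
          (0≤+ 0≤₁ (0≤* (0≤sq e) (≤⇒0≤ ss≤1))))


  -- Dependence on coordinates

  does⇒ : ∀ {A : Set} (d : Dec A) → does d ≡ true → A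
  does⇒ (yes a) _ = a

  bool-ext : ∀ {a b} → (a ≡ true → b ≡ true) → (b ≡ true → a ≡ true) → a ≡ b
  bool-ext {true}  {true}  h k = refl
  bool-ext {false} {false} h k = refl
  bool-ext {true}  {false} h k = sym (h refl)
  bool-ext {false} {true}  h k = k refl

  abstract
    _≺_ : ℚ → ℚ → Bool
    a ≺ b = does (a <? b)

    ≺-elim : ∀ a b (P : Bool → Set) → (a < b → P true) → (b ≤ a → P false) → P (a ≺ b)
    ≺-elim a b P h k = by (a <? b)
      where
      by : (d : Dec (a < b)) → P (does d)
      by (yes p) = h p
      by (no ¬p) = k (≮⇒≥ ¬p)

    _==_ : ℕ → ℕ → Bool
    m == n = does (m ℕ.≟ n)

    ==⇒≡ : ∀ {m n} → m == n ≡ true → m ≡ n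
    ==⇒≡ {m} {n} = does⇒ (m ℕ.≟ n)

    ≡⇒== : ∀ {m n} → m ≡ n → m == n ≡ true
    ≡⇒== {m} {n} = dec-true (m ℕ.≟ n)

  subsets : ∀ t → List (Subset t)
  subsets zero    = [] ∷ []
  subsets (suc t) = List.map (inside ∷_) (subsets t) ++ List.map (outside ∷_) (subsets t)

  ∈-subsets : ∀ {t} (f : Subset t) → f ∈ˡ subsets t
  ∈-subsets [] = here refl
  ∈-subsets (true ∷ f)  = ∈-++⁺ˡ (∈-map⁺ (inside ∷_) (∈-subsets f))
  ∈-subsets {suc t} (false ∷ f) = ∈-++⁺ʳ (List.map (inside ∷_) (subsets t)) (∈-map⁺ (outside ∷_) (∈-subsets f))

  _⊊_ : ∀ {t} → Subset t → Subset t → Set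
  f ⊊ g = f ⊆ g × ¬ (g ⊆ f)

  _⊊?_ : ∀ {t} (f g : Subset t) → Dec (f ⊊ g)
  f ⊊? g = (f ⊆? g) ×-dec ¬? (g ⊆? f)

  all⊊? : ∀ {t} (g : Subset t) {P : Subset t → Set} → (∀ f → Dec (P f)) → Dec (∀ f → f ⊊ g → P f)
  all⊊? g {P} P? = map′
    (λ h f f⊊g → imp f (All.lookup h (∈-subsets f)) f⊊g)
    (λ h → All.tabulate (λ {f} _ → dec f (h f)))
    (All.all? Q? (subsets _))
    where
    data Q (f : Subset _) : Set where
      not⊊ : ¬ (f ⊊ g) → Q f
      holds : P f → Q f
    Q? : ∀ f → Dec (Q f)
    Q? f with f ⊊? g | P? f
    ... | no ¬a | _     = yes (not⊊ ¬a)
    ... | yes a | yes b = yes (holds b)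
    ... | yes a | no ¬b = no λ { (not⊊ ¬a) → ¬a a ; (holds b) → ¬b b }
    imp : ∀ f → Q f → f ⊊ g → P f
    imp f (not⊊ ¬a) a = ⊥-elim (¬a a)
    imp f (holds b) _ = b
    dec : ∀ f → (f ⊊ g → P f) → Q f
    dec f h with f ⊊? g
    ... | yes a = holds (h a)
    ... | no ¬a = not⊊ ¬a

  Σ< : ℕ → (ℕ → ℚ) → ℚ
  Σ< zero    u = 0ℚ
  Σ< (suc n) u = u n + Σ< n u

  Σ<-mono : ∀ n {u v : ℕ → ℚ} → (∀ a → u a ≤ v a) → Σ< n u ≤ Σ< n v
  Σ<-mono zero    h = ≤-refl
  Σ<-mono (suc n) h = +-mono-≤ (h n) (Σ<-mono n h)

  Σ<-bound : ∀ n {u : ℕ → ℚ} c → (∀ a → a ℕ.< n → u a ≤ c) → Σ< n u ≤ ι n * c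
  Σ<-bound zero c h = subst (0ℚ ≤_) (sym (*-zeroˡ c)) ≤-refl
  Σ<-bound (suc n) {u} c h = subst (u n + Σ< n u ≤_) (lem (ι n) c)
    (+-mono-≤ (h n ℕₚ.≤-refl) (Σ<-bound n c (λ a a<n → h a (ℕₚ.m≤n⇒m≤1+n a<n))))
    where
    lem : ∀ a b → b + a * b ≡ (1ℚ + a) * b
    lem = solve-∀ ℚ-ring

  Σ<-0≤ : ∀ n {u : ℕ → ℚ} → (∀ a → 0ℚ ≤ u a) → 0ℚ ≤ Σ< n u
  Σ<-0≤ zero    h = ≤-refl
  Σ<-0≤ (suc n) h = 0≤+ (h n) (Σ<-0≤ n h)

  Σ<-term : ∀ n {u : ℕ → ℚ} → (∀ a → 0ℚ ≤ u a) → ∀ {a} → a ℕ.< n → u a ≤ Σ< n u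
  Σ<-term (suc n) {u} h {a} (ℕ.s≤s a≤n) with a ℕ.≟ n
  ... | yes refl = ≤-by (Σ< n u) (Σ<-0≤ n h) refl
  ... | no a≢n = ≤-trans (Σ<-term n h (ℕₚ.≤∧≢⇒< a≤n a≢n)) (≤-by (u n) (h n) (+-comm (u n) _))

  Σ<-gain : ∀ n {u v : ℕ → ℚ} → (∀ a → u a ≤ v a) → ∀ {a} → a ℕ.< n → ∀ δ → u a + δ ≤ v a → Σ< n u + δ ≤ Σ< n v
  Σ<-gain (suc n) {u} {v} h {a} (ℕ.s≤s a≤n) δ k with a ℕ.≟ n
  ... | yes refl = subst (_≤ v n + Σ< n v) (lem (u n) δ (Σ< n u)) (+-mono-≤ k (Σ<-mono n h))
    where
    lem : ∀ a b c → a + b + c ≡ a + c + b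
    lem = solve-∀ ℚ-ring
  ... | no a≢n = subst (_≤ v n + Σ< n v) (sym (+-assoc (u n) (Σ< n u) δ))
    (+-mono-≤ (h n) (Σ<-gain n h (ℕₚ.≤∧≢⇒< a≤n a≢n) δ k))

  ∧-true : ∀ {a b} → a ≡ true → b ≡ true → a ∧ b ≡ true
  ∧-true refl refl = refl

  ∧-left : ∀ {a b} → a ∧ b ≡ true → a ≡ true
  ∧-left {true} _ = refl

  ∧-right : ∀ {a b} → a ∧ b ≡ true → b ≡ true
  ∧-right {true} p = p

  module Dependence (ν t : ℕ) where
    open Expectation ν
    open Conditional ν t

    Agree : Subset t → X t → X t → Set
    Agree g x y = ∀ {i} → i ∈ g → lookup x i ≡ lookup y i

    Dep : ∀ {A : Set} → Subset t → (X t → A) → Set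
    Dep g f = ∀ {x y} → Agree g x y → f x ≡ f y

    private
      merge-in′ : ∀ {t} (g : Subset t) (x y : Vec V t) {i} → i ∈ g → lookup (merge g x y) i ≡ lookup x i
      merge-in′ (true ∷ g)  (x ∷ xs) (y ∷ ys) here      = refl
      merge-in′ (true ∷ g)  (x ∷ xs) (y ∷ ys) (there p) = merge-in′ g xs ys p
      merge-in′ (false ∷ g) (x ∷ xs) (y ∷ ys) (there p) = merge-in′ g xs ys p

      merge-out′ : ∀ {t} (g : Subset t) (x y : Vec V t) {i} → i ∉ g → lookup (merge g x y) i ≡ lookup y i
      merge-out′ (true ∷ g)  (x ∷ xs) (y ∷ ys) {zero}  p = ⊥-elim (p here)
      merge-out′ (false ∷ g) (x ∷ xs) (y ∷ ys) {zero}  p = refl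
      merge-out′ (true ∷ g)  (x ∷ xs) (y ∷ ys) {suc i} p = merge-out′ g xs ys (λ q → p (there q))
      merge-out′ (false ∷ g) (x ∷ xs) (y ∷ ys) {suc i} p = merge-out′ g xs ys (λ q → p (there q))

    merge-in : ∀ g x y → Agree g (merge g x y) x
    merge-in g x y = merge-in′ g x y

    merge-agree : ∀ g h {x x′} y → Agree (g ∩ h) x x′ → Agree h (merge g x y) (merge g x′ y)
    merge-agree g h {x} {x′} y ag {i} i∈h with i ∈? g
    ... | yes i∈g = trans (merge-in′ g x y i∈g) (trans (ag (x∈p∩q⁺ (i∈g , i∈h))) (sym (merge-in′ g x′ y i∈g)))
    ... | no i∉g  = trans (merge-out′ g x y i∉g) (sym (merge-out′ g x′ y i∉g))

    -- A conjunction of events each depending on fewer coordinates than g once the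
    -- coordinates outside g are frozen.
    data Adm (g : Subset t) : (X t → Bool) → Set where
      top  : Adm g (λ _ → true)
      base : ∀ {ψ h} → Dep h ψ → ¬ (g ⊆ h) → Adm g ψ
      and  : ∀ {Φ Ψ} → Adm g Φ → Adm g Ψ → Adm g (λ x → Φ x ∧ Ψ x)

    -- The cylinder intersections against which classes on `g` are tested: `to` and `from` say that
    -- `Φ` is the conjunction of the `φ f`. One event for every `f` lets a single splitting refine
    -- all lower colours at once.
    record Str (g : Subset t) (Φ : X t → Bool) : Set where
      field
        φ    : Subset t → X t → Bool
        dep  : ∀ f → Dep f (φ f)
        to   : ∀ x → Φ x ≡ true → ∀ f → f ⊊ g → φ f x ≡ true
        from : ∀ x → (∀ f → f ⊊ g → φ f x ≡ true) → Φ x ≡ true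

    -- Once the coordinates outside `g` are frozen, an event on `h` depends on `g ∩ h` only, which
    -- is a proper subset as `h` does not contain `g`. All other subsets receive the trivial event.
    Adm⇒Str : ∀ {g Φ} → Adm g Φ → ∀ y → Str g (λ x → Φ (merge g x y))
    Adm⇒Str top y = record
      { φ = λ _ _ → true ; dep = λ _ _ → refl ; to = λ _ _ _ _ → refl ; from = λ _ _ → refl }
    Adm⇒Str (and a b) y = record
      { φ    = λ f x → A.φ f x ∧ B.φ f x
      ; dep  = λ f ag → cong₂ _∧_ (A.dep f ag) (B.dep f ag)
      ; to   = λ x p f f⊊g → ∧-true (A.to x (∧-left p) f f⊊g) (B.to x (∧-right p) f f⊊g)
      ; from = λ x h → ∧-true (A.from x (λ f f⊊g → ∧-left (h f f⊊g))) (B.from x (λ f f⊊g → ∧-right (h f f⊊g)))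
      }
      where
      module A = Str (Adm⇒Str a y)
      module B = Str (Adm⇒Str b y)
    Adm⇒Str {g} (base {ψ} {h} d g⊈h) y = record
      { φ = φ ; dep = dep ; to = λ x p f _ → to x p f ; from = λ x k → from x (k (g ∩ h) (p∩q⊆p g h , λ q → g⊈h (⊆-trans q (p∩q⊆q g h)))) }
      where
      _≟ˢ_ = Vecₚ.≡-dec Boolₚ._≟_
      φ : Subset t → X t → Bool
      φ f x = if does (f ≟ˢ (g ∩ h)) then ψ (merge g x y) else true
      dep : ∀ f → Dep f (φ f)
      dep f {x} {x′} ag with f ≟ˢ (g ∩ h)
      ... | yes refl = d (merge-agree g h y ag)
      ... | no _     = refl
      to : ∀ x → ψ (merge g x y) ≡ true → ∀ f → φ f x ≡ true
      to x p f with f ≟ˢ (g ∩ h)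
      ... | yes _ = p
      ... | no _  = refl
      from : ∀ x → φ (g ∩ h) x ≡ true → ψ (merge g x y) ≡ true
      from x p with (g ∩ h) ≟ˢ (g ∩ h)
      ... | yes _ = p
      ... | no ¬e = ⊥-elim (¬e refl)

    E-through-merge : ∀ g {u v : X t → ℚ} → Dep g u → Dep g v → ∀ (Φ : X t → Bool) κ →
      (∀ y → E (λ x → u x * ⟦ Φ (merge g x y) ⟧) ≤ E (λ x → v x * ⟦ Φ (merge g x y) ⟧) + κ) →
      E (λ x → u x * ⟦ Φ x ⟧) ≤ E (λ x → v x * ⟦ Φ x ⟧) + κ
    E-through-merge g {u} {v} du dv Φ κ h = begin
      E (λ x → u x * ⟦ Φ x ⟧)
        ≡⟨ sym (through u du) ⟩
      E (λ y → E (λ x → u x * ⟦ Φ (merge g x y) ⟧))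
        ≤⟨ E-mono h ⟩
      E (λ y → E (λ x → v x * ⟦ Φ (merge g x y) ⟧) + κ)
        ≡⟨ E-+ (λ y → E (λ x → v x * ⟦ Φ (merge g x y) ⟧)) (λ _ → κ) ⟩
      E (λ y → E (λ x → v x * ⟦ Φ (merge g x y) ⟧)) + E {t} (λ _ → κ)
        ≡⟨ cong₂ _+_ (through v dv) (E-const {t} κ) ⟩
      E (λ x → v x * ⟦ Φ x ⟧) + κ ∎
      where
      open ≤-Reasoning
      through : ∀ (w : X t → ℚ) → Dep g w → E (λ y → E (λ x → w x * ⟦ Φ (merge g x y) ⟧)) ≡ E (λ x → w x * ⟦ Φ x ⟧)
      through w dw = trans
        (E-cong (λ y → E-cong (λ x → cong (_* ⟦ Φ (merge g x y) ⟧) (sym (dw (merge-in g x y))))))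
        (E-merge g (λ x → w x * ⟦ Φ x ⟧))


  -- Regular colourings

  sq-large : ∀ {κ e} → 0ℚ ≤ κ → κ < e → κ * κ ≤ e * e
  sq-large {κ} {e} h k = mul-mono h (≤-trans h (<⇒≤ k)) (<⇒≤ k) (<⇒≤ k)

  sq-large⁻ : ∀ {κ e} → 0ℚ ≤ κ → e < - κ → κ * κ ≤ e * e
  sq-large⁻ {κ} {e} h k = subst (κ * κ ≤_) (neg*neg e) (sq-large h (subst (_< - e) (lem κ) (neg-antimono-< k)))
    where
    lem : ∀ a → - - a ≡ a
    lem = solve-∀ ℚ-ring

  sq-small : ∀ {κ e} → 0ℚ ≤ κ → e * e ≤ κ * κ → e ≤ κ
  sq-small {κ} {e} h k with κ <? e
  ... | no ¬p = ≮⇒≥ ¬p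
  ... | yes p = ⊥-elim (<-irrefl refl (<-≤-trans κκ<ee k))
    where
    κκ<ee : κ * κ < e * e
    κκ<ee = ≤-<-trans (mulˡ h (<⇒≤ p)) (*-monoˡ-<-pos e {{positive (≤-<-trans h p)}} p)

  minus-swap : ∀ a b → (a - b) * (a - b) ≡ (b - a) * (b - a)
  minus-swap = solve-∀ ℚ-ring

  grow : ℕ → ℕ → ℕ
  grow zero    L = L
  grow (suc m) L = grow m (L ℕ.+ L)

  ≤-grow : ∀ m L → L ℕ.≤ grow m L
  ≤-grow zero    L = ℕₚ.≤-refl
  ≤-grow (suc m) L = ℕₚ.≤-trans (ℕₚ.m≤m+n L L) (≤-grow m (L ℕ.+ L))

  -- The least value of `D` along the colour counts `L`, `grow (m L) L`, and so on, at which the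
  -- iteration in `strong` may come to a halt.
  stages : (ℕ → ℕ) → (ℕ → ℚ) → ℕ → ℕ → ℚ
  stages m D zero    L = 1ℚ
  stages m D (suc M) L = D L ⊓ stages m D M (grow (m L) L)

  0<⊓ : ∀ {a b} → 0ℚ < a → 0ℚ < b → 0ℚ < a ⊓ b
  0<⊓ {a} {b} h k with ⊓-sel a b
  ... | inj₁ e = subst (0ℚ <_) (sym e) h
  ... | inj₂ e = subst (0ℚ <_) (sym e) k

  0<stages : ∀ m {D} → (∀ L → 0ℚ < D L) → ∀ M L → 0ℚ < stages m D M L
  0<stages m 0<D zero    L = 0<1
  0<stages m 0<D (suc M) L = 0<⊓ (0<D L) (0<stages m 0<D M (grow (m L) L))

  module Regularity (ν t : ℕ) where
    open Expectation ν
    open Conditional ν t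
    open Dependence ν t

    Colouring : Set
    Colouring = Subset t → X t → ℕ

    record Valid (c : Colouring) (L : ℕ) : Set where
      field
        dep   : ∀ f → Dep f (c f)
        bound : ∀ f x → c f x ℕ.< L

    colours : Subset t → Colouring → Partition
    colours g c = record
      { rel    = λ x y → does (same? x y)
      ; reflR  = λ x → dec-true (same? x x) (λ _ _ → refl)
      ; symR   = λ {x} {y} p → dec-true (same? y x) (λ f s → sym (does⇒ (same? x y) p f s))
      ; transR = λ {x} {y} {z} p q → dec-true (same? x z)
          (λ f s → trans (does⇒ (same? x y) p f s) (does⇒ (same? y z) q f s))
      }
      where
      same? : ∀ x y → Dec (∀ f → f ⊊ g → c f x ≡ c f y)
      same? x y = all⊊? g (λ f → c f x ℕ.≟ c f y)

    module _ (g : Subset t) (c : Colouring) where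
      colours-from : ∀ {x y} → Partition.rel (colours g c) x y ≡ true → ∀ f → f ⊊ g → c f x ≡ c f y
      colours-from {x} {y} = does⇒ (all⊊? g (λ f → c f x ℕ.≟ c f y))

      colours-to : ∀ {x y} → (∀ f → f ⊊ g → c f x ≡ c f y) → Partition.rel (colours g c) x y ≡ true
      colours-to {x} {y} = dec-true (all⊊? g (λ f → c f x ℕ.≟ c f y))

      colours-dep : ∀ {A : Set} {b : X t → A} → (∀ f → Dep f (c f)) → Measurable (colours g c) b → Dep g b
      colours-dep d m ag = m (colours-to (λ f f⊊g → d f (λ i∈f → ag (proj₁ f⊊g i∈f))))

    -- The clause `fixed` protects `g` itself and the index sets treated before it: none of them is
    -- a proper subset of `g`, so regularising `g` leaves their classes untouched.
    record Refines (g : Subset t) (c c′ : Colouring) : Set where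
      field
        finer : ∀ f {x y} → c′ f x ≡ c′ f y → c f x ≡ c f y
        fixed : ∀ f → ¬ (f ⊊ g) → ∀ x → c′ f x ≡ c f x

    refines-refl : ∀ {g c} → Refines g c c
    refines-refl = record { finer = λ _ p → p ; fixed = λ _ _ _ → refl }

    refines-trans : ∀ {g c c′ c″} → Refines g c c′ → Refines g c′ c″ → Refines g c c″
    refines-trans r s = record
      { finer = λ f p → Refines.finer r f (Refines.finer s f p)
      ; fixed = λ f n x → trans (Refines.fixed s f n x) (Refines.fixed r f n x)
      }

    colours-finer : ∀ {g c c′} → Refines g c c′ → Finer (colours g c′) (colours g c)
    colours-finer {g} {c} {c′} r p = colours-to g c (λ f f⊊g → Refines.finer r f (colours-from g c′ p f f⊊g))

    -- The old colour and the bit `φ f x` are packed into one number; colours below `L` make the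
    -- shift by `L` decodable.
    split : Subset t → (Subset t → X t → Bool) → ℕ → Colouring → Colouring
    split g φ L c f x = if does (f ⊊? g) then (if φ f x then L ℕ.+ c f x else c f x) else c f x

    module _ {g c L} (v : Valid c L) {Φ} (s : Str g Φ) where
      open Str s
      private
        c′ = split g φ L c
        open Valid v using (bound)

        inner : ∀ f x y → (if φ f x then L ℕ.+ c f x else c f x) ≡ (if φ f y then L ℕ.+ c f y else c f y) →
          φ f x ≡ φ f y × c f x ≡ c f y
        inner f x y p with φ f x | φ f y
        ... | true  | true  = refl , ℕₚ.+-cancelˡ-≡ L _ _ p
        ... | false | false = refl , p
        ... | true  | false = ⊥-elim (ℕₚ.<⇒≢ (ℕₚ.<-≤-trans (bound f y) (ℕₚ.m≤m+n L _)) (sym p))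
        ... | false | true  = ⊥-elim (ℕₚ.<⇒≢ (ℕₚ.<-≤-trans (bound f x) (ℕₚ.m≤m+n L _)) p)

      split-valid : Valid c′ (L ℕ.+ L)
      split-valid = record { dep = dep′ ; bound = bound′ }
        where
        dep′ : ∀ f → Dep f (c′ f)
        dep′ f {x} {y} ag = cong₂ (λ n b → if does (f ⊊? g) then (if b then L ℕ.+ n else n) else n)
          (Valid.dep v f ag) (dep f ag)
        bound′ : ∀ f x → c′ f x ℕ.< L ℕ.+ L
        bound′ f x with does (f ⊊? g) | φ f x
        ... | true  | true  = ℕₚ.+-monoʳ-< L (bound f x)
        ... | true  | false = ℕₚ.<-≤-trans (bound f x) (ℕₚ.m≤m+n L L)
        ... | false | _     = ℕₚ.<-≤-trans (bound f x) (ℕₚ.m≤m+n L L)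

      split-refines : Refines g c c′
      split-refines = record { finer = finer′ ; fixed = fixed′ }
        where
        finer′ : ∀ f {x y} → c′ f x ≡ c′ f y → c f x ≡ c f y
        finer′ f {x} {y} p with does (f ⊊? g)
        ... | true  = proj₂ (inner f x y p)
        ... | false = p
        fixed′ : ∀ f → ¬ (f ⊊ g) → ∀ x → c′ f x ≡ c f x
        fixed′ f n x rewrite dec-false (f ⊊? g) n = refl

      split-meas : Measurable (colours g c′) Φ
      split-meas {x} {y} p = bool-ext
        (λ q → from y (λ f f⊊g → trans (sym (eq f f⊊g)) (to x q f f⊊g)))
        (λ q → from x (λ f f⊊g → trans (eq f f⊊g) (to y q f f⊊g)))
        where
        eq : ∀ f → f ⊊ g → φ f x ≡ φ f y
        eq f f⊊g = proj₁ (inner f x y (subst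
          (λ b → (if b then (if φ f x then L ℕ.+ c f x else c f x) else c f x) ≡
                 (if b then (if φ f y then L ℕ.+ c f y else c f y) else c f y))
          (dec-true (f ⊊? g) f⊊g) (colours-from g c′ p f f⊊g)))

    valid-mono : ∀ {c L M} → L ℕ.≤ M → Valid c L → Valid c M
    valid-mono h v = record { dep = Valid.dep v ; bound = λ f x → ℕₚ.<-≤-trans (Valid.bound v f x) h }

    module Energy (g : Subset t) (γ : X t → ℕ) (L₀ : ℕ) where

      class : ℕ → X t → Bool
      class a x = γ x == a

      q : Colouring → ℕ → X t → ℚ
      q c a = cexp (colours g c) (λ x → ⟦ class a x ⟧)

      q-0≤ : ∀ c a x → 0ℚ ≤ q c a x
      q-0≤ c a = cexp-0≤ (colours g c) (λ x → 0≤⟦⟧ (class a x))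

      q-≤1 : ∀ c a x → q c a x ≤ 1ℚ
      q-≤1 c a = cexp-≤1 (colours g c) (λ x → ⟦⟧≤1 (class a x))

      sq : Colouring → ℕ → ℚ
      sq c a = E (λ x → q c a x * q c a x)

      energy : Colouring → ℚ
      energy c = Σ< L₀ (sq c)

      sq-mono : ∀ {c c′} → Refines g c c′ → ∀ a → sq c a ≤ sq c′ a
      sq-mono {c} {c′} r a = energy-mono (colours g c) (colours g c′) (colours-finer r) (λ x → ⟦ class a x ⟧)

      0≤energy : ∀ c → 0ℚ ≤ energy c
      0≤energy c = Σ<-0≤ L₀ (λ a → E-0 (λ x → 0≤sq (q c a x)))

      energy≤ : ∀ c → energy c ≤ ι L₀
      energy≤ c = subst (energy c ≤_) (*-identityʳ (ι L₀)) (Σ<-bound L₀ 1ℚ (λ a _ →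
        subst (sq c a ≤_) (E-const {t} 1ℚ) (E-mono (λ x →
          subst (q c a x * q c a x ≤_) (*-identityˡ 1ℚ) (mul-mono (q-0≤ c a x) 0≤1 (q-≤1 c a x) (q-≤1 c a x))))))

      discrepancy : Colouring → ℕ → (X t → Bool) → ℚ
      discrepancy c a Φ = E (λ x → (⟦ class a x ⟧ - q c a x) * ⟦ Φ x ⟧)

      Uniform : Colouring → ℚ → Set
      Uniform c κ = ∀ {a} → a ℕ.< L₀ → ∀ {Φ} → Str g Φ → discrepancy c a Φ ≤ κ × - κ ≤ discrepancy c a Φ

      -- Existence statements are in continuation-passing style with answer type ⊥: the
      -- bound to be proved in the end is decidable, so nothing is lost, and failure of
      -- uniformity may be assumed outright.
      weak : ∀ m {κ} → 0ℚ ≤ κ → ∀ {c L} → Valid c L → ι L₀ < energy c + ι m * (κ * κ) →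
        (∀ c′ → Valid c′ (grow m L) → Refines g c c′ → Uniform c′ κ → ⊥) → ⊥
      -- With no increments left, `big` places the energy above its maximum.
      weak zero {κ} 0≤κ {c} v big k = <-irrefl refl (<-≤-trans
        (subst (ι L₀ <_) (trans (cong (energy c +_) (*-zeroˡ (κ * κ))) (+-identityʳ _)) big) (energy≤ c))
      weak (suc m) {κ} 0≤κ {c} {L} v big k =
        -- The present `c` is claimed to be uniform. Should the continuation exhibit a violating
        -- event, the argument restarts from the colouring split along that event, with one
        -- increment spent.
        k c (valid-mono (≤-grow (suc m) L) v) refines-refl no-split
        where
        step : ∀ {a} → a ℕ.< L₀ → ∀ {Φ} → Str g Φ → κ * κ ≤ discrepancy c a Φ * discrepancy c a Φ → ⊥
        step {a} a<L₀ {Φ} s large = weak m 0≤κ (split-valid v s) big′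
          (λ c″ v″ r″ → k c″ v″ (refines-trans (split-refines v s) r″))
          where
          c′ = split g (Str.φ s) L c
          gain : energy c + κ * κ ≤ energy c′
          gain = ≤-trans (+-monoʳ-≤ (energy c) large)
            (Σ<-gain L₀ (sq-mono (split-refines v s)) a<L₀ _
              (energy-gain (colours g c) (colours g c′) (colours-finer (split-refines v s))
                (λ x → ⟦ class a x ⟧) Φ (split-meas v s)))
          lem : ∀ a b c → a + (1ℚ + b) * c ≡ a + c + b * c
          lem = solve-∀ ℚ-ring
          big′ : ι L₀ < energy c′ + ι m * (κ * κ)
          big′ = <-≤-trans (subst (ι L₀ <_) (lem (energy c) (ι m) (κ * κ)) big) (+-monoˡ-≤ (ι m * (κ * κ)) gain)
        no-split : Uniform c κ
        no-split a<L₀ {Φ} s = upper , lower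
          where
          upper : discrepancy c _ Φ ≤ κ
          upper with κ <? discrepancy c _ Φ
          ... | yes p = ⊥-elim (step a<L₀ s (sq-large 0≤κ p))
          ... | no ¬p = ≮⇒≥ ¬p
          lower : - κ ≤ discrepancy c _ Φ
          lower with discrepancy c _ Φ <? - κ
          ... | yes p = ⊥-elim (step a<L₀ s (sq-large⁻ 0≤κ p))
          ... | no ¬p = ≮⇒≥ ¬p

      module _ (κ : ℕ → ℚ) (0≤κ : ∀ L → 0ℚ ≤ κ L) (m : ℕ → ℕ) (m-large : ∀ L → ι L₀ < ι (m L) * (κ L * κ L))
               (D : ℕ → ℚ) {ε : ℚ} (0≤ε : 0ℚ ≤ ε) where

        -- Iterating `weak` makes the precision a function of the colour count of the coarse member
        -- of the pair. A round whose energy gap exceeds `ε` is charged to the bounded energy, so at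
        -- most `M` rounds occur. The final inequality for `stages` records that the stopping stage
        -- is one of those foreseen.
        strong : ∀ M {c L} → Valid c L → ι L₀ < energy c + ι M * ε →
          (∀ c₁ L₁ c₂ → Valid c₁ L₁ → (∀ f → Dep f (c₂ f)) → Refines g c c₁ → Refines g c₁ c₂ → Uniform c₂ (κ L₁) →
            energy c₂ ≤ energy c₁ + ε → stages m D M L ≤ D L₁ → ⊥) → ⊥
        strong zero {c} v big k = <-irrefl refl (<-≤-trans
          (subst (ι L₀ <_) (trans (cong (energy c +_) (*-zeroˡ ε)) (+-identityʳ _)) big) (energy≤ c))
        strong (suc M) {c} {L} v big k = weak (m L) (0≤κ L) v
          (<-≤-trans (m-large L) (≤-by (energy c) (0≤energy c) (+-comm (energy c) _))) next
          where
          next : ∀ c′ → Valid c′ (grow (m L) L) → Refines g c c′ → Uniform c′ (κ L) → ⊥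
          next c′ v′ r u with energy c′ ≤? energy c + ε
          -- The pair is (`c`, `c′`): the old colouring is coarse, and `c′` is uniform at the
          -- precision `κ L` belonging to the coarse count.
          ... | yes p = k c L c′ v (Valid.dep v′) refines-refl r u p (p⊓q≤p (D L) (stages m D M (grow (m L) L)))
          ... | no ¬p = strong M v′ big′ (λ c₁ L₁ c₂ v₁ d₂ r₁ r₂ u₂ e₂ D≤ →
                k c₁ L₁ c₂ v₁ d₂ (refines-trans r r₁) r₂ u₂ e₂ (≤-trans (p⊓q≤q (D L) (stages m D M (grow (m L) L))) D≤))
            where
            lem : ∀ a b c → a + (1ℚ + b) * c ≡ a + c + b * c
            lem = solve-∀ ℚ-ring
            big′ : ι L₀ < energy c′ + ι M * ε
            big′ = <-≤-trans (subst (ι L₀ <_) (lem (energy c) (ι M) ε) big) (+-monoˡ-≤ (ι M * ε) (<⇒≤ (≰⇒> ¬p)))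

      -- Here `p` is measurable for the coarse `c`, whereas `κ` is the precision of a much finer
      -- colouring. The price of combining the two is the pointwise error `lam` and the event `bad`,
      -- where coarse and fine densities disagree.
      record Reg (c : Colouring) (lam β κ : ℚ) : Set where
        field
          p         : ℕ → X t → ℚ
          bad       : ℕ → X t → Bool
          p-≤1      : ∀ a x → p a x ≤ 1ℚ
          p-meas    : ∀ a {x y} → (∀ f → f ⊊ g → c f x ≡ c f y) → p a x ≡ p a y
          bad-dep   : ∀ a → Dep g (bad a)
          bad-small : ∀ {a} → a ℕ.< L₀ → E (λ x → ⟦ bad a x ⟧) ≤ β
          dense     : ∀ a η → 0ℚ ≤ η → E (λ x → ⟦ class a x ⟧ * ⟦ p a x ≺ η ⟧) ≤ η
          upper     : ∀ {a} → a ℕ.< L₀ → ∀ {Φ} → Adm g Φ →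
                      E (λ x → ⟦ class a x ⟧ * ⟦ Φ x ⟧) ≤ E (λ x → (p a x + (lam + ⟦ bad a x ⟧)) * ⟦ Φ x ⟧) + κ
          lower     : ∀ {a} → a ℕ.< L₀ → ∀ {Φ} → Adm g Φ →
                      E (λ x → p a x * ⟦ Φ x ⟧) ≤ E (λ x → (⟦ class a x ⟧ + (lam + ⟦ bad a x ⟧)) * ⟦ Φ x ⟧) + κ

      module _ (γ-dep : Dep g γ) {c₁ c₂ : Colouring} (d₁ : ∀ f → Dep f (c₁ f)) (d₂ : ∀ f → Dep f (c₂ f))
               (r : Refines g c₁ c₂) {lam β κ : ℚ} (0<lam : 0ℚ < lam)
               (close : energy c₂ ≤ energy c₁ + lam * lam * β) (u : Uniform c₂ κ) where
        private
          P₁ = colours g c₁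
          P₂ = colours g c₂
          0≤lam = <⇒≤ 0<lam

          diff : ℕ → X t → ℚ
          diff a x = q c₂ a x - q c₁ a x

          bad : ℕ → X t → Bool
          bad a x = (lam * lam) ≺ (diff a x * diff a x)

          q₁-dep : ∀ a → Dep g (q c₁ a)
          q₁-dep a = colours-dep g c₁ d₁ (cexp-meas P₁ (λ x → ⟦ class a x ⟧))

          q₂-dep : ∀ a → Dep g (q c₂ a)
          q₂-dep a = colours-dep g c₂ d₂ (cexp-meas P₂ (λ x → ⟦ class a x ⟧))

          bad-dep : ∀ a → Dep g (bad a)
          bad-dep a ag = cong₂ (λ y z → (lam * lam) ≺ ((z - y) * (z - y))) (q₁-dep a ag) (q₂-dep a ag)

          class-dep : ∀ a → Dep g (class a)
          class-dep a ag = cong (λ n → n == a) (γ-dep ag)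

          -- If the squares betray a difference above `lam`, the summand 1 dominates `a` by itself.
          near : ∀ {a b} → 0ℚ ≤ a → a ≤ 1ℚ → 0ℚ ≤ b → a ≤ b + (lam + ⟦ (lam * lam) ≺ ((a - b) * (a - b)) ⟧)
          near {a} {b} 0≤a a≤1 0≤b = ≺-elim (lam * lam) ((a - b) * (a - b)) (λ z → a ≤ b + (lam + ⟦ z ⟧))
            (λ _ → ≤-trans a≤1 (≤-by (b + lam) (0≤+ 0≤b 0≤lam) (lem₁ b lam)))
            (λ le → 0≤⇒≤ (subst (0ℚ ≤_) (lem₂ a b lam) (≤⇒0≤ (sq-small 0≤lam le))))
            where
            lem₁ : ∀ b l → b + (l + 1ℚ) ≡ 1ℚ + (b + l)
            lem₁ = solve-∀ ℚ-ring
            lem₂ : ∀ a b l → l - (a - b) ≡ b + (l + 0ℚ) - a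
            lem₂ = solve-∀ ℚ-ring

          q₂≤ : ∀ a x → q c₂ a x ≤ q c₁ a x + (lam + ⟦ bad a x ⟧)
          q₂≤ a x = near (q-0≤ c₂ a x) (q-≤1 c₂ a x) (q-0≤ c₁ a x)

          q₁≤ : ∀ a x → q c₁ a x ≤ q c₂ a x + (lam + ⟦ bad a x ⟧)
          q₁≤ a x = subst (λ z → q c₁ a x ≤ q c₂ a x + (lam + ⟦ (lam * lam) ≺ z ⟧))
            (minus-swap (q c₁ a x) (q c₂ a x))
            (near (q-0≤ c₁ a x) (q-≤1 c₁ a x) (q-0≤ c₂ a x))

          -- Chebyshev: the mean square of the difference of the densities is the energy gain of the
          -- class `a`, and this is at most the total gain because no other class loses energy.
          bad-small : ∀ {a} → a ℕ.< L₀ → E (λ x → ⟦ bad a x ⟧) ≤ β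
          bad-small {a} a<L₀ = cancel-*ˡ (0<* 0<lam 0<lam) (begin
            lam * lam * E (λ x → ⟦ bad a x ⟧)
              ≡⟨ sym (E-* (lam * lam) (λ x → ⟦ bad a x ⟧)) ⟩
            E (λ x → lam * lam * ⟦ bad a x ⟧)
              ≤⟨ E-mono markov ⟩
            E (λ x → diff a x * diff a x)
              ≡⟨ pythagoras P₁ P₂ (colours-finer r) (λ x → ⟦ class a x ⟧) ⟩
            sq c₂ a - sq c₁ a
              ≤⟨ 0≤⇒≤ (subst (0ℚ ≤_) (lem (energy c₁) (sq c₂ a - sq c₁ a) (energy c₂))
                   (≤⇒0≤ (Σ<-gain L₀ (sq-mono r) a<L₀ (sq c₂ a - sq c₁ a) (≤-reflexive (sym (a+[b-a] (sq c₁ a) (sq c₂ a))))))) ⟩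
            energy c₂ - energy c₁
              ≤⟨ 0≤⇒≤ (subst (0ℚ ≤_) (lem′ (energy c₁) (lam * lam * β) (energy c₂)) (≤⇒0≤ close)) ⟩
            lam * lam * β ∎)
            where
            open ≤-Reasoning
            lem : ∀ a d b → b - (a + d) ≡ (b - a) - d
            lem = solve-∀ ℚ-ring
            lem′ : ∀ a d b → (a + d) - b ≡ d - (b - a)
            lem′ = solve-∀ ℚ-ring
            markov : ∀ x → lam * lam * ⟦ bad a x ⟧ ≤ diff a x * diff a x
            markov x = ≺-elim (lam * lam) (diff a x * diff a x) (λ z → lam * lam * ⟦ z ⟧ ≤ diff a x * diff a x)
              (λ p → subst (_≤ diff a x * diff a x) (sym (*-identityʳ (lam * lam))) (<⇒≤ p))
              (λ _ → subst (_≤ diff a x * diff a x) (sym (*-zeroʳ (lam * lam))) (0≤sq (diff a x)))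

          -- The event of low density is measurable for the coarse colours, so the class may be
          -- replaced by its density there, and this is below `η`.
          dense : ∀ a η → 0ℚ ≤ η → E (λ x → ⟦ class a x ⟧ * ⟦ q c₁ a x ≺ η ⟧) ≤ η
          dense a η 0≤η = subst (_≤ η) (cexp-orth P₁ (λ x → ⟦ class a x ⟧) (λ x → ⟦ q c₁ a x ≺ η ⟧)
              (λ s → cong (λ z → ⟦ z ≺ η ⟧) (cexp-meas P₁ (λ x → ⟦ class a x ⟧) s)))
            (subst (E (λ x → q c₁ a x * ⟦ q c₁ a x ≺ η ⟧) ≤_) (E-const {t} η) (E-mono small))
            where
            small : ∀ x → q c₁ a x * ⟦ q c₁ a x ≺ η ⟧ ≤ η
            small x = ≺-elim (q c₁ a x) η (λ z → q c₁ a x * ⟦ z ⟧ ≤ η)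
              (λ p → subst (_≤ η) (sym (*-identityʳ (q c₁ a x))) (<⇒≤ p))
              (λ _ → subst (_≤ η) (sym (*-zeroʳ (q c₁ a x))) 0≤η)

          split-E : ∀ a Φ → E (λ x → ⟦ class a x ⟧ * ⟦ Φ x ⟧) ≡ E (λ x → q c₂ a x * ⟦ Φ x ⟧) + discrepancy c₂ a Φ
          split-E a Φ = trans (E-cong (λ x → lem ⟦ class a x ⟧ (q c₂ a x) ⟦ Φ x ⟧))
            (E-+ (λ x → q c₂ a x * ⟦ Φ x ⟧) (λ x → (⟦ class a x ⟧ - q c₂ a x) * ⟦ Φ x ⟧))
            where
            lem : ∀ a q f → a * f ≡ q * f + (a - q) * f
            lem = solve-∀ ℚ-ring

          sum-dep : ∀ a {w : X t → ℚ} → Dep g w → Dep g (λ x → w x + (lam + ⟦ bad a x ⟧))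
          sum-dep a dw ag = cong₂ (λ z b → z + (lam + ⟦ b ⟧)) (dw ag) (bad-dep a ag)

          upper : ∀ {a} → a ℕ.< L₀ → ∀ {Φ} → Adm g Φ →
            E (λ x → ⟦ class a x ⟧ * ⟦ Φ x ⟧) ≤ E (λ x → (q c₁ a x + (lam + ⟦ bad a x ⟧)) * ⟦ Φ x ⟧) + κ
          upper {a} a<L₀ {Φ} adm = E-through-merge g {u = λ x → ⟦ class a x ⟧} {v = λ x → q c₁ a x + (lam + ⟦ bad a x ⟧)}
            (λ ag → cong ⟦_⟧ (class-dep a ag)) (sum-dep a (q₁-dep a)) Φ κ
            (λ y → subst (_≤ E (λ x → (q c₁ a x + (lam + ⟦ bad a x ⟧)) * ⟦ Φ (merge g x y) ⟧) + κ)
              (sym (split-E a (λ x → Φ (merge g x y))))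
              (+-mono-≤ (E-mono (λ x → mulʳ (0≤⟦⟧ (Φ (merge g x y))) (q₂≤ a x))) (proj₁ (u a<L₀ (Adm⇒Str adm y)))))

          lower : ∀ {a} → a ℕ.< L₀ → ∀ {Φ} → Adm g Φ →
            E (λ x → q c₁ a x * ⟦ Φ x ⟧) ≤ E (λ x → (⟦ class a x ⟧ + (lam + ⟦ bad a x ⟧)) * ⟦ Φ x ⟧) + κ
          lower {a} a<L₀ {Φ} adm = E-through-merge g {u = λ x → q c₁ a x} {v = λ x → ⟦ class a x ⟧ + (lam + ⟦ bad a x ⟧)}
            (q₁-dep a) (sum-dep a (λ ag → cong ⟦_⟧ (class-dep a ag))) Φ κ below
            where
            below : ∀ y → E (λ x → q c₁ a x * ⟦ Φ (merge g x y) ⟧) ≤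
              E (λ x → (⟦ class a x ⟧ + (lam + ⟦ bad a x ⟧)) * ⟦ Φ (merge g x y) ⟧) + κ
            below y = begin
              E (λ x → q c₁ a x * ⟦ Ψ x ⟧)
                ≤⟨ E-mono (λ x → mulʳ (0≤⟦⟧ (Ψ x)) (q₁≤ a x)) ⟩
              E (λ x → (q c₂ a x + h x) * ⟦ Ψ x ⟧)
                ≡⟨ trans (E-cong (λ x → *-distribʳ-+ ⟦ Ψ x ⟧ (q c₂ a x) (h x)))
                     (E-+ (λ x → q c₂ a x * ⟦ Ψ x ⟧) (λ x → h x * ⟦ Ψ x ⟧)) ⟩
              Q + H
                ≤⟨ ≤-by (discrepancy c₂ a Ψ + κ) (subst (λ z → 0ℚ ≤ discrepancy c₂ a Ψ + z) (lem₁ κ)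
                     (≤⇒0≤ (proj₂ (u a<L₀ (Adm⇒Str adm y))))) (lem₂ Q (discrepancy c₂ a Ψ) H κ) ⟩
              Q + discrepancy c₂ a Ψ + H + κ
                ≡⟨ cong (λ z → z + H + κ) (sym (split-E a Ψ)) ⟩
              E (λ x → ⟦ class a x ⟧ * ⟦ Ψ x ⟧) + H + κ
                ≡⟨ cong (_+ κ) (sym (trans (E-cong (λ x → *-distribʳ-+ ⟦ Ψ x ⟧ ⟦ class a x ⟧ (h x)))
                     (E-+ (λ x → ⟦ class a x ⟧ * ⟦ Ψ x ⟧) (λ x → h x * ⟦ Ψ x ⟧)))) ⟩
              E (λ x → (⟦ class a x ⟧ + h x) * ⟦ Ψ x ⟧) + κ ∎
              where
              open ≤-Reasoning
              Ψ : X t → Bool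
              Ψ x = Φ (merge g x y)
              h : X t → ℚ
              h x = lam + ⟦ bad a x ⟧
              Q = E (λ x → q c₂ a x * ⟦ Ψ x ⟧)
              H = E (λ x → h x * ⟦ Ψ x ⟧)
              lem₁ : ∀ a → - - a ≡ a
              lem₁ = solve-∀ ℚ-ring
              lem₂ : ∀ q d h k → q + d + h + k ≡ q + h + (d + k)
              lem₂ = solve-∀ ℚ-ring

        regular : Reg c₁ lam β κ
        regular = record
          { p = q c₁ ; bad = bad ; p-≤1 = q-≤1 c₁
          ; p-meas = λ a s → cexp-meas P₁ (λ x → ⟦ class a x ⟧) (colours-to g c₁ s)
          ; bad-dep = bad-dep ; bad-small = bad-small ; dense = dense ; upper = upper ; lower = lower }


  -- Counting

  -- Replacing one event by its density costs at most eight errors of size θ′.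
  eightfold : ℚ → ℚ
  eightfold a = (a + a + (a + a)) + (a + a + (a + a))

  module Counting (ν t : ℕ) where
    open Expectation ν
    open Dependence ν t

    Pr : (X t → Bool) → ℚ
    Pr Φ = E (λ x → ⟦ Φ x ⟧)

    Pr-mono : ∀ {Φ Ψ} → (∀ x → Φ x ≡ true → Ψ x ≡ true) → Pr Φ ≤ Pr Ψ
    Pr-mono h = E-mono (λ x → ⟦⟧-mono (h x))

    Pr-cong : ∀ {Φ Ψ} → (∀ x → Φ x ≡ Ψ x) → Pr Φ ≡ Pr Ψ
    Pr-cong h = E-cong (λ x → cong ⟦_⟧ (h x))

    Pr≤1 : ∀ Φ → Pr Φ ≤ 1ℚ
    Pr≤1 Φ = subst (Pr Φ ≤_) (E-const {t} 1ℚ) (E-mono (λ x → ⟦⟧≤1 (Φ x)))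

    record Item : Set where
      constructor item
      field
        g   : Subset t
        A   : X t → Bool
        bad : X t → Bool
        p   : ℚ

    open Item

    cut : Subset t → List Item → X t → Bool
    cut h []       x = true
    cut h (i ∷ is) x = if does (g i ⊆? h) then A i x ∧ cut h is x else cut h is x

    weight : Subset t → List Item → ℚ
    weight h []       = 1ℚ
    weight h (i ∷ is) = if does (g i ⊆? h) then p i * weight h is else weight h is

    weight∖ : Subset t → Subset t → List Item → ℚ
    weight∖ h k []       = 1ℚ
    weight∖ h k (i ∷ is) =
      if does (g i ⊆? h) then (if does (g i ⊆? k) then weight∖ h k is else p i * weight∖ h k is) else weight∖ h k is

    -- `θ` is the relative error allowed with the item included and `θ′` the one already achieved
    -- for `is`. As `π` bounds the product of all later densities from below, `κ-small` makes `κ`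
    -- negligible in any intersection of later events. The condition `rare` is relative to the cell
    -- cut out by the later items inside `g i`; a global bound could be exhausted in that one cell.
    record Step (i : Item) (is : List Item) (θ θ′ η π : ℚ) : Set where
      field
        nonempty : Nonempty (g i)
        later    : All (λ j → ¬ (g i ⊆ g j)) is
        A-dep    : Dep (g i) (A i)
        bad-dep  : Dep (g i) (bad i)
        0<η      : 0ℚ < η
        η≤p      : η ≤ p i
        p≤1      : p i ≤ 1ℚ
        0≤θ′     : 0ℚ ≤ θ′
        θ′≤1     : θ′ ≤ 1ℚ
        θ′-small : eightfold θ′ ≤ θ * η
        0≤θ      : 0ℚ ≤ θ
        κ        : ℚ
        κ-small  : κ ≤ θ′ * π
        upper    : ∀ {Φ} → Adm (g i) Φ → (∀ x → Φ x ≡ true → cut (g i) is x ≡ true) →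
                   Pr (λ x → A i x ∧ Φ x) ≤ p i * Pr Φ + (θ′ * Pr Φ + Pr (λ x → bad i x ∧ Φ x) + κ)
        lower    : ∀ {Φ} → Adm (g i) Φ → (∀ x → Φ x ≡ true → cut (g i) is x ≡ true) →
                   p i * Pr Φ ≤ Pr (λ x → A i x ∧ Φ x) + (θ′ * Pr Φ + Pr (λ x → bad i x ∧ Φ x) + κ)
        rare     : Pr (λ x → bad i x ∧ cut (g i) is x) ≤ θ′ * Pr (cut (g i) is)

    data Steps : List Item → ℚ → ℚ → Set where
      []  : ∀ {θ} → 0ℚ ≤ θ → Steps [] θ 1ℚ
      _∷_ : ∀ {i is θ θ′ η π} → Step i is θ θ′ η π → Steps is θ′ π → Steps (i ∷ is) θ (η * π)

    cut-mono : ∀ {h k} → h ⊆ k → ∀ is x → cut k is x ≡ true → cut h is x ≡ true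
    cut-mono h⊆k [] x e = refl
    cut-mono {h} {k} h⊆k (i ∷ is) x e with g i ⊆? h | g i ⊆? k
    ... | yes a | yes b = ∧-true (∧-left e) (cut-mono h⊆k is x (∧-right {A i x} e))
    ... | yes a | no ¬b = ⊥-elim (¬b (⊆-trans a h⊆k))
    ... | no ¬a | yes b = cut-mono h⊆k is x (∧-right {A i x} e)
    ... | no ¬a | no ¬b = cut-mono h⊆k is x e

    module _ {h k : Subset t} (k⊆h : k ⊆ h) where
      weight-split : ∀ is → weight h is ≡ weight k is * weight∖ h k is
      weight-split [] = sym (*-identityˡ 1ℚ)
      weight-split (i ∷ is) with g i ⊆? h | g i ⊆? k
      ... | yes a | yes b = trans (cong (p i *_) (weight-split is)) (sym (*-assoc (p i) (weight k is) _))
      ... | yes a | no ¬b = trans (cong (p i *_) (weight-split is)) (lem (p i) (weight k is) _)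
        where
        lem : ∀ a b c → a * (b * c) ≡ b * (a * c)
        lem = solve-∀ ℚ-ring
      ... | no ¬a | yes b = ⊥-elim (¬a (⊆-trans b k⊆h))
      ... | no ¬a | no ¬b = weight-split is

    0≤weight∖ : ∀ {is θ π} → Steps is θ π → ∀ h k → 0ℚ ≤ weight∖ h k is
    0≤weight∖ ([] _) h k = 0≤1
    0≤weight∖ (_∷_ {i} {is} s ss) h k with g i ⊆? h | g i ⊆? k
    ... | yes a | yes b = 0≤weight∖ ss h k
    ... | yes a | no ¬b = 0≤* (≤-trans (<⇒≤ (Step.0<η s)) (Step.η≤p s)) (0≤weight∖ ss h k)
    ... | no ¬a | _     = 0≤weight∖ ss h k

    weight∖-∅ : ∀ {is θ π} → Steps is θ π → ∀ h → weight∖ h ∅ is ≡ weight h is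
    weight∖-∅ ([] _) h = refl
    weight∖-∅ (_∷_ {i} {is} s ss) h with g i ⊆? h | g i ⊆? ∅
    ... | yes a | yes b = ⊥-elim (∉⊥ (b (proj₂ (Step.nonempty s))))
    ... | yes a | no ¬b = cong (p i *_) (weight∖-∅ ss h)
    ... | no ¬a | _     = weight∖-∅ ss h

    0<π : ∀ {is θ π} → Steps is θ π → 0ℚ < π
    0<π ([] _)   = 0<1
    0<π (s ∷ ss) = 0<* (Step.0<η s) (0<π ss)

    π≤weight : ∀ {is θ π} → Steps is θ π → ∀ h → π ≤ weight h is
    π≤weight ([] _) h = ≤-refl
    π≤weight (_∷_ {i} {is} {η = η} {π} s ss) h with g i ⊆? h
    ... | yes _ = mul-mono (<⇒≤ 0<η) (≤-trans (<⇒≤ (0<π ss)) (π≤weight ss h)) η≤p (π≤weight ss h)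
      where open Step s
    ... | no _  = ≤-trans (*-≤1 (<⇒≤ (0<π ss)) (≤-trans η≤p p≤1)) (π≤weight ss h)
      where open Step s

    0≤weight : ∀ {is θ π} → Steps is θ π → ∀ h → 0ℚ ≤ weight h is
    0≤weight ss h = ≤-trans (<⇒≤ (0<π ss)) (π≤weight ss h)

    -- Supersets come first in the list, so no later event lives on a set containing `g i`.
    cut-adm : ∀ {i is θ θ′ η π} → Step i is θ θ′ η π → Steps is θ′ π → ∀ h → Adm (g i) (cut h is)
    cut-adm {i} s ss h = go ss (Step.later s)
      where
      go : ∀ {is θ π} → Steps is θ π → All (λ j → ¬ (g i ⊆ g j)) is → Adm (g i) (cut h is)
      go ([] _) [] = top
      go (_∷_ {j} s′ ss′) (n ∷ ns) with g j ⊆? h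
      ... | yes _ = and (base (Step.A-dep s′) n) (go ss′ ns)
      ... | no _  = go ss′ ns

    θ′≤θη : ∀ {i is θ θ′ η π} → Step i is θ θ′ η π → θ′ ≤ θ * η
    θ′≤θη {θ′ = θ′} s = ≤-trans (≤-by _ (0≤+ (0≤+ 0≤θ′ (0≤+ 0≤θ′ 0≤θ′)) (0≤+ (0≤+ 0≤θ′ 0≤θ′) (0≤+ 0≤θ′ 0≤θ′))) (lem θ′)) θ′-small
      where
      open Step s
      lem : ∀ a → (a + a + (a + a)) + (a + a + (a + a)) ≡ a + (a + (a + a) + ((a + a) + (a + a)))
      lem = solve-∀ ℚ-ring

    θ′≤θ : ∀ {i is θ θ′ η π} → Step i is θ θ′ η π → θ′ ≤ θ
    θ′≤θ {i} {θ = θ} {η = η} s = ≤-trans (θ′≤θη s)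
      (subst (θ * η ≤_) (*-identityʳ θ) (mulˡ (Step.0≤θ s) (≤-trans (Step.η≤p s) (Step.p≤1 s))))

    -- The events inside k are kept and those inside h but not inside k are replaced by
    -- their densities; the error is relative to the product of all densities inside h,
    -- also when D is a rare event.
    Upper : List Item → ℚ → Set
    Upper is θ = ∀ h k → k ⊆ h → ∀ {D : X t → Bool} → Dep k D →
      Pr (λ x → D x ∧ cut h is x) ≤ Pr (λ x → D x ∧ cut k is x) * weight∖ h k is + θ * weight h is

    upper-total : ∀ {is θ π} → Steps is θ π → Upper is θ → ∀ h → Pr (cut h is) ≤ weight h is + θ * weight h is
    upper-total {is} {θ} ss U h = ≤-trans (U h ∅ ⊥⊆ {λ _ → true} (λ _ → refl))
      (+-monoˡ-≤ (θ * weight h is) (subst (Pr (cut ∅ is) * weight∖ h ∅ is ≤_) (weight∖-∅ ss h)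
        (*-≤1 (0≤weight∖ ss h ∅) (Pr≤1 (cut ∅ is)))))

    module _ {i is θ θ′ η π} (s : Step i is θ θ′ η π) (ss : Steps is θ′ π) (U : Upper is θ′)
             {h : Subset t} (i⊆h : g i ⊆ h) where
      open Step s
      private
        w = weight h is
        S = θ′ * w

        0≤w : 0ℚ ≤ w
        0≤w = 0≤weight ss h

        0≤S : 0ℚ ≤ S
        0≤S = 0≤* 0≤θ′ 0≤w

        -- As `θ′` is at most 1, a probability is at most twice the predicted weight.
        θ′-total : ∀ k {u} → 0ℚ ≤ u → θ′ * (Pr (cut k is) * u) ≤ θ′ * (weight k is * u) + θ′ * (weight k is * u)
        θ′-total k {u} 0≤u = begin
          θ′ * (Pr (cut k is) * u)                 ≤⟨ mulˡ 0≤θ′ (mulʳ 0≤u (upper-total ss U k)) ⟩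
          θ′ * ((wk + θ′ * wk) * u)                ≡⟨ lem θ′ wk u ⟩
          θ′ * (wk * u) + θ′ * (θ′ * (wk * u))     ≤⟨ +-monoʳ-≤ (θ′ * (wk * u)) (*-≤1 (0≤* 0≤θ′ (0≤* (0≤weight ss k) 0≤u)) θ′≤1) ⟩
          θ′ * (wk * u) + θ′ * (wk * u)            ∎
          where
          open ≤-Reasoning
          wk = weight k is
          lem : ∀ a b c → a * ((b + a * b) * c) ≡ a * (b * c) + a * (a * (b * c))
          lem = solve-∀ ℚ-ring

      -- Of the six copies of `S`, two come from `θ′ * Pr`, three from the exceptional event and one
      -- from `κ`. For the exceptional event, `U` is applied with `D = bad i` and `k = g i`: rarity
      -- in the cell of `g i` is carried to `h` by the densities of the remaining events.
      error-bound : θ′ * Pr (cut h is) + Pr (λ x → bad i x ∧ cut h is x) + κ ≤ (S + S + (S + S)) + (S + S)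
      error-bound = begin
        θ′ * Pr (cut h is) + Pr (λ x → bad i x ∧ cut h is x) + κ
          ≤⟨ +-mono-≤ (+-mono-≤ part₁ part₂) (≤-trans κ-small (mulˡ 0≤θ′ (π≤weight ss h))) ⟩
        S + S + (S + S + S) + S
          ≡⟨ lem S ⟩
        (S + S + (S + S)) + (S + S) ∎
        where
        open ≤-Reasoning
        lem : ∀ a → a + a + (a + a + a) + a ≡ (a + a + (a + a)) + (a + a)
        lem = solve-∀ ℚ-ring
        part₁ : θ′ * Pr (cut h is) ≤ S + S
        part₁ = subst₂ (λ a b → θ′ * a ≤ θ′ * b + θ′ * b) (*-identityʳ _) (*-identityʳ w) (θ′-total h 0≤1)
        part₂ : Pr (λ x → bad i x ∧ cut h is x) ≤ S + S + S
        part₂ = begin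
          Pr (λ x → bad i x ∧ cut h is x)
            ≤⟨ U h (g i) i⊆h bad-dep ⟩
          Pr (λ x → bad i x ∧ cut (g i) is x) * weight∖ h (g i) is + S
            ≤⟨ +-monoˡ-≤ S (mulʳ (0≤weight∖ ss h (g i)) rare) ⟩
          θ′ * Pr (cut (g i) is) * weight∖ h (g i) is + S
            ≡⟨ cong (_+ S) (*-assoc θ′ _ _) ⟩
          θ′ * (Pr (cut (g i) is) * weight∖ h (g i) is) + S
            ≤⟨ +-monoˡ-≤ S (θ′-total (g i) (0≤weight∖ ss h (g i))) ⟩
          θ′ * (weight (g i) is * weight∖ h (g i) is) + θ′ * (weight (g i) is * weight∖ h (g i) is) + S
            ≡⟨ cong (λ z → θ′ * z + θ′ * z + S) (sym (weight-split i⊆h is)) ⟩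
          S + S + S ∎

      slack : eightfold S ≤ θ * (p i * w)
      slack = begin
        eightfold S          ≡⟨ lem θ′ w ⟩
        eightfold θ′ * w     ≤⟨ mulʳ 0≤w θ′-small ⟩
        θ * η * w            ≤⟨ mulʳ 0≤w (mulˡ 0≤θ η≤p) ⟩
        θ * p i * w          ≡⟨ *-assoc θ (p i) w ⟩
        θ * (p i * w)        ∎
        where
        open ≤-Reasoning
        lem : ∀ a b → (a * b + a * b + (a * b + a * b)) + (a * b + a * b + (a * b + a * b)) ≡ ((a + a + (a + a)) + (a + a + (a + a))) * b
        lem = solve-∀ ℚ-ring

      -- A seventh copy of `S` is the error inherited from the later items; eight are available.
      absorb : p i * S + ((S + S + (S + S)) + (S + S)) ≤ θ * (p i * w)
      absorb = ≤-trans (≤-trans (+-monoˡ-≤ ((S + S + (S + S)) + (S + S)) (*-≤1 0≤S p≤1)) (≤-by S 0≤S (lem S))) slack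
        where
        lem : ∀ a → (a + a + (a + a)) + (a + a + (a + a)) ≡ a + ((a + a + (a + a)) + (a + a)) + a
        lem = solve-∀ ℚ-ring

      -- Since `k` does not contain `g i`, the event `D` is admissible for `g i`, so `A i` can be
      -- traded for its density inside `D ∧ cut h is`.
      upper-step : ∀ {k} → k ⊆ h → ¬ (g i ⊆ k) → ∀ {D : X t → Bool} → Dep k D →
        Pr (λ x → D x ∧ (A i x ∧ cut h is x)) ≤ Pr (λ x → D x ∧ cut k is x) * (p i * weight∖ h k is) + θ * (p i * w)
      upper-step {k} k⊆h i⊈k {D} D-dep = begin
        Pr (λ x → D x ∧ (A i x ∧ cut h is x))
          ≡⟨ Pr-cong (λ x → exch (D x) (A i x) (cut h is x)) ⟩
        Pr (λ x → A i x ∧ Φ x)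
          ≤⟨ upper (and (base D-dep i⊈k) (cut-adm s ss h)) (λ x e → cut-mono i⊆h is x (∧-right {D x} e)) ⟩
        p i * Pr Φ + (θ′ * Pr Φ + Pr (λ x → bad i x ∧ Φ x) + κ)
          ≤⟨ +-mono-≤ (mulˡ 0≤p (U h k k⊆h D-dep)) (≤-trans (+-monoˡ-≤ κ (+-mono-≤
               (mulˡ 0≤θ′ (Pr-mono (λ x e → ∧-right {D x} e)))
               (Pr-mono {λ x → bad i x ∧ Φ x} {λ x → bad i x ∧ cut h is x}
                 (λ x e → ∧-true (∧-left e) (∧-right {D x} (∧-right {bad i x} e)))))) error-bound) ⟩
        p i * (M * u + S) + ((S + S + (S + S)) + (S + S))
          ≡⟨ lem (p i) M u S ((S + S + (S + S)) + (S + S)) ⟩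
        M * (p i * u) + (p i * S + ((S + S + (S + S)) + (S + S)))
          ≤⟨ +-monoʳ-≤ (M * (p i * u)) absorb ⟩
        M * (p i * u) + θ * (p i * w) ∎
        where
        open ≤-Reasoning
        0≤p = ≤-trans (<⇒≤ 0<η) η≤p
        M = Pr (λ x → D x ∧ cut k is x)
        u = weight∖ h k is
        Φ : X t → Bool
        Φ x = D x ∧ cut h is x
        exch : ∀ a b c → a ∧ (b ∧ c) ≡ b ∧ (a ∧ c)
        exch true  b     c = refl
        exch false true  c = refl
        exch false false c = refl
        lem : ∀ p m u s r → p * (m * u + s) + r ≡ m * (p * u) + (p * s + r)
        lem = solve-∀ ℚ-ring

      lower-step : w ≤ Pr (cut h is) + θ′ * w → p i * w ≤ Pr (λ x → A i x ∧ cut h is x) + θ * (p i * w)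
      lower-step ih = begin
        p i * w
          ≤⟨ mulˡ 0≤p ih ⟩
        p i * (Pr (cut h is) + S)
          ≡⟨ *-distribˡ-+ (p i) (Pr (cut h is)) S ⟩
        p i * Pr (cut h is) + p i * S
          ≤⟨ +-monoˡ-≤ (p i * S) (≤-trans (lower (cut-adm s ss h) (λ x e → cut-mono i⊆h is x e))
               (+-monoʳ-≤ (Pr (λ x → A i x ∧ cut h is x)) error-bound)) ⟩
        Pr (λ x → A i x ∧ cut h is x) + ((S + S + (S + S)) + (S + S)) + p i * S
          ≡⟨ lem (Pr (λ x → A i x ∧ cut h is x)) ((S + S + (S + S)) + (S + S)) (p i * S) ⟩
        Pr (λ x → A i x ∧ cut h is x) + (p i * S + ((S + S + (S + S)) + (S + S)))
          ≤⟨ +-monoʳ-≤ (Pr (λ x → A i x ∧ cut h is x)) absorb ⟩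
        Pr (λ x → A i x ∧ cut h is x) + θ * (p i * w) ∎
        where
        open ≤-Reasoning
        0≤p = ≤-trans (<⇒≤ 0<η) η≤p
        lem : ∀ a b c → a + b + c ≡ a + (c + b)
        lem = solve-∀ ℚ-ring

    counting-upper : ∀ {is θ π} → Steps is θ π → Upper is θ
    counting-upper ([] {θ} 0≤θ) h k k⊆h {D} D-dep =
      ≤-by (θ * 1ℚ) (0≤* 0≤θ 0≤1) (cong (_+ θ * 1ℚ) (*-identityʳ (Pr (λ x → D x ∧ true))))
    counting-upper (_∷_ {i} {is} {θ} {θ′} s ss) h k k⊆h {D} D-dep with g i ⊆? h | g i ⊆? k
    ... | yes a | no ¬b = upper-step s ss (counting-upper ss) a k⊆h ¬b D-dep
    -- An event inside `k` is moved into `D`, which still depends on `k` only. The weight gains the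
    -- factor `p i`, so the error must be shrunk: `θ′` is at most `θ * η`, hence at most `θ * p i`.
    ... | yes a | yes b = ≤-trans
      (subst₂ (λ y z → y ≤ z * weight∖ h k is + θ′ * weight h is)
        (Pr-cong (λ x → Boolₚ.∧-assoc (D x) (A i x) (cut h is x))) (Pr-cong (λ x → Boolₚ.∧-assoc (D x) (A i x) (cut k is x)))
        (counting-upper ss h k k⊆h {λ x → D x ∧ A i x} (λ ag → cong₂ _∧_ (D-dep ag) (Step.A-dep s (λ e → ag (b e))))))
      (+-monoʳ-≤ (Pr (λ x → D x ∧ (A i x ∧ cut k is x)) * weight∖ h k is) (subst (θ′ * weight h is ≤_) (*-assoc θ (p i) (weight h is))
        (mulʳ (0≤weight ss h) (≤-trans (θ′≤θη s) (mulˡ (Step.0≤θ s) (Step.η≤p s))))))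
    ... | no ¬a | yes b = ⊥-elim (¬a (⊆-trans b k⊆h))
    ... | no ¬a | no ¬b = ≤-trans (counting-upper ss h k k⊆h D-dep)
      (+-monoʳ-≤ (Pr (λ x → D x ∧ cut k is x) * weight∖ h k is) (mulʳ (0≤weight ss h) (θ′≤θ s)))

    -- No extra event `D` appears here: exceptional events need bounds from above only, and
    -- `counting-upper` supplies them.
    counting-lower : ∀ {is θ π} → Steps is θ π → ∀ h → weight h is ≤ Pr (cut h is) + θ * weight h is
    counting-lower ([] {θ} 0≤θ) h = ≤-by (θ * 1ℚ) (0≤* 0≤θ 0≤1) (cong (_+ θ * 1ℚ) (E-const {t} 1ℚ))
    counting-lower (_∷_ {i} {is} s ss) h with g i ⊆? h
    ... | yes a = lower-step s ss (counting-upper ss) a (counting-lower ss h)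
    ... | no ¬a = ≤-trans (counting-lower ss h) (+-monoʳ-≤ (Pr (cut h is)) (mulʳ (0≤weight ss h) (θ′≤θ s)))


  -- Processing all index sets

  toℚᵘ-ι : ∀ n → toℚᵘ (ι n) ℚᵘ.≃ ℚᵘ.mkℚᵘ (ℤ.+ n) 0
  toℚᵘ-ι zero    = ℚᵘₚ.≃-refl
  toℚᵘ-ι (suc n) = ℚᵘₚ.≃-trans (toℚᵘ-homo-+ 1ℚ (ι n))
    (ℚᵘₚ.≃-trans (ℚᵘₚ.+-cong (ℚᵘₚ.≃-refl {toℚᵘ 1ℚ}) (toℚᵘ-ι n)) (ℚᵘ.*≡* (cong (λ z → (ℤ.+ 1 ℤ.+ z) ℤ.* ℤ.+ 1) (ℤₚ.*-identityʳ (ℤ.+ n)))))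

  ≤-ι : ∀ p → p ≤ ι ℤ.∣ ↥ p ∣
  ≤-ι p@record{} = toℚᵘ-cancel-≤ (ℚᵘₚ.≤-respʳ-≃ (ℚᵘₚ.≃-sym (toℚᵘ-ι ℤ.∣ ↥ p ∣)) (ℚᵘ.*≤* (lem (↥ p) (↧ₙ p))))
    where
    lem : ∀ z d .{{_ : ℕ.NonZero d}} → z ℤ.* ℤ.+ 1 ℤ.≤ ℤ.+ ℤ.∣ z ∣ ℤ.* ℤ.+ d
    lem (ℤ.+ n)      (suc d) = subst₂ ℤ._≤_ (sym (ℤₚ.*-identityʳ (ℤ.+ n))) (ℤₚ.pos-* n (suc d)) (ℤ.+≤+ (ℕₚ.m≤m*n n (suc d)))
    lem ℤ.-[1+ n ] (suc d) = subst (ℤ._≤ ℤ.+ suc n ℤ.* ℤ.+ suc d) (sym (ℤₚ.*-identityʳ ℤ.-[1+ n ])) ℤ.-≤+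

  abstract
    -- The default 0 for nonpositive `b` makes this total, so that the constants below are plain
    -- functions that carry no positivity proofs.
    arch : ℚ → ℚ → ℕ
    arch a b with 0ℚ <? b
    ... | yes p = suc ℤ.∣ ↥ (a * recip p) ∣
    ... | no _  = 0

    arch-< : ∀ a {b} → 0ℚ < b → a < ι (arch a b) * b
    arch-< a {b} 0<b with 0ℚ <? b
    ... | no ¬p = ⊥-elim (¬p 0<b)
    ... | yes p = subst (_< ι (suc ℤ.∣ ↥ (a * recip p) ∣) * b) eq (*-monoˡ-<-pos b {{positive p}}
        (≤-<-trans (≤-ι (a * recip p)) (ι-mono-< {ℤ.∣ ↥ (a * recip p) ∣} ℕₚ.≤-refl)))
      where
      eq : a * recip p * b ≡ a
      eq = trans (*-assoc a (recip p) b) (trans (cong (a *_) (recip-inv p)) (*-identityʳ a))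

  half : ℚ
  half = 1/ι 2

  eighth : ℚ
  eighth = 1/ι 8

  eightfold-eighth : ∀ a → eightfold (a * eighth) ≡ a
  eightfold-eighth a = trans (lem a eighth) (trans (cong (a *_) (1/ι-inv 7)) (*-identityʳ a))
    where
    lem : ∀ a b → (a * b + a * b + (a * b + a * b)) + (a * b + a * b + (a * b + a * b)) ≡
      a * (b * (1ℚ + (1ℚ + (1ℚ + (1ℚ + (1ℚ + (1ℚ + (1ℚ + (1ℚ + 0ℚ)))))))))
    lem = solve-∀ ℚ-ring

  1/ι≤1 : ∀ n → 1/ι (suc n) ≤ 1ℚ
  1/ι≤1 n = subst (1/ι (suc n) ≤_) (1/ι-inv n) (subst (_≤ 1/ι (suc n) * ι (suc n)) (*-identityʳ (1/ι (suc n)))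
    (mulˡ (<⇒≤ (0<1/ι (suc n))) (≤-by (ι n) (0≤ι n) refl)))

  module Parameters (ρ : ℚ) (0<ρ : 0ℚ < ρ) (ρ≤1 : ρ ≤ 1ℚ) where

    abstract
      -- The density threshold for a set with `L` classes: a loss of `eta L` in each class adds up
      -- to at most `ρ`.
      eta : ℕ → ℚ
      eta L = ρ * 1/ι (suc L)

      0<eta : ∀ L → 0ℚ < eta L
      0<eta L = 0<* 0<ρ (0<1/ι (suc L))

      eta≤1 : ∀ L → eta L ≤ 1ℚ
      eta≤1 L = ≤-trans (*-≤1 (<⇒≤ (0<1/ι (suc L))) ρ≤1) (1/ι≤1 L)

      ι*eta : ∀ L → ι L * eta L ≤ ρ
      ι*eta L = subst (_≤ ρ) (lem (ι L) ρ (1/ι (suc L)))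
        (subst (ρ * (1/ι (suc L) * ι L) ≤_) (*-identityʳ ρ) (mulˡ (<⇒≤ 0<ρ)
          (subst (1/ι (suc L) * ι L ≤_) (1/ι-inv L) (mulˡ (<⇒≤ (0<1/ι (suc L))) (ι-mono (ℕₚ.n≤1+n L))))))
        where
        lem : ∀ a b c → b * (c * a) ≡ a * (b * c)
        lem = solve-∀ ℚ-ring

      next : ℚ → ℕ → ℚ
      next θ L = θ * eta L * eighth

      0<next : ∀ {θ} → 0ℚ < θ → ∀ L → 0ℚ < next θ L
      0<next h L = 0<* (0<* h (0<eta L)) (0<1/ι 8)

      next≤1 : ∀ {θ} → 0ℚ < θ → θ ≤ 1ℚ → ∀ L → next θ L ≤ 1ℚ
      next≤1 {θ} h k L = ≤-trans (*-≤1 (<⇒≤ (0<1/ι 8)) (≤-trans (*-≤1 (<⇒≤ (0<eta L)) k) (eta≤1 L))) (1/ι≤1 7)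

      eightfold-next : ∀ θ L → eightfold (next θ L) ≤ θ * eta L
      eightfold-next θ L = ≤-reflexive (eightfold-eighth (θ * eta L))

    -- This is `lam * lam * β` with `lam = θ` and `β = θ * η`. The square pays for densities
    -- differing by more than `θ` (Chebyshev), the third `θ` for cells in which the exceptional
    -- event has frequency above `θ` (Markov), and `η` remains.
    tolerance : ℚ → ℚ → ℚ
    tolerance θ η = θ * θ * (θ * η)

    -- A lower bound for the product of all eta's that regularise chooses.  The energy
    -- increment may stop at any stage, hence the minimum over the stages; the precision κ
    -- required at a stage already takes into account every density chosen afterwards.
    bound : ∀ {t} → List (Subset t) → ℚ → ℕ → ℚ
    bound []      θ L = 1ℚ
    bound (g ∷ G) θ L = eta L * stages (λ L₁ → arch (ι L) (κ L₁ * κ L₁)) (bound G (next θ L))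
                                       (arch (ι L) (tolerance (next θ L) (eta L))) L
      where
      κ : ℕ → ℚ
      κ L₁ = next θ L * bound G (next θ L) L₁

    0<bound : ∀ {t} (G : List (Subset t)) {θ} → 0ℚ < θ → ∀ L → 0ℚ < bound G θ L
    0<bound []      h L = 0<1
    0<bound (g ∷ G) {θ} h L = 0<* (0<eta L) (0<stages _ (0<bound G (0<next h L)) (arch (ι L) (tolerance (next θ L) (eta L))) L)

  -- Two demands on the order: no later set contains `g`, which makes later events admissible, and
  -- every nonempty proper subset of `g` comes later, so the later items inside `g` determine the
  -- whole cell of lower colours.
  data Chain {t} : List (Subset t) → Set where
    []  : Chain []
    _∷_ : ∀ {g G} → (Nonempty g × All (λ r → ¬ (g ⊆ r)) G × (∀ f → f ⊊ g → Nonempty f → f ∈ˡ G)) → Chain G → Chain (g ∷ G)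

  module Processing (ρ : ℚ) (0<ρ : 0ℚ < ρ) (ρ≤1 : ρ ≤ 1ℚ) (ν t : ℕ) where
    open Parameters ρ 0<ρ ρ≤1
    open Expectation ν
    open Conditional ν t
    open Dependence ν t
    open Regularity ν t
    open Counting ν t

    module _ {g : Subset t} {γ : X t → ℕ} {L₀ : ℕ} where
      open Energy g γ L₀
      -- Only `p-meas` mentions the colouring, and measurability survives refinement. The densities
      -- remain those of the coarse colouring for which they were defined.
      Reg-refine : ∀ {c c′ lam β κ} → (∀ f {x y} → c′ f x ≡ c′ f y → c f x ≡ c f y) → Reg c lam β κ → Reg c′ lam β κ
      Reg-refine h r = record
        { p = p ; bad = bad ; p-≤1 = p-≤1 ; p-meas = λ a s → p-meas a (λ f f⊊g → h f (s f f⊊g))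
        ; bad-dep = bad-dep ; bad-small = bad-small ; dense = dense ; upper = upper ; lower = lower }
        where open Reg r

    data Regular (c : Colouring) : List (Subset t) → ℚ → ℚ → Set where
      []   : ∀ {θ} → 0ℚ ≤ θ → Regular c [] θ 1ℚ
      cons : ∀ {g G θ π} (γ : X t → ℕ) (L : ℕ) (κ : ℚ) → 0ℚ < θ → θ ≤ 1ℚ →
             (∀ x → c g x ≡ γ x) → (∀ x → γ x ℕ.< L) → Dep g γ →
             Energy.Reg g γ L c (next θ L) (next θ L * eta L) κ → κ ≤ next θ L * π →
             Regular c G (next θ L) π → Regular c (g ∷ G) θ (eta L * π)

    regularise : ∀ {G} → Chain G → ∀ {θ} → 0ℚ < θ → θ ≤ 1ℚ → ∀ {c L} → Valid c L →
      (∀ c′ π → (∀ f {x y} → c′ f x ≡ c′ f y → c f x ≡ c f y) →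
        (∀ f → All (λ r → ¬ (f ⊆ r)) G → ∀ x → c′ f x ≡ c f x) →
        (∀ f → Dep f (c′ f)) → Regular c′ G θ π → bound G θ L ≤ π → ⊥) → ⊥
    regularise [] 0<θ θ≤1 {c} v k = k c 1ℚ (λ _ e → e) (λ _ _ _ → refl) (Valid.dep v) ([] (<⇒≤ 0<θ)) ≤-refl
    regularise {g ∷ G} ((_ , later , _) ∷ ch) {θ} 0<θ θ≤1 {c} {L} v k =
      strong κ (λ L₁ → <⇒≤ (0<κ L₁)) m (λ L₁ → arch-< (ι L) (0<* (0<κ L₁) (0<κ L₁))) (bound G θ′) (<⇒≤ 0<ε)
        (arch (ι L) ε) v
        (<-≤-trans (arch-< (ι L) 0<ε) (≤-by (energy c) (0≤energy c) (+-comm (energy c) _))) after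
      where
      open Energy g (c g) L
      θ′ = next θ L
      0<θ′ = 0<next 0<θ L
      ε = tolerance θ′ (eta L)
      0<ε : 0ℚ < ε
      0<ε = 0<* (0<* 0<θ′ 0<θ′) (0<* 0<θ′ (0<eta L))
      κ : ℕ → ℚ
      κ L₁ = θ′ * bound G θ′ L₁
      0<κ : ∀ L₁ → 0ℚ < κ L₁
      0<κ L₁ = 0<* 0<θ′ (0<bound G 0<θ′ L₁)
      m : ℕ → ℕ
      m L₁ = arch (ι L) (κ L₁ * κ L₁)
      after : ∀ c₁ L₁ c₂ → Valid c₁ L₁ → (∀ f → Dep f (c₂ f)) → Refines g c c₁ → Refines g c₁ c₂ → Uniform c₂ (κ L₁) →
        energy c₂ ≤ energy c₁ + ε → stages m (bound G θ′) (arch (ι L) ε) L ≤ bound G θ′ L₁ → ⊥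
      -- The recursion continues from the coarse `c₁`. The fine `c₂` is dropped: its colour count
      -- has no a priori bound in terms of `κ L₁`, while `κ L₁` was chosen to beat every density
      -- found from `c₁` onwards.
      after c₁ L₁ c₂ v₁ d₂ r₁ r₂ u close low = regularise ch 0<θ′ (next≤1 0<θ θ≤1 L) v₁ finish
        where
        finish : ∀ c′ π → (∀ f {x y} → c′ f x ≡ c′ f y → c₁ f x ≡ c₁ f y) →
          (∀ f → All (λ r → ¬ (f ⊆ r)) G → ∀ x → c′ f x ≡ c₁ f x) →
          (∀ f → Dep f (c′ f)) → Regular c′ G θ′ π → bound G θ′ L₁ ≤ π → ⊥
        finish c′ π finer fixed d′ rs b≤π = k c′ (eta L * π)
          (λ f e → Refines.finer r₁ f (finer f e))
          (λ { f (n ∷ ns) x → trans (fixed f ns x) (Refines.fixed r₁ f (λ f⊊g → n (proj₁ f⊊g)) x) })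
          d′
          (cons (c g) L (κ L₁) 0<θ θ≤1
            (λ x → trans (fixed g later x) (Refines.fixed r₁ g (λ g⊊g → proj₂ g⊊g ⊆-refl) x))
            (Valid.bound v g) (Valid.dep v g)
            (Reg-refine finer (regular (Valid.dep v g) (Valid.dep v₁) d₂ r₂ 0<θ′ close u))
            (mulˡ (<⇒≤ 0<θ′) b≤π) rs)
          (mulˡ (<⇒≤ (0<eta L)) (≤-trans low b≤π))


  -- Typical tuples and the removal lemma

  sumL : ∀ {A : Set} → (A → ℚ) → List A → ℚ
  sumL u []       = 0ℚ
  sumL u (a ∷ as) = u a + sumL u as

  sumL-+ : ∀ {A : Set} (u v : A → ℚ) as → sumL (λ a → u a + v a) as ≡ sumL u as + sumL v as
  sumL-+ u v []       = refl
  sumL-+ u v (a ∷ as) = trans (cong (u a + v a +_) (sumL-+ u v as)) (interchange (u a) (v a) _ _)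

  sumL-mono : ∀ {A : Set} {u v : A → ℚ} as → (∀ a → a ∈ˡ as → u a ≤ v a) → sumL u as ≤ sumL v as
  sumL-mono []       h = ≤-refl
  sumL-mono (a ∷ as) h = +-mono-≤ (h a (here refl)) (sumL-mono as (λ b b∈ → h b (there b∈)))

  sumL-1 : ∀ {A : Set} (as : List A) → sumL (λ _ → 1ℚ) as ≡ ι (length as)
  sumL-1 []       = refl
  sumL-1 (a ∷ as) = cong (1ℚ +_) (sumL-1 as)

  sumL-0 : ∀ {A : Set} (as : List A) → sumL (λ _ → 0ℚ) as ≡ 0ℚ
  sumL-0 []       = refl
  sumL-0 (a ∷ as) = trans (+-identityˡ _) (sumL-0 as)

  module Removal (ρ : ℚ) (0<ρ : 0ℚ < ρ) (ρ≤1 : ρ ≤ 1ℚ) (ν t : ℕ) where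
    open Parameters ρ 0<ρ ρ≤1
    open Expectation ν
    open Conditional ν t
    open Dependence ν t
    open Regularity ν t
    open Counting ν t
    open Processing ρ 0<ρ ρ≤1 ν t

    E-Σ< : ∀ n (u : ℕ → X t → ℚ) → E (λ x → Σ< n (λ a → u a x)) ≡ Σ< n (λ a → E (u a))
    E-Σ< zero    u = E-const {t} 0ℚ
    E-Σ< (suc n) u = trans (E-+ (u n) (λ x → Σ< n (λ a → u a x))) (cong (E (u n) +_) (E-Σ< n u))

    by-class : ∀ (γ : X t → ℕ) L → (∀ x → γ x ℕ.< L) → ∀ (B : ℕ → X t → Bool) {δ} →
      (∀ {a} → a ℕ.< L → E (λ x → ⟦ γ x == a ⟧ * ⟦ B a x ⟧) ≤ δ) → Pr (λ x → B (γ x) x) ≤ ι L * δ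
    by-class γ L γ<L B {δ} h = begin
      Pr (λ x → B (γ x) x)
        ≤⟨ E-mono (λ x → subst (_≤ Σ< L (λ a → ⟦ γ x == a ⟧ * ⟦ B a x ⟧))
             (trans (cong (λ b → ⟦ b ⟧ * ⟦ B (γ x) x ⟧) (≡⇒== {γ x} refl)) (*-identityˡ ⟦ B (γ x) x ⟧))
             (Σ<-term L {λ a → ⟦ γ x == a ⟧ * ⟦ B a x ⟧} (λ a → 0≤* (0≤⟦⟧ (γ x == a)) (0≤⟦⟧ (B a x))) (γ<L x))) ⟩
      E (λ x → Σ< L (λ a → ⟦ γ x == a ⟧ * ⟦ B a x ⟧))
        ≡⟨ E-Σ< L (λ a x → ⟦ γ x == a ⟧ * ⟦ B a x ⟧) ⟩
      Σ< L (λ a → E (λ x → ⟦ γ x == a ⟧ * ⟦ B a x ⟧))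
        ≤⟨ Σ<-bound L δ (λ a → h) ⟩
      ι L * δ ∎
      where open ≤-Reasoning

    module Exceptional {g : Subset t} {γ : X t → ℕ} {L : ℕ} {c : Colouring} {κ θ : ℚ} (0<θ : 0ℚ < θ)
                       (γ<L : ∀ x → γ x ℕ.< L) (γ-dep : Dep g γ) (c-dep : ∀ f → Dep f (c f))
                       (reg : Energy.Reg g γ L c θ (θ * eta L) κ) where
      open Energy.Reg reg
      P = colours g c
      open Partition P using (rel)

      sparse : ℕ → X t → Bool
      sparse a x = p a x ≺ eta L

      -- The conditional frequency of `bad a` in the cell of `x` exceeds `θ`, with the mass of the
      -- cell multiplied out.
      rough : ℕ → X t → Bool
      rough a x = (θ * mass P x) ≺ E (λ y → ⟦ rel x y ⟧ * ⟦ bad a y ⟧)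

      p-dep : ∀ a → Dep g (p a)
      p-dep a = colours-dep g c c-dep (λ s → p-meas a (colours-from g c s))

      sparse-dep : Dep g (λ x → sparse (γ x) x)
      sparse-dep {x} {y} ag = cong (_≺ eta L) (trans (cong (λ a → p a x) (γ-dep ag)) (p-dep (γ y) ag))

      rough-dep : Dep g (λ x → rough (γ x) x)
      rough-dep {x} {y} ag = cong₂ _≺_ (cong (θ *_) (mass-dep ag))
        (trans (cong (λ a → E (λ z → ⟦ rel x z ⟧ * ⟦ bad a z ⟧)) (γ-dep ag)) (bad-mass-dep ag))
        where
        mass-dep : Dep g (mass P)
        mass-dep = colours-dep g c c-dep (mass-meas P)
        bad-mass-dep : ∀ {x y} → Agree g x y →
          E (λ z → ⟦ rel x z ⟧ * ⟦ bad (γ y) z ⟧) ≡ E (λ z → ⟦ rel y z ⟧ * ⟦ bad (γ y) z ⟧)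
        bad-mass-dep {x} {y} = colours-dep g c {b = λ x → E (λ z → ⟦ rel x z ⟧ * ⟦ bad (γ y) z ⟧)} c-dep
          (λ s → E-cong (λ z → cong (λ b → ⟦ b ⟧ * ⟦ bad (γ y) z ⟧) (rel-congˡ P s z)))

      Pr-sparse : Pr (λ x → sparse (γ x) x) ≤ ρ
      Pr-sparse = ≤-trans (by-class γ L γ<L sparse (λ {a} _ → dense a (eta L) (<⇒≤ (0<eta L)))) (ι*eta L)

      -- The conditional expectation of `bad a` has mean at most `θ * eta L`, so by Markov it
      -- exceeds `θ` with probability at most `eta L`; then sum over the classes.
      Pr-rough : Pr (λ x → rough (γ x) x) ≤ ρ
      Pr-rough = ≤-trans (by-class γ L γ<L rough (λ {a} a<L → ≤-trans
          (E-mono (λ x → *-≤1 (0≤⟦⟧ (rough a x)) (⟦⟧≤1 (γ x == a)))) (small a<L))) (ι*eta L)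
        where
        markov : ∀ a x → θ * ⟦ rough a x ⟧ ≤ cexp P (λ y → ⟦ bad a y ⟧) x
        markov a x = ≺-elim (θ * mass P x) (E (λ y → ⟦ rel x y ⟧ * ⟦ bad a y ⟧))
          (λ z → θ * ⟦ z ⟧ ≤ cexp P (λ y → ⟦ bad a y ⟧) x)
          (λ lt → subst (_≤ cexp P (λ y → ⟦ bad a y ⟧) x) (sym (*-identityʳ θ))
            (cancel-*ˡ (0<mass P x) (subst₂ _≤_ (*-comm θ (mass P x)) (cexp-mass P (λ y → ⟦ bad a y ⟧) x) (<⇒≤ lt))))
          (λ _ → subst (_≤ cexp P (λ y → ⟦ bad a y ⟧) x) (sym (*-zeroʳ θ)) (cexp-0≤ P (λ y → 0≤⟦⟧ (bad a y)) x))
        mean : ∀ a → E (cexp P (λ y → ⟦ bad a y ⟧)) ≡ E (λ y → ⟦ bad a y ⟧)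
        mean a = trans (E-cong (λ x → sym (*-identityʳ (cexp P (λ y → ⟦ bad a y ⟧) x))))
          (trans (cexp-orth P (λ y → ⟦ bad a y ⟧) (λ _ → 1ℚ) (λ _ → refl)) (E-cong (λ x → *-identityʳ ⟦ bad a x ⟧)))
        small : ∀ {a} → a ℕ.< L → Pr (rough a) ≤ eta L
        small {a} a<L = cancel-*ˡ 0<θ (begin
          θ * Pr (rough a)                     ≡⟨ sym (E-* θ (λ x → ⟦ rough a x ⟧)) ⟩
          E (λ x → θ * ⟦ rough a x ⟧)          ≤⟨ E-mono (markov a) ⟩
          E (cexp P (λ y → ⟦ bad a y ⟧))       ≡⟨ mean a ⟩
          E (λ y → ⟦ bad a y ⟧)                ≤⟨ bad-small a<L ⟩
          θ * eta L                            ∎)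
          where open ≤-Reasoning

    module _ {c : Colouring} (c-dep : ∀ f → Dep f (c f)) where

      exceptions : ∀ {G θ π} → Regular c G θ π → X t → ℚ
      exceptions ([] _) τ = 0ℚ
      exceptions (cons {θ = θ} γ L κ 0<θ θ≤1 c≡γ γ<L γ-dep reg κ≤ rs) τ =
        (⟦ sparse (γ τ) τ ⟧ + ⟦ rough (γ τ) τ ⟧) + exceptions rs τ
        where open Exceptional (0<next 0<θ L) γ<L γ-dep c-dep reg

      Typical : ∀ {G θ π} → Regular c G θ π → X t → Set
      Typical ([] _) τ = Unit
      Typical (cons {θ = θ} γ L κ 0<θ θ≤1 c≡γ γ<L γ-dep reg κ≤ rs) τ =
        (sparse (γ τ) τ ≡ false) × (rough (γ τ) τ ≡ false) × Typical rs τ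
        where open Exceptional (0<next 0<θ L) γ<L γ-dep c-dep reg

      0≤exceptions : ∀ {G θ π} (rs : Regular c G θ π) τ → 0ℚ ≤ exceptions rs τ
      0≤exceptions ([] _) τ = ≤-refl
      0≤exceptions (cons {θ = θ} γ L κ 0<θ θ≤1 c≡γ γ<L γ-dep reg κ≤ rs) τ =
        0≤+ (0≤+ (0≤⟦⟧ (sparse (γ τ) τ)) (0≤⟦⟧ (rough (γ τ) τ))) (0≤exceptions rs τ)
        where open Exceptional (0<next 0<θ L) γ<L γ-dep c-dep reg

      typical? : ∀ {G θ π} (rs : Regular c G θ π) τ → Typical rs τ ⊎ 1ℚ ≤ exceptions rs τ
      typical? ([] _) τ = inj₁ tt
      typical? (cons {θ = θ} γ L κ 0<θ θ≤1 c≡γ γ<L γ-dep reg κ≤ rs) τ =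
        go (sparse (γ τ) τ) (rough (γ τ) τ) (typical? rs τ)
        where
        open Exceptional (0<next 0<θ L) γ<L γ-dep c-dep reg using (sparse; rough)
        go : ∀ a b → Typical rs τ ⊎ 1ℚ ≤ exceptions rs τ →
          (a ≡ false × b ≡ false × Typical rs τ) ⊎ 1ℚ ≤ (⟦ a ⟧ + ⟦ b ⟧) + exceptions rs τ
        go false false (inj₁ h) = inj₁ (refl , refl , h)
        go false false (inj₂ h) = inj₂ (subst (1ℚ ≤_) (sym (+-identityˡ (exceptions rs τ))) h)
        go true  b     _ = inj₂ (≤-by (⟦ b ⟧ + exceptions rs τ) (0≤+ (0≤⟦⟧ b) (0≤exceptions rs τ)) (+-assoc 1ℚ ⟦ b ⟧ _))
        go false true  _ = inj₂ (≤-by (exceptions rs τ) (0≤exceptions rs τ) refl)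

      module _ (T : List (X t)) {K : ℚ} where
        Dominated : Subset t → Set
        Dominated g = ∀ {B : X t → Bool} → Dep g B → sumL (λ τ → ⟦ B τ ⟧) T ≤ K * Pr B

        -- Both exceptional events of `g` depend on the coordinates in `g` only. This is exactly the
        -- kind of event for which domination transfers smallness from the uniform measure to `T`.
        few-exceptions : 0ℚ ≤ K → ∀ {G θ π} (rs : Regular c G θ π) → All Dominated G →
          sumL (exceptions rs) T ≤ ι (length G) * (K * ρ + K * ρ)
        few-exceptions 0≤K ([] _) [] = ≤-reflexive (trans (sumL-0 T) (sym (*-zeroˡ (K * ρ + K * ρ))))
        few-exceptions 0≤K {g ∷ G} (cons {θ = θ} γ L κ 0<θ θ≤1 c≡γ γ<L γ-dep reg κ≤ rs) (d ∷ ds) = begin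
          sumL (λ τ → (⟦ sparse (γ τ) τ ⟧ + ⟦ rough (γ τ) τ ⟧) + exceptions rs τ) T
            ≡⟨ trans (sumL-+ (λ τ → ⟦ sparse (γ τ) τ ⟧ + ⟦ rough (γ τ) τ ⟧) (exceptions rs) T)
                 (cong (_+ sumL (exceptions rs) T) (sumL-+ (λ τ → ⟦ sparse (γ τ) τ ⟧) (λ τ → ⟦ rough (γ τ) τ ⟧) T)) ⟩
          (sumL (λ τ → ⟦ sparse (γ τ) τ ⟧) T + sumL (λ τ → ⟦ rough (γ τ) τ ⟧) T) + sumL (exceptions rs) T
            ≤⟨ +-mono-≤ (+-mono-≤ (≤-trans (d sparse-dep) (mulˡ 0≤K Pr-sparse)) (≤-trans (d rough-dep) (mulˡ 0≤K Pr-rough)))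
                 (few-exceptions 0≤K rs ds) ⟩
          (K * ρ + K * ρ) + ι (length G) * (K * ρ + K * ρ)
            ≡⟨ lem (ι (length G)) (K * ρ + K * ρ) ⟩
          ι (length (g ∷ G)) * (K * ρ + K * ρ) ∎
          where
          open ≤-Reasoning
          open Exceptional (0<next 0<θ L) γ<L γ-dep c-dep reg
          lem : ∀ a b → b + a * b ≡ (1ℚ + a) * b
          lem = solve-∀ ℚ-ring

        -- First moment: if no element were typical, each would contribute at least 1 to the sum of
        -- the exceptions.
        typical-exists : 0ℚ ≤ K → ∀ {G θ π} (rs : Regular c G θ π) → All Dominated G →
          ι (length G) * (K * ρ + K * ρ) < ι (length T) → (∀ τ → τ ∈ˡ T → Typical rs τ → ⊥) → ⊥
        typical-exists 0≤K {G} rs ds lt none = <-irrefl refl (<-≤-trans lt (subst (_≤ ι (length G) * (K * ρ + K * ρ)) (sumL-1 T)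
          (≤-trans (sumL-mono T all-bad) (few-exceptions 0≤K rs ds))))
          where
          all-bad : ∀ τ → τ ∈ˡ T → 1ℚ ≤ exceptions rs τ
          all-bad τ τ∈T with typical? rs τ
          ... | inj₁ h = ⊥-elim (none τ τ∈T h)
          ... | inj₂ h = h

      module _ (τ : X t) where
        items : ∀ {G θ π} → Regular c G θ π → List Item
        items ([] _) = []
        items (cons {g = g} γ L κ 0<θ θ≤1 c≡γ γ<L γ-dep reg κ≤ rs) =
          item g (λ x → γ x == γ τ) (Energy.Reg.bad reg (γ τ)) (Energy.Reg.p reg (γ τ) τ) ∷ items rs

        cut⇒same : ∀ h {G θ π} (rs : Regular c G θ π) {x} → cut h (items rs) x ≡ true → ∀ {f} → f ∈ˡ G → f ⊆ h → c f x ≡ c f τ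
        cut⇒same h (cons {g = g} γ L κ 0<θ θ≤1 c≡γ γ<L γ-dep reg κ≤ rs) {x} e f∈ f⊆h with g ⊆? h
        cut⇒same h (cons γ L κ 0<θ θ≤1 c≡γ γ<L γ-dep reg κ≤ rs) {x} e (here refl) f⊆h | yes _ =
          trans (c≡γ x) (trans (==⇒≡ (∧-left e)) (sym (c≡γ τ)))
        cut⇒same h (cons γ L κ 0<θ θ≤1 c≡γ γ<L γ-dep reg κ≤ rs) {x} e (there f∈) f⊆h | yes _ =
          cut⇒same h rs (∧-right {γ x == γ τ} e) f∈ f⊆h
        cut⇒same h (cons γ L κ 0<θ θ≤1 c≡γ γ<L γ-dep reg κ≤ rs) e (here refl) f⊆h | no ¬a = ⊥-elim (¬a f⊆h)
        cut⇒same h (cons γ L κ 0<θ θ≤1 c≡γ γ<L γ-dep reg κ≤ rs) e (there f∈) f⊆h | no _ = cut⇒same h rs e f∈ f⊆h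

        same⇒cut : ∀ h {G θ π} (rs : Regular c G θ π) {x} → (∀ {f} → f ∈ˡ G → f ⊆ h → c f x ≡ c f τ) → cut h (items rs) x ≡ true
        same⇒cut h ([] _) s = refl
        same⇒cut h (cons {g = g} γ L κ 0<θ θ≤1 c≡γ γ<L γ-dep reg κ≤ rs) {x} s with g ⊆? h
        ... | yes a = ∧-true (≡⇒== (trans (sym (c≡γ x)) (trans (s (here refl) a) (c≡γ τ)))) (same⇒cut h rs (λ f∈ → s (there f∈)))
        ... | no _  = same⇒cut h rs (λ f∈ → s (there f∈))

        later-items : ∀ {G θ π} (rs : Regular c G θ π) {g} → All (λ r → ¬ (g ⊆ r)) G → All (λ j → ¬ (g ⊆ Item.g j)) (items rs)
        later-items ([] _) [] = []
        later-items (cons γ L κ 0<θ θ≤1 c≡γ γ<L γ-dep reg κ≤ rs) (n ∷ ns) = n ∷ later-items rs ns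

        -- On the cell of `τ` the function `p` is constant, so the integral inequalities of `Reg`
        -- become inequalities with the number `p a τ`. That `τ` is not sparse gives `η≤p`; that it
        -- is not rough gives `rare`.
        steps : ∀ {G} → Chain G → ∀ {θ π} (rs : Regular c G θ π) → Typical rs τ → Steps (items rs) θ π
        steps [] ([] h) _ = [] h
        steps {g ∷ G} ((ne , later , below) ∷ ch) {θ} (cons {π = π} γ L κ 0<θ θ≤1 c≡γ γ<L γ-dep reg κ≤ rs) (¬sparse , ¬rough , ty) =
          step ∷ steps ch rs ty
          where
          open Energy.Reg reg
          open Exceptional (0<next 0<θ L) γ<L γ-dep c-dep reg using (sparse; rough; P)
          open Partition P using (rel)
          is = items rs
          a = γ τ
          θ′ = next θ L

          cut⇒below : ∀ x → cut g is x ≡ true → ∀ f → f ⊊ g → c f x ≡ c f τ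
          cut⇒below x e f f⊊g with nonempty? f
          ... | yes f≠∅ = cut⇒same g rs e (below f f⊊g f≠∅) (proj₁ f⊊g)
          -- The chain omits the empty set, but a colouring that depends on no coordinate is
          -- constant.
          ... | no f=∅  = c-dep f (λ i∈f → ⊥-elim (f=∅ (_ , i∈f)))

          cut≡rel : ∀ x → cut g is x ≡ rel τ x
          cut≡rel x = bool-ext
            (λ e → colours-to g c (λ f f⊊g → sym (cut⇒below x e f f⊊g)))
            (λ e → same⇒cut g rs (λ {f} f∈ f⊆g → sym (colours-from g c e f (f⊆g , λ g⊆f → All.lookup later f∈ g⊆f))))

          p≡ : ∀ x → cut g is x ≡ true → p a x ≡ p a τ
          p≡ x e = p-meas a (cut⇒below x e)

          not-sparse : ∀ u v → u ≺ v ≡ false → v ≤ u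
          not-sparse u v = ≺-elim u v (λ b → b ≡ false → v ≤ u) (λ _ ()) (λ le _ → le)

          expand : ∀ (u : X t → ℚ) (Φ : X t → Bool) → E (λ x → (u x + (θ′ + ⟦ bad a x ⟧)) * ⟦ Φ x ⟧) ≡
            E (λ x → u x * ⟦ Φ x ⟧) + (θ′ * Pr Φ + Pr (λ x → bad a x ∧ Φ x))
          expand u Φ = begin
            E (λ x → (u x + (θ′ + ⟦ bad a x ⟧)) * ⟦ Φ x ⟧)
              ≡⟨ E-cong (λ x → trans (lem (u x) θ′ ⟦ bad a x ⟧ ⟦ Φ x ⟧)
                   (cong (λ z → u x * ⟦ Φ x ⟧ + (θ′ * ⟦ Φ x ⟧ + z)) (sym (⟦⟧-∧ (bad a x) (Φ x))))) ⟩
            E (λ x → u x * ⟦ Φ x ⟧ + (θ′ * ⟦ Φ x ⟧ + ⟦ bad a x ∧ Φ x ⟧))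
              ≡⟨ trans (E-+ (λ x → u x * ⟦ Φ x ⟧) (λ x → θ′ * ⟦ Φ x ⟧ + ⟦ bad a x ∧ Φ x ⟧))
                   (cong (E (λ x → u x * ⟦ Φ x ⟧) +_) (trans (E-+ (λ x → θ′ * ⟦ Φ x ⟧) (λ x → ⟦ bad a x ∧ Φ x ⟧))
                     (cong (_+ Pr (λ x → bad a x ∧ Φ x)) (E-* θ′ (λ x → ⟦ Φ x ⟧))))) ⟩
            E (λ x → u x * ⟦ Φ x ⟧) + (θ′ * Pr Φ + Pr (λ x → bad a x ∧ Φ x)) ∎
            where
            open ≡-Reasoning
            lem : ∀ u l b f → (u + (l + b)) * f ≡ u * f + (l * f + b * f)
            lem = solve-∀ ℚ-ring

          p-const : ∀ (Φ : X t → Bool) → (∀ x → Φ x ≡ true → cut g is x ≡ true) → E (λ x → p a x * ⟦ Φ x ⟧) ≡ p a τ * Pr Φ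
          p-const Φ Φ⇒ = trans (E-cong (λ x → trans (*-comm (p a x) ⟦ Φ x ⟧)
              (trans (⟦⟧-guard (Φ x) (λ e → p≡ x (Φ⇒ x e))) (*-comm ⟦ Φ x ⟧ (p a τ)))))
            (E-* (p a τ) (λ x → ⟦ Φ x ⟧))

          class-∧ : ∀ (Φ : X t → Bool) → E (λ x → ⟦ γ x == a ⟧ * ⟦ Φ x ⟧) ≡ Pr (λ x → (γ x == a) ∧ Φ x)
          class-∧ Φ = E-cong (λ x → sym (⟦⟧-∧ (γ x == a) (Φ x)))

          step : Step (item g (λ x → γ x == γ τ) (bad a) (p a τ)) is θ θ′ (eta L) π
          step = record
            { nonempty = ne ; later = later-items rs later
            ; A-dep = λ ag → cong (_== a) (γ-dep ag) ; bad-dep = bad-dep a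
            ; 0<η = 0<eta L ; η≤p = not-sparse (p a τ) (eta L) ¬sparse ; p≤1 = p-≤1 a τ
            ; 0≤θ′ = <⇒≤ (0<next 0<θ L) ; θ′≤1 = next≤1 0<θ θ≤1 L ; θ′-small = eightfold-next θ L ; 0≤θ = <⇒≤ 0<θ
            ; κ = κ ; κ-small = κ≤
            ; upper = λ {Φ} adm Φ⇒ → subst₂ _≤_ (class-∧ Φ)
                (trans (cong (_+ κ) (trans (expand (p a) Φ) (cong (_+ (θ′ * Pr Φ + Pr (λ x → bad a x ∧ Φ x))) (p-const Φ Φ⇒))))
                  (+-assoc (p a τ * Pr Φ) _ κ))
                (upper (γ<L τ) adm)
            ; lower = λ {Φ} adm Φ⇒ → subst₂ _≤_ (p-const Φ Φ⇒)
                (trans (cong (_+ κ) (trans (expand (λ x → ⟦ γ x == a ⟧) Φ) (cong (_+ (θ′ * Pr Φ + Pr (λ x → bad a x ∧ Φ x))) (class-∧ Φ))))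
                  (+-assoc (Pr (λ x → (γ x == a) ∧ Φ x)) _ κ))
                (lower (γ<L τ) adm)
            ; rare = subst₂ (λ u v → u ≤ θ′ * v)
                (E-cong (λ x → trans (sym (⟦⟧-∧ (rel τ x) (bad a x)))
                  (cong ⟦_⟧ (trans (Boolₚ.∧-comm (rel τ x) (bad a x)) (cong (bad a x ∧_) (sym (cut≡rel x)))))))
                (E-cong (λ x → cong ⟦_⟧ (sym (cut≡rel x))))
                (not-sparse (θ′ * mass P τ) (E (λ y → ⟦ rel τ y ⟧ * ⟦ bad a y ⟧)) ¬rough)
            }

    -- A typical `τ` exists by the size of `T`, and the tuples sharing its refined colours share its
    -- original ones. Starting from relative error `half` leaves half of the predicted weight, whose
    -- lower bound does not involve `ν`.
    removal : ∀ {G} → Chain G → ∀ {c L} → Valid c L → ∀ (T : List (X t)) {K} → 0ℚ ≤ K →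
      All (λ g → ∀ {B : X t → Bool} → Dep g B → sumL (λ τ → ⟦ B τ ⟧) T ≤ K * Pr B) G →
      ι (length G) * (K * ρ + K * ρ) < ι (length T) →
      (∀ τ → τ ∈ˡ T → (∀ (Φ : X t → Bool) → (∀ x → (∀ {f} → f ∈ˡ G → c f x ≡ c f τ) → Φ x ≡ true) →
        half * bound G half L ≤ Pr Φ) → ⊥) → ⊥
    removal {G} ch {c} {L} v T {K} 0≤K dom lt k = regularise ch (0<1/ι 2) (1/ι≤1 1) v
      (λ c′ π finer _ d′ rs b≤π → typical-exists d′ T {K} 0≤K rs dom lt
        (λ τ τ∈T ty → k τ τ∈T (λ Φ h → begin
          half * bound G half L
            ≤⟨ mulˡ 0≤half b≤π ⟩
          half * π
            ≤⟨ mulˡ 0≤half (π≤weight (steps d′ τ ch rs ty) full) ⟩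
          half * weight full (items d′ τ rs)
            ≤⟨ halve (weight full (items d′ τ rs)) (Pr (cut full (items d′ τ rs)))
                 (counting-lower (steps d′ τ ch rs ty) full) ⟩
          Pr (cut full (items d′ τ rs))
            ≤⟨ Pr-mono (λ x e → h x (λ {f} f∈ → finer f (cut⇒same d′ τ full rs e f∈ ⊆⊤))) ⟩
          Pr Φ ∎)))
      where
      open ≤-Reasoning
      0≤half : 0ℚ ≤ half
      0≤half = <⇒≤ (0<1/ι 2)
      halve : ∀ w P → w ≤ P + half * w → half * w ≤ P
      halve w P h = 0≤⇒≤ (subst (0ℚ ≤_) eq (≤⇒0≤ h))
        where
        two-halves : half * (1ℚ + (1ℚ + 0ℚ)) ≡ 1ℚ
        two-halves = 1/ι-inv 1
        lem : ∀ P h w → (P + h * w) - (h * (1ℚ + (1ℚ + 0ℚ))) * w ≡ P - h * w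
        lem = solve-∀ ℚ-ring
        eq : (P + half * w) - w ≡ P - half * w
        eq = trans (cong (λ z → (P + half * w) - z) (trans (sym (*-identityˡ w)) (cong (_* w) (sym two-halves)))) (lem P half w)


  -- Finite sets

  ⊆-tail : ∀ {t b b′} (p q : Subset t) → (b ∷ p) ⊆ (b′ ∷ q) → p ⊆ q
  ⊆-tail p q s i∈p = drop-there (s (there i∈p))

  -- Listing `inside` before `outside` at every coordinate puts each set ahead of its proper
  -- subsets.
  subsets-sorted : ∀ t → AllPairs (λ (g r : Subset t) → ¬ (g ⊆ r)) (subsets t)
  subsets-sorted zero    = [] ∷ []
  subsets-sorted (suc t) = AllPairsₚ.++⁺
    (AllPairsₚ.map⁺ (shift (subsets-sorted t)))
    (AllPairsₚ.map⁺ (shift (subsets-sorted t)))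
    (Allₚ.map⁺ (All.tabulate (λ {g} _ → Allₚ.map⁺ (All.tabulate (λ {r} _ → cross g r)))))
    where
    shift : ∀ {b xs} → AllPairs (λ (g r : Subset t) → ¬ (g ⊆ r)) xs →
      AllPairs (λ (g r : Subset t) → ¬ ((b ∷ g) ⊆ (b ∷ r))) xs
    shift []       = []
    shift {b} {g ∷ _} (a ∷ as) = All.map (λ {r} n (s : (b ∷ g) ⊆ (b ∷ r)) → n (⊆-tail g r s)) a ∷ shift as
    cross : ∀ (g r : Subset t) → ¬ ((inside ∷ g) ⊆ (outside ∷ r))
    cross g r s with s here
    ... | ()

  Small : ∀ {t} → ℕ → Subset t → Set
  Small k g = Nonempty g × ∣ g ∣ ℕ.≤ k

  small? : ∀ {t} k (g : Subset t) → Dec (Small k g)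
  small? k g = nonempty? g ×-dec (∣ g ∣ ℕ.≤? k)

  smallSubsets : ∀ t → ℕ → List (Subset t)
  smallSubsets t k = filter (small? k) (subsets t)

  ∈-smallSubsets : ∀ {t k} {g : Subset t} → Small k g → g ∈ˡ smallSubsets t k
  ∈-smallSubsets {g = g} s = ∈-filter⁺ (small? _) (∈-subsets g) s

  -- The invariant is that a small set either is still in the list or has been passed, in which case
  -- no remaining set contains it. A proper subset of the head cannot have been passed.
  smallSubsets-chain : ∀ t k → Chain (smallSubsets t k)
  smallSubsets-chain t k = go (AllPairsₚ.filter⁺ (small? k) (subsets-sorted t))
    (Allₚ.all-filter (small? k) (subsets t)) (λ s → inj₁ (∈-smallSubsets s))
    where
    go : ∀ {G} → AllPairs (λ (g r : Subset t) → ¬ (g ⊆ r)) G → All (Small k) G →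
      (∀ {f : Subset t} → Small k f → f ∈ˡ G ⊎ All (λ r → ¬ (f ⊆ r)) G) → Chain G
    go [] [] _ = []
    go {g ∷ G} (later ∷ ps) ((ne , size) ∷ ss) complete = (ne , later , below) ∷ go ps ss complete′
      where
      below : ∀ f → f ⊊ g → Nonempty f → f ∈ˡ G
      below f (f⊆g , g⊈f) f≠∅ with complete {f} (f≠∅ , ℕₚ.≤-trans (p⊆q⇒∣p∣≤∣q∣ f⊆g) size)
      ... | inj₁ (here refl)  = ⊥-elim (g⊈f f⊆g)
      ... | inj₁ (there f∈G)  = f∈G
      ... | inj₂ (f⊈g ∷ _)    = ⊥-elim (f⊈g f⊆g)
      complete′ : ∀ {f : Subset t} → Small k f → f ∈ˡ G ⊎ All (λ r → ¬ (f ⊆ r)) G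
      complete′ s with complete s
      ... | inj₁ (here refl)  = inj₂ later
      ... | inj₁ (there f∈G)  = inj₁ f∈G
      ... | inj₂ (_ ∷ ns)     = inj₂ ns

  lookup-injective : ∀ {A : Set} {xs : List A} → Unique xs → ∀ {i j} → List.lookup xs i ≡ List.lookup xs j → i ≡ j
  lookup-injective {xs = x ∷ xs} (x∉ ∷ u) {zero}  {zero}  e = refl
  lookup-injective {xs = x ∷ xs} (x∉ ∷ u) {zero}  {suc j} e = ⊥-elim (All.lookup x∉ (∈-lookup j) e)
  lookup-injective {xs = x ∷ xs} (x∉ ∷ u) {suc i} {zero}  e = ⊥-elim (All.lookup x∉ (∈-lookup i) (sym e))
  lookup-injective {xs = x ∷ xs} (x∉ ∷ u) {suc i} {suc j} e = cong suc (lookup-injective u e)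

  ksubsets : ∀ t → ℕ → List (Subset t)
  ksubsets zero    zero    = [] ∷ []
  ksubsets zero    (suc k) = []
  ksubsets (suc t) zero    = List.map (outside ∷_) (ksubsets t zero)
  ksubsets (suc t) (suc k) = List.map (inside ∷_) (ksubsets t k) ++ List.map (outside ∷_) (ksubsets t (suc k))

  nC0≡1 : ∀ n → n C 0 ≡ 1
  nC0≡1 n = trans (nCk≡nC[n∸k] {0} {n} z≤n) (nCn≡1 n)

  length-ksubsets : ∀ t k → length (ksubsets t k) ≡ t C k
  length-ksubsets zero    zero    = refl
  length-ksubsets zero    (suc k) = sym (k>n⇒nCk≡0 (s≤s (z≤n {k})))
  length-ksubsets (suc t) zero    = trans (Listₚ.length-map (outside ∷_) (ksubsets t zero))
    (trans (length-ksubsets t zero) (trans (nC0≡1 t) (sym (nC0≡1 (suc t)))))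
  length-ksubsets (suc t) (suc k) = trans (Listₚ.length-++ (List.map (inside ∷_) (ksubsets t k)))
    (trans (cong₂ ℕ._+_ (trans (Listₚ.length-map (inside ∷_) (ksubsets t k)) (length-ksubsets t k))
      (trans (Listₚ.length-map (outside ∷_) (ksubsets t (suc k))) (length-ksubsets t (suc k))))
      (nCk+nC[k+1]≡[n+1]C[k+1] t k))

  ksubsets-size : ∀ t k → All (λ f → ∣ f ∣ ≡ k) (ksubsets t k)
  ksubsets-size zero    zero    = refl ∷ []
  ksubsets-size zero    (suc k) = []
  ksubsets-size (suc t) zero    = Allₚ.map⁺ (ksubsets-size t zero)
  ksubsets-size (suc t) (suc k) = Allₚ.++⁺ (Allₚ.map⁺ (All.map (cong suc) (ksubsets-size t k)))
    (Allₚ.map⁺ (ksubsets-size t (suc k)))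

  ksubsets-unique : ∀ t k → Unique (ksubsets t k)
  ksubsets-unique zero    zero    = [] ∷ []
  ksubsets-unique zero    (suc k) = []
  ksubsets-unique (suc t) zero    = Uniqueₚ.map⁺ Vecₚ.∷-injectiveʳ (ksubsets-unique t zero)
  ksubsets-unique (suc t) (suc k) = Uniqueₚ.++⁺ (Uniqueₚ.map⁺ Vecₚ.∷-injectiveʳ (ksubsets-unique t k))
    (Uniqueₚ.map⁺ Vecₚ.∷-injectiveʳ (ksubsets-unique t (suc k))) disjoint
    where
    disjoint : ∀ {v} → v ∈ˡ List.map (inside ∷_) (ksubsets t k) × v ∈ˡ List.map (outside ∷_) (ksubsets t (suc k)) → ⊥
    disjoint (p , q) with ∈-map⁻ (inside ∷_) p | ∈-map⁻ (outside ∷_) q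
    ... | _ , _ , refl | _ , _ , ()

  ⊆-by-size : ∀ {t} {p q : Subset t} → p ⊆ q → ∣ q ∣ ℕ.≤ ∣ p ∣ → p ≡ q
  ⊆-by-size {p = []} {[]} _ _ = refl
  ⊆-by-size {p = true ∷ p}  {true ∷ q}  s h = cong (true ∷_) (⊆-by-size (⊆-tail p q s) (ℕₚ.≤-pred h))
  ⊆-by-size {p = false ∷ p} {false ∷ q} s h = cong (false ∷_) (⊆-by-size (⊆-tail p q s) h)
  ⊆-by-size {p = false ∷ p} {true ∷ q}  s h = ⊥-elim (ℕₚ.<⇒≱ h (p⊆q⇒∣p∣≤∣q∣ (⊆-tail p q s)))
  ⊆-by-size {p = true ∷ p}  {false ∷ q} s h with s here
  ... | ()

  ∪-size : ∀ {t k} {f f′ : Subset t} → ∣ f ∣ ≡ k → ∣ f′ ∣ ≡ k → f ≢ f′ → k ℕ.< ∣ f ∪ f′ ∣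
  ∪-size {k = k} {f} {f′} ef ef′ f≢ with ∣ f ∪ f′ ∣ ℕ.≤? k
  ... | no ¬p = ℕₚ.≰⇒> ¬p
  ... | yes p = ⊥-elim (f≢ (trans
    (⊆-by-size (p⊆p∪q f′) (subst (∣ f ∪ f′ ∣ ℕ.≤_) (sym ef) p))
    (sym (⊆-by-size (q⊆p∪q f f′) (subst (∣ f ∪ f′ ∣ ℕ.≤_) (sym ef′) p)))))

  enlarge : ∀ {t k} (g : Subset t) → ∣ g ∣ ℕ.≤ k → k ℕ.≤ t → ∃ λ h → g ⊆ h × ∣ h ∣ ≡ k
  enlarge [] z≤n z≤n = [] , (λ ()) , refl
  enlarge {suc t} {suc k} (true ∷ g) (s≤s a) (s≤s b) with enlarge g a b
  ... | h , g⊆h , e = inside ∷ h , (λ { here → here ; (there i) → there (g⊆h i) }) , cong suc e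
  enlarge {suc t} {zero} (false ∷ g) a b with enlarge g a z≤n
  ... | h , g⊆h , e = outside ∷ h , (λ { (there i) → there (g⊆h i) }) , e
  enlarge {suc t} {suc k} (false ∷ g) a (s≤s b) with ∣ g ∣ ℕ.≤? k
  ... | yes p with enlarge g p b
  ... | h , g⊆h , e = inside ∷ h , (λ { (there i) → there (g⊆h i) }) , cong suc e
  enlarge {suc t} {suc k} (false ∷ g) a (s≤s b) | no ¬p =
    outside ∷ g , (λ x → x) , ℕₚ.≤-antisym a (ℕₚ.≰⇒> ¬p)

  enumerate : ∀ {n} (S : Subset n) → Fin ∣ S ∣ → Fin n
  enumerate (true ∷ S)  zero    = zero
  enumerate (true ∷ S)  (suc i) = suc (enumerate S i)
  enumerate (false ∷ S) i       = suc (enumerate S i)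

  enumerate-∈ : ∀ {n} (S : Subset n) i → enumerate S i ∈ S
  enumerate-∈ (true ∷ S)  zero    = here
  enumerate-∈ (true ∷ S)  (suc i) = there (enumerate-∈ S i)
  enumerate-∈ (false ∷ S) i       = there (enumerate-∈ S i)

  enumerate-injective : ∀ {n} (S : Subset n) {i j} → enumerate S i ≡ enumerate S j → i ≡ j
  enumerate-injective (true ∷ S)  {zero}  {zero}  e = refl
  enumerate-injective (true ∷ S)  {suc i} {suc j} e = cong suc (enumerate-injective S (Finₚ.suc-injective e))
  enumerate-injective (false ∷ S) {i}     {j}     e = enumerate-injective S (Finₚ.suc-injective e)

  -- Inclusion-exclusion for `p` and `r ∪ y`, with their intersection weakened to `p ∩ y`.
  ∪-∣∣ : ∀ {n} (p r y : Subset n) → ∣ (p ∪ r) ∪ y ∣ ℕ.+ ∣ p ∩ y ∣ ℕ.≤ ∣ p ∣ ℕ.+ ∣ r ∪ y ∣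
  ∪-∣∣ [] [] [] = z≤n
  ∪-∣∣ (true ∷ p) (r₀ ∷ r) (true ∷ y) with ∪-∣∣ p r y
  ... | ih rewrite ℕₚ.+-suc ∣ (p ∪ r) ∪ y ∣ ∣ p ∩ y ∣ with r₀
  ... | true  rewrite ℕₚ.+-suc ∣ p ∣ ∣ r ∪ y ∣ = s≤s (s≤s ih)
  ... | false rewrite ℕₚ.+-suc ∣ p ∣ ∣ r ∪ y ∣ = s≤s (s≤s ih)
  ∪-∣∣ (true ∷ p) (true ∷ r)  (false ∷ y) rewrite ℕₚ.+-suc ∣ p ∣ ∣ r ∪ y ∣ = s≤s (ℕₚ.m≤n⇒m≤1+n (∪-∣∣ p r y))
  ∪-∣∣ (true ∷ p) (false ∷ r) (false ∷ y) = s≤s (∪-∣∣ p r y)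
  ∪-∣∣ (false ∷ p) (true ∷ r)  (true ∷ y)  rewrite ℕₚ.+-suc ∣ p ∣ ∣ r ∪ y ∣ = s≤s (∪-∣∣ p r y)
  ∪-∣∣ (false ∷ p) (true ∷ r)  (false ∷ y) rewrite ℕₚ.+-suc ∣ p ∣ ∣ r ∪ y ∣ = s≤s (∪-∣∣ p r y)
  ∪-∣∣ (false ∷ p) (false ∷ r) (true ∷ y)  rewrite ℕₚ.+-suc ∣ p ∣ ∣ r ∪ y ∣ = s≤s (∪-∣∣ p r y)
  ∪-∣∣ (false ∷ p) (false ∷ r) (false ∷ y) = ∪-∣∣ p r y

  -- Counting `Y` as part of the union drives the induction: each `S a` has at least `k` of its `r`
  -- points in `Y` already and adds at most `r ∸ k` new ones.
  ⋃-bound : ∀ {n r k} e (S : Fin e → Subset n) (Y : Subset n) → (∀ a → ∣ S a ∣ ≡ r) → (∀ a → k ℕ.≤ ∣ S a ∩ Y ∣) →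
    ∣ ⋃ (List.tabulate S) ∪ Y ∣ ℕ.≤ e ℕ.* (r ℕ.∸ k) ℕ.+ ∣ Y ∣
  ⋃-bound zero S Y _ _ = ℕₚ.≤-reflexive (cong ∣_∣ (∪-identityˡ Y))
  ⋃-bound {r = r} {k} (suc e) S Y size meet = begin
    ∣ (S₀ ∪ R) ∪ Y ∣                                  ≤⟨ ℕₚ.m+n≤o⇒m≤o∸n ∣ (S₀ ∪ R) ∪ Y ∣ (∪-∣∣ S₀ R Y) ⟩
    (∣ S₀ ∣ ℕ.+ ∣ R ∪ Y ∣) ℕ.∸ ∣ S₀ ∩ Y ∣              ≤⟨ ℕₚ.∸-monoʳ-≤ (∣ S₀ ∣ ℕ.+ ∣ R ∪ Y ∣) (meet zero) ⟩
    (∣ S₀ ∣ ℕ.+ ∣ R ∪ Y ∣) ℕ.∸ k                       ≡⟨ cong (λ s → (s ℕ.+ ∣ R ∪ Y ∣) ℕ.∸ k) (size zero) ⟩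
    (r ℕ.+ ∣ R ∪ Y ∣) ℕ.∸ k                            ≡⟨ ℕₚ.+-∸-comm ∣ R ∪ Y ∣ k≤r ⟩
    (r ℕ.∸ k) ℕ.+ ∣ R ∪ Y ∣                            ≤⟨ ℕₚ.+-monoʳ-≤ (r ℕ.∸ k)
                                                           (⋃-bound e (λ a → S (suc a)) Y (λ a → size (suc a)) (λ a → meet (suc a))) ⟩
    (r ℕ.∸ k) ℕ.+ (e ℕ.* (r ℕ.∸ k) ℕ.+ ∣ Y ∣)          ≡⟨ sym (ℕₚ.+-assoc (r ℕ.∸ k) (e ℕ.* (r ℕ.∸ k)) ∣ Y ∣) ⟩
    suc e ℕ.* (r ℕ.∸ k) ℕ.+ ∣ Y ∣                      ∎
    where
    open ℕₚ.≤-Reasoning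
    S₀ = S zero
    R = ⋃ (List.tabulate (λ a → S (suc a)))
    k≤r : k ℕ.≤ r
    k≤r = ℕₚ.≤-trans (meet zero) (subst (∣ S₀ ∩ Y ∣ ℕ.≤_) (size zero) (p⊆q⇒∣p∣≤∣q∣ {p = S₀ ∩ Y} {q = S₀} (p∩q⊆p S₀ Y)))

  injection-size : ∀ {n t} (g : Subset t) (y : Fin t → Fin n) → (∀ {i j} → y i ≡ y j → i ≡ j) →
    ∀ (P : Subset n) → (∀ {i} → i ∈ g → y i ∈ P) → ∣ g ∣ ℕ.≤ ∣ P ∣
  injection-size [] y inj P h = z≤n
  injection-size (false ∷ g) y inj P h =
    injection-size g (λ i → y (suc i)) (λ e → Finₚ.suc-injective (inj e)) P (λ i∈g → h (there i∈g))
  injection-size (true ∷ g) y inj P h = ℕₚ.≤-trans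
    (s≤s (injection-size g (λ i → y (suc i)) (λ e → Finₚ.suc-injective (inj e)) (P ∖ y zero)
      (λ i∈g → x∈p∧x≢y⇒x∈p-y (h (there i∈g)) (λ e → Finₚ.0≢1+n (sym (inj e))))))
    (x∈p⇒∣p-x∣<∣p∣ (h here))

  range : ∀ {n t} → Vec (Fin n) t → Subset n
  range []       = ∅
  range (x ∷ xs) = ⁅ x ⁆ ∪ range xs

  ∈-range : ∀ {n t} (x : Vec (Fin n) t) i → lookup x i ∈ range x
  ∈-range (x ∷ xs) zero    = x∈p∪q⁺ (inj₁ (x∈⁅x⁆ x))
  ∈-range (x ∷ xs) (suc i) = x∈p∪q⁺ (inj₂ (∈-range xs i))

  range-size : ∀ {n t} (x : Vec (Fin n) t) → ∣ range x ∣ ℕ.≤ t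
  range-size {n} []   = ℕₚ.≤-reflexive (∣⊥∣≡0 n)
  range-size (x ∷ xs) = ℕₚ.≤-trans (lem x (range xs)) (s≤s (range-size xs))
    where
    lem : ∀ {n} (x : Fin n) (P : Subset n) → ∣ ⁅ x ⁆ ∪ P ∣ ℕ.≤ suc ∣ P ∣
    lem zero (b ∷ P) = s≤s (ℕₚ.≤-trans (ℕₚ.≤-reflexive (cong ∣_∣ (∪-identityˡ P))) (∣p∣≤∣x∷p∣ b P))
    lem (suc x) (true ∷ P)  = s≤s (lem x P)
    lem (suc x) (false ∷ P) = lem x P


  -- From hypergraphs to tuples

  pow : ℚ → ℕ → ℚ
  pow w zero    = 1ℚ
  pow w (suc k) = w * pow w k

  0≤pow : ∀ {w} → 0ℚ ≤ w → ∀ k → 0ℚ ≤ pow w k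
  0≤pow h zero    = 0≤1
  0≤pow h (suc k) = 0≤* h (0≤pow h k)

  pow-antitone : ∀ {w} → 0ℚ ≤ w → w ≤ 1ℚ → ∀ {j k} → j ℕ.≤ k → pow w k ≤ pow w j
  pow-antitone 0≤w w≤1 {k = zero}  z≤n = ≤-refl
  pow-antitone 0≤w w≤1 {k = suc k} z≤n = ≤-trans (*-≤1 (0≤pow 0≤w k) w≤1) (pow-antitone 0≤w w≤1 {k = k} z≤n)
  pow-antitone 0≤w w≤1 (s≤s h) = mulˡ 0≤w (pow-antitone 0≤w w≤1 h)

  pow-inverse : ∀ {w n} → w * ι n ≡ 1ℚ → ∀ k → pow w k * ι (n ℕ.^ k) ≡ 1ℚ
  pow-inverse h zero = refl
  pow-inverse {w} {n} h (suc k) = begin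
    w * pow w k * ι (n ℕ.* n ℕ.^ k)         ≡⟨ cong (w * pow w k *_) (ι-* n (n ℕ.^ k)) ⟩
    w * pow w k * (ι n * ι (n ℕ.^ k))       ≡⟨ lem w (pow w k) (ι n) (ι (n ℕ.^ k)) ⟩
    w * ι n * (pow w k * ι (n ℕ.^ k))       ≡⟨ cong₂ _*_ h (pow-inverse h k) ⟩
    1ℚ ∎
    where
    open ≡-Reasoning
    lem : ∀ a b c d → a * b * (c * d) ≡ a * c * (b * d)
    lem = solve-∀ ℚ-ring

  sumL-cong : ∀ {A : Set} {u v : A → ℚ} as → (∀ a → u a ≡ v a) → sumL u as ≡ sumL v as
  sumL-cong []       h = refl
  sumL-cong (a ∷ as) h = cong₂ _+_ (h a) (sumL-cong as h)

  sumL-* : ∀ {A : Set} (u : A → ℚ) c as → sumL (λ a → u a * c) as ≡ sumL u as * c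
  sumL-* u c []       = sym (*-zeroˡ c)
  sumL-* u c (a ∷ as) = trans (cong (u a * c +_) (sumL-* u c as)) (sym (*-distribʳ-+ c (u a) (sumL u as)))

  sumL-const : ∀ {A : Set} c (as : List A) → sumL (λ _ → c) as ≡ ι (length as) * c
  sumL-const c as = trans (sumL-cong as (λ _ → sym (*-identityˡ c))) (trans (sumL-* (λ _ → 1ℚ) c as) (cong (_* c) (sumL-1 as)))

  sumL-map : ∀ {A B : Set} (u : B → ℚ) (f : A → B) as → sumL u (List.map f as) ≡ sumL (λ a → u (f a)) as
  sumL-map u f []       = refl
  sumL-map u f (a ∷ as) = cong (u (f a) +_) (sumL-map u f as)

  sumL-count : ∀ {A : Set} (b : A → Bool) as → sumL (λ a → ⟦ b a ⟧) as ≡ ι (length (filter (λ a → b a Boolₚ.≟ true) as))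
  sumL-count b [] = refl
  sumL-count b (a ∷ as) with b a
  ... | true  = cong (1ℚ +_) (sumL-count b as)
  ... | false = trans (+-identityˡ _) (sumL-count b as)

  anyᵇ : ∀ {A : Set} → (A → Bool) → List A → Bool
  anyᵇ p []       = false
  anyᵇ p (a ∷ as) = p a ∨ anyᵇ p as

  anyᵇ-∈ : ∀ {A : Set} (p : A → Bool) {as a} → a ∈ˡ as → p a ≡ true → anyᵇ p as ≡ true
  anyᵇ-∈ p (here refl) e rewrite e = refl
  anyᵇ-∈ p {b ∷ as} (there a∈) e with p b
  ... | true  = refl
  ... | false = anyᵇ-∈ p a∈ e

  anyᵇ-sum : ∀ {A : Set} (p : A → Bool) as → ⟦ anyᵇ p as ⟧ ≤ sumL (λ a → ⟦ p a ⟧) as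
  anyᵇ-sum p [] = ≤-refl
  anyᵇ-sum p (a ∷ as) with p a
  ... | true  = ≤-by (sumL (λ b → ⟦ p b ⟧) as)
    (≤-trans (0≤⟦⟧ (anyᵇ p as)) (anyᵇ-sum p as)) refl
  ... | false = subst (⟦ anyᵇ p as ⟧ ≤_) (sym (+-identityˡ _)) (anyᵇ-sum p as)

  module Agreement (ν : ℕ) where
    open Expectation ν

    w : ℚ
    w = 1/ι (suc ν)

    0≤w : 0ℚ ≤ w
    0≤w = <⇒≤ (0<1/ι (suc ν))

    agreeᵇ : ∀ {t} → Subset t → X t → X t → Bool
    agreeᵇ []          []       []       = true
    agreeᵇ (true ∷ g)  (x ∷ xs) (y ∷ ys) = does (x Finₚ.≟ y) ∧ agreeᵇ g xs ys
    agreeᵇ (false ∷ g) (x ∷ xs) (y ∷ ys) = agreeᵇ g xs ys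

    module _ {t : ℕ} where
      open Dependence ν t public using (Agree; Dep)

    agreeᵇ⇒ : ∀ {t} (g : Subset t) (x y : X t) → agreeᵇ g x y ≡ true → Agree g x y
    agreeᵇ⇒ (true ∷ g) (x ∷ xs) (y ∷ ys) e here = does⇒ (x Finₚ.≟ y) (∧-left e)
    agreeᵇ⇒ (true ∷ g) (x ∷ xs) (y ∷ ys) e (there i∈) =
      agreeᵇ⇒ g xs ys (∧-right {does (x Finₚ.≟ y)} e) i∈
    agreeᵇ⇒ (false ∷ g) (x ∷ xs) (y ∷ ys) e (there i∈) = agreeᵇ⇒ g xs ys e i∈

    ⇒agreeᵇ : ∀ {t} (g : Subset t) (x y : X t) → Agree g x y → agreeᵇ g x y ≡ true
    ⇒agreeᵇ [] [] [] ag = refl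
    ⇒agreeᵇ (true ∷ g)  (x ∷ xs) (y ∷ ys) ag =
      ∧-true (dec-true (x Finₚ.≟ y) (ag here)) (⇒agreeᵇ g xs ys (λ i∈ → ag (there i∈)))
    ⇒agreeᵇ (false ∷ g) (x ∷ xs) (y ∷ ys) ag = ⇒agreeᵇ g xs ys (λ i∈ → ag (there i∈))

    agreeᵇ-dep : ∀ {t} (g : Subset t) (y : X t) → Dep g (λ x → agreeᵇ g x y)
    agreeᵇ-dep g y {x} {x′} ag = bool-ext
      (λ e → ⇒agreeᵇ g x′ y (λ i∈ → trans (sym (ag i∈)) (agreeᵇ⇒ g x y e i∈)))
      (λ e → ⇒agreeᵇ g x y (λ i∈ → trans (ag i∈) (agreeᵇ⇒ g x′ y e i∈)))

    E-agree : ∀ {t} (g : Subset t) (y : X t) → E (λ x → ⟦ agreeᵇ g x y ⟧) ≡ pow w ∣ g ∣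
    E-agree [] [] = refl
    E-agree {suc t} (true ∷ g) (y ∷ ys) = trans (avg-single (λ v → E (λ xs → ⟦ does (v Finₚ.≟ y) ∧ agreeᵇ g xs ys ⟧)) y off)
      (cong (w *_) (trans (E-cong (λ xs → cong (λ b → ⟦ b ∧ agreeᵇ g xs ys ⟧) (dec-true (y Finₚ.≟ y) refl))) (E-agree g ys)))
      where
      off : ∀ v → v ≢ y → E (λ xs → ⟦ does (v Finₚ.≟ y) ∧ agreeᵇ g xs ys ⟧) ≡ 0ℚ
      off v v≢y with v Finₚ.≟ y
      ... | yes e = ⊥-elim (v≢y e)
      ... | no _  = E-const {t} 0ℚ
    E-agree (false ∷ g) (y ∷ ys) = trans (avg-const _) (E-agree g ys)

    E-sumL : ∀ {t} {A : Set} (u : A → X t → ℚ) as → E (λ x → sumL (λ a → u a x) as) ≡ sumL (λ a → E (u a)) as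
    E-sumL {t} u []   = E-const {t} 0ℚ
    E-sumL u (a ∷ as) = trans (E-+ (u a) (λ x → sumL (λ b → u b x) as)) (cong (E (u a) +_) (E-sumL u as))

  largeSubsets : ∀ t → ℕ → List (Subset t)
  largeSubsets t k = filter (λ h → suc k ℕ.≤? ∣ h ∣) (subsets t)

  module Reduction (ν t k e r : ℕ) (1≤k : 1 ℕ.≤ k) (k≤t : k ℕ.≤ t) (t≤r : t ℕ.≤ r) (e≤ : e ℕ.≤ t C k)
                   (H : Hypergraph (suc ν) r) (free : GFree (e ℕ.* (r ℕ.∸ k) ℕ.+ t) e H) where
    open Expectation ν
    open Agreement ν
    open Counting ν t
    open Regularity ν t

    M : ℕ
    M = numEdges H

    S : Fin M → Subset (suc ν)
    S = List.lookup (edges H)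

    S-size : ∀ j → ∣ S j ∣ ≡ r
    S-size j = All.lookup (uniform H) (∈-lookup j)

    τ : Fin M → X t
    τ j = Vec.tabulate (λ i → enumerate (S j) (inject≤ i (subst (t ℕ.≤_) (sym (S-size j)) t≤r)))

    τ-∈ : ∀ j i → lookup (τ j) i ∈ S j
    τ-∈ j i = subst (_∈ S j) (sym (Vecₚ.lookup∘tabulate _ i)) (enumerate-∈ (S j) _)

    τ-injective : ∀ j {a b} → lookup (τ j) a ≡ lookup (τ j) b → a ≡ b
    τ-injective j {a} {b} e = Finₚ.inject≤-injective _ _ a b (enumerate-injective (S j)
      (trans (sym (Vecₚ.lookup∘tabulate _ a)) (trans e (Vecₚ.lookup∘tabulate _ b))))

    -- Each of the `e` edges has at least `k` vertices among the at most `t` entries of `x`, so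
    -- together they contradict freeness. The sets `g a` may coincide, as in the degree bound, or be
    -- distinct, as for the final tuple.
    clash : (x : X t) (σ : Fin e → Fin M) → Injective _≡_ _≡_ σ → (g : Fin e → Subset t) → (∀ a → ∣ g a ∣ ≡ k) →
      (∀ a → Agree (g a) x (τ (σ a))) → ⊥
    clash x σ σ-inj g g-size ag = ℕₚ.<⇒≱ (free σ σ-inj) (begin
      ∣ ⋃ (List.tabulate (λ a → S (σ a))) ∣
        ≤⟨ ∣p∣≤∣p∪q∣ (⋃ (List.tabulate (λ a → S (σ a)))) (range x) ⟩
      ∣ ⋃ (List.tabulate (λ a → S (σ a))) ∪ range x ∣
        ≤⟨ ⋃-bound e (λ a → S (σ a)) (range x) (λ a → S-size (σ a)) meet ⟩
      e ℕ.* (r ℕ.∸ k) ℕ.+ ∣ range x ∣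
        ≤⟨ ℕₚ.+-monoʳ-≤ (e ℕ.* (r ℕ.∸ k)) (range-size x) ⟩
      e ℕ.* (r ℕ.∸ k) ℕ.+ t ∎)
      where
      open ℕₚ.≤-Reasoning
      meet : ∀ a → k ℕ.≤ ∣ S (σ a) ∩ range x ∣
      meet a = subst (ℕ._≤ ∣ S (σ a) ∩ range x ∣) (g-size a) (injection-size (g a) (lookup (τ (σ a))) (τ-injective (σ a)) _
        (λ {i} i∈ → x∈p∩q⁺ (τ-∈ (σ a) i , subst (_∈ range x) (ag a i∈) (∈-range x i))))

    degree : ∀ {g} → ∣ g ∣ ≡ k → ∀ x → sumL (λ j → ⟦ agreeᵇ g x (τ j) ⟧) (allFin M) ≤ ι e
    degree {g} g-size x = subst (_≤ ι e) (sym (sumL-count (λ j → agreeᵇ g x (τ j)) (allFin M))) (ι-mono few)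
      where
      meets? = λ j → agreeᵇ g x (τ j) Boolₚ.≟ true
      js = filter meets? (allFin M)
      few : length js ℕ.≤ e
      few with length js ℕ.≤? e
      ... | yes p = p
      ... | no ¬p = ⊥-elim (clash x (λ a → List.lookup js (inject≤ a e≤js))
        (λ {a} {b} eq → Finₚ.inject≤-injective _ _ a b (lookup-injective (Uniqueₚ.filter⁺ meets? (Uniqueₚ.allFin⁺ M)) eq))
        (λ _ → g) (λ _ → g-size)
        (λ a → agreeᵇ⇒ g x _ (All.lookup (Allₚ.all-filter meets? (allFin M)) (∈-lookup (inject≤ a e≤js)))))
        where
        e≤js : e ℕ.≤ length js
        e≤js = ℕₚ.<⇒≤ (ℕₚ.≰⇒> ¬p)

    -- Double counting of pairs of an edge and a tuple agreeing on `g`: every edge agrees with a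
    -- proportion `pow w k` of the tuples, and every tuple with at most `e` edges.
    edge-mass : ∀ {g} → ∣ g ∣ ≡ k → ∀ {B : X t → Bool} → Dep g B →
      sumL (λ j → ⟦ B (τ j) ⟧) (allFin M) * pow w k ≤ ι e * Pr B
    edge-mass {g} g-size {B} B-dep = begin
      sumL (λ j → ⟦ B (τ j) ⟧) (allFin M) * pow w k
        ≡⟨ sym (sumL-* (λ j → ⟦ B (τ j) ⟧) (pow w k) (allFin M)) ⟩
      sumL (λ j → ⟦ B (τ j) ⟧ * pow w k) (allFin M)
        ≡⟨ sumL-cong (allFin M) (λ j → trans (cong (⟦ B (τ j) ⟧ *_) (trans (cong (pow w) (sym g-size)) (sym (E-agree g (τ j)))))
             (sym (E-* ⟦ B (τ j) ⟧ (λ x → ⟦ agreeᵇ g x (τ j) ⟧)))) ⟩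
      sumL (λ j → E (λ x → ⟦ B (τ j) ⟧ * ⟦ agreeᵇ g x (τ j) ⟧)) (allFin M)
        ≡⟨ sym (E-sumL (λ j x → ⟦ B (τ j) ⟧ * ⟦ agreeᵇ g x (τ j) ⟧) (allFin M)) ⟩
      E (λ x → sumL (λ j → ⟦ B (τ j) ⟧ * ⟦ agreeᵇ g x (τ j) ⟧) (allFin M))
        ≡⟨ E-cong (λ x → trans (sumL-cong (allFin M) (λ j → same x j)) (sumL-* (λ j → ⟦ agreeᵇ g x (τ j) ⟧) ⟦ B x ⟧ (allFin M))) ⟩
      E (λ x → sumL (λ j → ⟦ agreeᵇ g x (τ j) ⟧) (allFin M) * ⟦ B x ⟧)
        ≤⟨ E-mono (λ x → mulʳ (0≤⟦⟧ (B x)) (degree {g} g-size x)) ⟩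
      E (λ x → ι e * ⟦ B x ⟧)
        ≡⟨ E-* (ι e) (λ x → ⟦ B x ⟧) ⟩
      ι e * Pr B ∎
      where
      open ≤-Reasoning
      same : ∀ x j → ⟦ B (τ j) ⟧ * ⟦ agreeᵇ g x (τ j) ⟧ ≡ ⟦ agreeᵇ g x (τ j) ⟧ * ⟦ B x ⟧
      same x j = trans (*-comm ⟦ B (τ j) ⟧ ⟦ agreeᵇ g x (τ j) ⟧)
        (⟦⟧-guard (agreeᵇ g x (τ j)) (λ eq → cong ⟦_⟧ (sym (B-dep (agreeᵇ⇒ g x (τ j) eq)))))

    edges≤ : ι M * pow w k ≤ ι e
    edges≤ with enlarge {t} ∅ (subst (ℕ._≤ k) (sym (∣⊥∣≡0 t)) z≤n) k≤t
    ... | g , _ , g-size = begin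
      ι M * pow w k
        ≡⟨ cong (_* pow w k) (trans (cong ι (sym (Listₚ.length-tabulate {n = M} (λ j → j)))) (sym (sumL-1 (allFin M)))) ⟩
      sumL (λ _ → 1ℚ) (allFin M) * pow w k
        ≤⟨ edge-mass {g} g-size {λ _ → true} (λ _ → refl) ⟩
      ι e * Pr (λ _ → true)
        ≡⟨ trans (cong (ι e *_) (E-const {t} 1ℚ)) (*-identityʳ (ι e)) ⟩
      ι e ∎
      where open ≤-Reasoning

    T : List (X t)
    T = List.map τ (allFin M)

    -- The factor `suc ν ^ k` appears because `T` is counted rather than given total mass 1.
    K : ℚ
    K = ι e * ι (suc ν ℕ.^ k)

    0≤K : 0ℚ ≤ K
    0≤K = 0≤* (0≤ι e) (0≤ι (suc ν ℕ.^ k))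

    -- An event on at most `k` coordinates is also an event on `k` coordinates, where the degree
    -- bound applies.
    dominated : ∀ {g} → Small k g → ∀ {B : X t → Bool} → Dep g B → sumL (λ x → ⟦ B x ⟧) T ≤ K * Pr B
    dominated {g} (_ , g≤k) {B} B-dep with enlarge g g≤k k≤t
    ... | h , g⊆h , h-size = begin
      sumL (λ x → ⟦ B x ⟧) T
        ≡⟨ sumL-map (λ x → ⟦ B x ⟧) τ (allFin M) ⟩
      Σ₀
        ≡⟨ sym (trans (cong (Σ₀ *_) (pow-inverse (1/ι-inv ν) k)) (*-identityʳ Σ₀)) ⟩
      Σ₀ * (pow w k * ι (suc ν ℕ.^ k))
        ≡⟨ sym (*-assoc Σ₀ (pow w k) _) ⟩
      Σ₀ * pow w k * ι (suc ν ℕ.^ k)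
        ≤⟨ mulʳ (0≤ι (suc ν ℕ.^ k)) (edge-mass {h} h-size {B} (λ ag → B-dep (λ i∈ → ag (g⊆h i∈)))) ⟩
      ι e * Pr B * ι (suc ν ℕ.^ k)
        ≡⟨ lem (ι e) (Pr B) (ι (suc ν ℕ.^ k)) ⟩
      K * Pr B ∎
      where
      open ≤-Reasoning
      Σ₀ = sumL (λ j → ⟦ B (τ j) ⟧) (allFin M)
      lem : ∀ a b c → a * b * c ≡ a * c * b
      lem = solve-∀ ℚ-ring

    shadow : Subset t → X t → Bool
    shadow g x = anyᵇ (λ j → agreeᵇ g x (τ j)) (allFin M)

    shadow-dep : ∀ g → Dep g (shadow g)
    shadow-dep g {x} {y} ag = go (allFin M)
      where
      go : ∀ js → anyᵇ (λ j → agreeᵇ g x (τ j)) js ≡ anyᵇ (λ j → agreeᵇ g y (τ j)) js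
      go []       = refl
      go (j ∷ js) = cong₂ _∨_ (agreeᵇ-dep g (τ j) ag) (go js)

    anyᵇ-witness : ∀ {A : Set} (p : A → Bool) as → anyᵇ p as ≡ true → ∃ λ a → p a ≡ true
    anyᵇ-witness p (a ∷ as) e with p a in eq
    ... | true  = a , eq
    ... | false = anyᵇ-witness p as e

    -- The initial two colours record whether some edge tuple looks like `x` on `g`; sharing the
    -- colours of an element of `T` therefore forces such an edge for every small `g`.
    colour : Colouring
    colour g x = if shadow g x then 1 else 0

    colour-valid : Valid colour 2
    colour-valid = record { dep = λ g ag → cong (λ b → if b then 1 else 0) (shadow-dep g ag) ; bound = bound₂ }
      where
      bound₂ : ∀ g x → colour g x ℕ.< 2
      bound₂ g x with shadow g x
      ... | true  = ℕₚ.≤-refl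
      ... | false = s≤s z≤n

    degenerate : X t → Bool
    degenerate x = anyᵇ (λ h → shadow h x) (largeSubsets t k)

    -- With n vertices there are at most e n^k edges, and agreement with a fixed one on more than k
    -- coordinates has probability at most n^-(k+1). Each large set thus contributes at most e / n.
    Pr-degenerate : Pr degenerate ≤ ι (length (largeSubsets t k)) * (w * ι e)
    Pr-degenerate = begin
      Pr degenerate
        ≤⟨ E-mono (λ x → anyᵇ-sum (λ h → shadow h x) (largeSubsets t k)) ⟩
      E (λ x → sumL (λ h → ⟦ shadow h x ⟧) (largeSubsets t k))
        ≡⟨ E-sumL (λ h x → ⟦ shadow h x ⟧) (largeSubsets t k) ⟩
      sumL (λ h → Pr (shadow h)) (largeSubsets t k)
        ≤⟨ sumL-mono (largeSubsets t k) (λ h h∈ → each h (proj₂ (∈-filter⁻ (λ h → suc k ℕ.≤? ∣ h ∣) {xs = subsets t} h∈))) ⟩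
      sumL (λ _ → w * ι e) (largeSubsets t k)
        ≡⟨ sumL-const (w * ι e) (largeSubsets t k) ⟩
      ι (length (largeSubsets t k)) * (w * ι e) ∎
      where
      open ≤-Reasoning
      lem : ∀ m w p → m * (w * p) ≡ w * (m * p)
      lem = solve-∀ ℚ-ring
      each : ∀ h → suc k ℕ.≤ ∣ h ∣ → Pr (shadow h) ≤ w * ι e
      each h k<h = begin
        Pr (shadow h)
          ≤⟨ E-mono (λ x → anyᵇ-sum (λ j → agreeᵇ h x (τ j)) (allFin M)) ⟩
        E (λ x → sumL (λ j → ⟦ agreeᵇ h x (τ j) ⟧) (allFin M))
          ≡⟨ E-sumL (λ j x → ⟦ agreeᵇ h x (τ j) ⟧) (allFin M) ⟩
        sumL (λ j → E (λ x → ⟦ agreeᵇ h x (τ j) ⟧)) (allFin M)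
          ≡⟨ sumL-cong (allFin M) (λ j → E-agree h (τ j)) ⟩
        sumL (λ _ → pow w ∣ h ∣) (allFin M)
          ≡⟨ sumL-const (pow w ∣ h ∣) (allFin M) ⟩
        ι (length (allFin M)) * pow w ∣ h ∣
          ≡⟨ cong (λ m → ι m * pow w ∣ h ∣) (Listₚ.length-tabulate {n = M} (λ j → j)) ⟩
        ι M * pow w ∣ h ∣
          ≤⟨ mulˡ (0≤ι M) (pow-antitone 0≤w (1/ι≤1 ν) k<h) ⟩
        ι M * (w * pow w k)
          ≡⟨ lem (ι M) w (pow w k) ⟩
        w * (ι M * pow w k)
          ≤⟨ mulˡ 0≤w edges≤ ⟩
        w * ι e ∎

    sub : Fin e → Subset t
    sub a = List.lookup (ksubsets t k) (inject≤ a (subst (e ℕ.≤_) (sym (length-ksubsets t k)) e≤))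

    sub-size : ∀ a → ∣ sub a ∣ ≡ k
    sub-size a = All.lookup (ksubsets-size t k) (∈-lookup _)

    sub-injective : ∀ {a b} → sub a ≡ sub b → a ≡ b
    sub-injective {a} {b} eq = Finₚ.inject≤-injective _ _ a b (lookup-injective (ksubsets-unique t k) eq)

    sub-small : ∀ a → Small k (sub a)
    sub-small a = ne , ℕₚ.≤-reflexive (sub-size a)
      where
      ne : Nonempty (sub a)
      ne with nonempty? (sub a)
      ... | yes p = p
      ... | no ¬p = ⊥-elim (ℕₚ.<⇒≢ 1≤k (trans (sym (∣⊥∣≡0 t)) (trans (sym (cong ∣_∣ (Empty-unique ¬p))) (sub-size a))))

    -- On each of the `e` chosen k-subsets, `x` looks like some edge. If `x` is not degenerate these
    -- edges are distinct and `clash` applies.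
    copy⇒degenerate : ∀ {y} → y ∈ˡ T → ∀ x → (∀ {f} → f ∈ˡ smallSubsets t k → colour f x ≡ colour f y) → degenerate x ≡ true
    copy⇒degenerate {y} y∈T x same with degenerate x in eq
    ... | true  = refl
    ... | false = ⊥-elim (clash x σ σ-injective sub sub-size (λ a → agreeᵇ⇒ (sub a) x (τ (σ a)) (proj₂ (hit a))))
      where
      origin : ∃ λ j → y ≡ τ j
      origin with ∈-map⁻ τ y∈T
      ... | j , _ , e = j , e
      in-shadow : ∀ {b b′} → (if b then 1 else 0) ≡ (if b′ then 1 else 0) → b′ ≡ true → b ≡ true
      in-shadow {true}  e refl = refl
      hit : ∀ a → ∃ λ j → agreeᵇ (sub a) x (τ j) ≡ true
      hit a = anyᵇ-witness _ (allFin M) (in-shadow (same (∈-smallSubsets (sub-small a)))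
        (anyᵇ-∈ (λ j → agreeᵇ (sub a) y (τ j)) (∈-allFin (proj₁ origin))
          (⇒agreeᵇ (sub a) y (τ (proj₁ origin)) (λ {i} _ → cong (λ z → lookup z i) (proj₂ origin)))))
      σ : Fin e → Fin M
      σ a = proj₁ (hit a)
      σ-injective : Injective _≡_ _≡_ σ
      σ-injective {a} {b} σa≡σb with a Finₚ.≟ b
      ... | yes p = p
      -- One edge serving two different k-subsets would agree with `x` on their union, which has
      -- more than `k` elements.
      ... | no ¬p = ⊥-elim (false≢true (trans (sym eq) (anyᵇ-∈ (λ h → shadow h x)
          (∈-filter⁺ (λ h → suc k ℕ.≤? ∣ h ∣) (∈-subsets (sub a ∪ sub b))
            (∪-size (sub-size a) (sub-size b) (λ e → ¬p (sub-injective e))))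
          (anyᵇ-∈ (λ j → agreeᵇ (sub a ∪ sub b) x (τ j)) (∈-allFin (σ a)) (⇒agreeᵇ (sub a ∪ sub b) x (τ (σ a)) both)))))
        where
        false≢true : false ≢ true
        false≢true ()
        both : Agree (sub a ∪ sub b) x (τ (σ a))
        both i∈ with x∈p∪q⁻ (sub a) (sub b) i∈
        ... | inj₁ i∈a = agreeᵇ⇒ (sub a) x (τ (σ a)) (proj₂ (hit a)) i∈a
        ... | inj₂ i∈b = agreeᵇ⇒ (sub b) x (τ (σ a)) (subst (λ j → agreeᵇ (sub b) x (τ j) ≡ true) (sym σa≡σb) (proj₂ (hit b))) i∈b

    module _ {ρ : ℚ} (0<ρ : 0ℚ < ρ) (ρ≤1 : ρ ≤ 1ℚ) where
      open Parameters ρ 0<ρ ρ≤1 using (bound)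
      open Removal ρ 0<ρ ρ≤1 ν t using (removal)

      -- Copies have at least a proportion `δ` independent of n, and all of them are degenerate,
      -- which allows only a proportion of order 1 / n. In `bound`, `half` is the initial error and
      -- 2 the number of initial colours.
      dense⇒small : ι (length (smallSubsets t k)) * (K * ρ + K * ρ) < ι M →
        suc ν ℕ.> arch (ι (length (largeSubsets t k) ℕ.* e)) (half * bound (smallSubsets t k) half 2) → ⊥
      dense⇒small many big = removal (smallSubsets-chain t k) colour-valid T 0≤K
        (All.tabulate (λ g∈ {B} → dominated (proj₂ (∈-filter⁻ (small? k) {xs = subsets t} g∈)) {B}))
        (subst (ι (length (smallSubsets t k)) * (K * ρ + K * ρ) <_)
          (cong ι (sym (trans (Listₚ.length-map τ (allFin M)) (Listₚ.length-tabulate {n = M} (λ j → j))))) many)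
        (λ y y∈T lower → <-irrefl refl (contra (≤-trans (lower degenerate (copy⇒degenerate y∈T)) Pr-degenerate)))
        where
        δ = half * bound (smallSubsets t k) half 2
        0<δ : 0ℚ < δ
        0<δ = 0<* (0<1/ι 2) (Parameters.0<bound ρ 0<ρ ρ≤1 (smallSubsets t k) (0<1/ι 2) 2)
        q = length (largeSubsets t k) ℕ.* e
        contra : δ ≤ ι (length (largeSubsets t k)) * (w * ι e) → ι q < ι q
        contra h = begin-strict
          ι q
            <⟨ arch-< (ι q) 0<δ ⟩
          ι (arch (ι q) δ) * δ
            ≤⟨ mulʳ (<⇒≤ 0<δ) (ι-mono (ℕₚ.<⇒≤ big)) ⟩
          ι (suc ν) * δ
            ≤⟨ mulˡ (0≤ι (suc ν)) h ⟩
          ι (suc ν) * (ι (length (largeSubsets t k)) * (w * ι e))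
            ≡⟨ lem (ι (suc ν)) (ι (length (largeSubsets t k))) w (ι e) ⟩
          w * ι (suc ν) * (ι (length (largeSubsets t k)) * ι e)
            ≡⟨ trans (cong (_* (ι (length (largeSubsets t k)) * ι e)) (1/ι-inv ν)) (trans (*-identityˡ _) (sym (ι-* (length (largeSubsets t k)) e))) ⟩
          ι q ∎
          where
          open ≤-Reasoning
          lem : ∀ a b c d → a * (b * (c * d)) ≡ c * a * (b * d)
          lem = solve-∀ ℚ-ring

  -- Choice of the constants

  module Threshold (t k e m : ℕ) where
    -- More than n^k / m edges must outnumber the exceptional ones, of which there are at most 2 e
    -- n^k `ρ` per index set. Solving for `ρ` gives 1 / `q`; `suc q` makes the inequality safe for
    -- `q = 0`.
    q : ℕ
    q = (length (smallSubsets t k) ℕ.+ length (smallSubsets t k)) ℕ.* e ℕ.* m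

    ρ : ℚ
    ρ = 1/ι (suc q)

    0<ρ : 0ℚ < ρ
    0<ρ = 0<1/ι (suc q)

    open Parameters ρ 0<ρ (1/ι≤1 q)

    threshold : ℕ
    threshold = suc (arch (ι (length (largeSubsets t k) ℕ.* e)) (half * bound (smallSubsets t k) (half) 2))

    many-edges : ∀ {M N} → ¬ (m ℕ.* M ℕ.≤ N) →
      ι (length (smallSubsets t k)) * (ι e * ι N * ρ + ι e * ι N * ρ) < ι M
    many-edges {M} {N} h = *-cancelˡ-<-nonNeg (ι m) {{nonNegative (0≤ι m)}} (begin-strict
      ι m * (ι G * (ι e * ι N * ρ + ι e * ι N * ρ))   ≡⟨ lem (ι m) (ι G) (ι e) (ι N) ρ ⟩
      (ι G + ι G) * ι e * ι m * ρ * ι N               ≡⟨ cong (λ z → z * ρ * ι N) (sym ι-q) ⟩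
      ι q * ρ * ι N                                   ≤⟨ mulʳ (0≤ι N) qρ≤1 ⟩
      1ℚ * ι N                                        ≡⟨ *-identityˡ (ι N) ⟩
      ι N                                             <⟨ ι-mono-< (ℕₚ.≰⇒> h) ⟩
      ι (m ℕ.* M)                                     ≡⟨ ι-* m M ⟩
      ι m * ι M                                       ∎)
      where
      open ≤-Reasoning
      G = length (smallSubsets t k)
      lem : ∀ m g e n r → m * (g * (e * n * r + e * n * r)) ≡ (g + g) * e * m * r * n
      lem = solve-∀ ℚ-ring
      ι-q : ι q ≡ (ι G + ι G) * ι e * ι m
      ι-q = trans (ι-* ((G ℕ.+ G) ℕ.* e) m) (cong (_* ι m) (trans (ι-* (G ℕ.+ G) e) (cong (_* ι e) (ι-+ G G))))
      qρ≤1 : ι q * ρ ≤ 1ℚ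
      qρ≤1 = subst (ι q * ρ ≤_) (trans (*-comm (ι (suc q)) ρ) (1/ι-inv q)) (mulʳ (<⇒≤ 0<ρ) (ι-mono (ℕₚ.n≤1+n q)))

-- Deduction of the little-o statement

open import Defs
open import Data.Nat using (ℕ; zero; suc; _+_; _*_; _∸_; _^_; _≤_; z≤n; s≤s; _≤?_)
open import Data.Nat.Combinatorics using (_C_)
open import Data.Nat.Properties using (<⇒≱; ≤-trans; m≤m+n; +-assoc)
open import Data.Empty using (⊥-elim)
open import Data.Product using (_,_)
open import Relation.Binary.PropositionalEquality using (_≡_; trans; cong; subst)
open import Relation.Nullary using (yes; no)
open HypergraphRemoval using (nC0≡1; 1/ι≤1; module Reduction; module Threshold)

theorem2 : (r k e i : ℕ) → 2 ≤ k + i + 1 → k + i + 1 ≤ r →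
    3 ≤ e → e ≤ (k + i + 1) C k →
    LittleO-f r (e * (r ∸ k) + k + i + 1) e k
-- For `k = 0` the binomial coefficient is 1, which leaves no room for `e`.
theorem2 r zero e i _ _ 3≤e e≤ m _ =
  ⊥-elim (<⇒≱ (s≤s (s≤s z≤n)) (≤-trans 3≤e (subst (e ≤_) (nC0≡1 (i + 1)) e≤)))
theorem2 r k@(suc _) e i _ t≤r _ e≤ m _ = threshold , sparse
  where
  t = k + i + 1
  open Threshold t k e m
  k≤t : k ≤ t
  k≤t = ≤-trans (m≤m+n k i) (m≤m+n (k + i) 1)
  regroup : e * (r ∸ k) + k + i + 1 ≡ e * (r ∸ k) + t
  regroup = trans (cong (_+ 1) (+-assoc (e * (r ∸ k)) k i)) (+-assoc (e * (r ∸ k)) (k + i) 1)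
  sparse : (n : ℕ) → threshold ≤ n → (H : Hypergraph n r) → GFree (e * (r ∸ k) + k + i + 1) e H →
    m * numEdges H ≤ n ^ k
  -- The case `n = 0` is excluded because `threshold` is a successor. Deciding the bound justifies
  -- the proof by contradiction on which the continuation-passing style relies.
  sparse (suc ν) big H free with m * numEdges H ≤? suc ν ^ k
  ... | yes p = p
  ... | no ¬p = ⊥-elim (Reduction.dense⇒small ν t k e r (s≤s z≤n) k≤t t≤r e≤ H
        (subst (λ v → GFree v e H) regroup free) 0<ρ (1/ι≤1 q) (many-edges ¬p) big)
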